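{- Every graph $G$ is $\lfloor\frac23 \operatorname{mad}(G)+1\rfloor$-choosable with clustering $57\lfloor\frac{2}{3}\operatorname{mad}(G)\rfloor+6$.
   Context: Graphs are finite and simple. $\operatorname{mad}(G)$ is the maximum, over all subgraphs $H$ of $G$, of the average degree of $H$. In a coloured graph the monochromatic subgraph is the spanning subgraph of edges whose endpoints have the same colour; its connected components are monochromatic components. A colouring has clustering $c$ if every monochromatic component has at most $c$ vertices. A $k$-list-assignment $L$ assigns to each vertex $v$ a set $L(v)$ of at least $k$ colours; an $L$-colouring colours each $v$ with a colour from $L(v)$. $G$ is $k$-choosable with clustering $c$ if for every $k$-list-assignment $L$, $G$ has an $L$-colouring with clustering $c$. -}

module Defs where

open import Data.Nat using (ℕ; zero; suc; _≤_)
open import Data.Bool using (Bool; true; false; _∧_)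
open import Data.Fin using (Fin)
open import Data.List using (List; allFin; map; length)
open import Data.Nat.ListAction using (sum)
open import Data.List.Membership.Propositional using (_∈_)
open import Data.List.Relation.Unary.All using (All)
open import Data.List.Relation.Unary.Unique.Propositional using (Unique)
open import Data.Integer using (ℤ; +_; ∣_∣)
open import Data.Rational using (ℚ; _/_; 0ℚ; 1ℚ; _*_; _+_; floor)
open import Data.Rational using () renaming (_≤_ to _≤ℚ_)
open import Data.Product using (Σ; _×_; ∃)
open import Relation.Binary.PropositionalEquality using (_≡_)

record Graph (n : ℕ) : Set where
  field
    adj   : Fin n → Fin n → Bool
    sym   : ∀ u v → adj u v ≡ adj v u
    irrefl : ∀ v → adj v v ≡ false
open Graph public

b2n : Bool → ℕ
b2n true  = 1
b2n false = 0

record Subgraph {n : ℕ} (G : Graph n) : Set where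
  field
    vert : Fin n → Bool
    edge : Fin n → Fin n → Bool
    edge-sym : ∀ u v → edge u v ≡ edge v u
    edge-adj : ∀ u v → edge u v ≡ true → adj G u v ≡ true
    edge-vert : ∀ u v → edge u v ≡ true → vert u ∧ vert v ≡ true
open Subgraph public

nVert : ∀ {n} {G : Graph n} → Subgraph G → ℕ
nVert H = sum (map (λ v → b2n (vert H v)) (allFin _))

degSum : ∀ {n} {G : Graph n} → Subgraph G → ℕ
degSum {n} H = sum (map (λ u → sum (map (λ v → b2n (edge H u v)) (allFin n))) (allFin n))

-- average degree (sum of degrees) / (number of vertices); 0 for the null graph
avgDeg' : ℕ → ℕ → ℚ
avgDeg' s zero = 0ℚ
avgDeg' s (suc k) = (+ s) / suc k

avgDeg : ∀ {n} {G : Graph n} → Subgraph G → ℚ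
avgDeg H = avgDeg' (degSum H) (nVert H)

IsMad : ∀ {n} → Graph n → ℚ → Set
IsMad G m = (Σ (Subgraph G) λ H → avgDeg H ≡ m) × (∀ (H : Subgraph G) → avgDeg H ≤ℚ m)

Colouring : ℕ → Set
Colouring n = Fin n → ℕ

data MonoConn {n : ℕ} (G : Graph n) (c : Colouring n) : Fin n → Fin n → Set where
  here : ∀ {u} → MonoConn G c u u
  step : ∀ {u v w} → MonoConn G c u v → adj G v w ≡ true → c v ≡ c w → MonoConn G c u w

HasClustering : ∀ {n} → Graph n → Colouring n → ℕ → Set
HasClustering {n} G c k =
  ∀ (u : Fin n) (xs : List (Fin n)) → Unique xs → All (MonoConn G c u) xs → length xs ≤ k

IsListAssignment : ∀ {n} → ℕ → (Fin n → List ℕ) → Set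
IsListAssignment k L = ∀ v → Unique (L v) × k ≤ length (L v)

ChoosableWithClustering : ∀ {n} → Graph n → ℕ → ℕ → Set
ChoosableWithClustering {n} G k c =
  ∀ (L : Fin n → List ℕ) → IsListAssignment k L →
    Σ (Colouring n) λ col → (∀ v → col v ∈ L v) × HasClustering G col c

twoThirds : ℚ
twoThirds = (+ 2) / 3

-- ⌊ q ⌋ as a natural number (used only for q ≥ 0)
⌊_⌋ℕ : ℚ → ℕ
⌊ q ⌋ℕ = ∣ floor q ∣

module Submission where

-- Let k = ⌊2m/3⌋ + 1, so that 4 e(X) < 3k∣X∣ for every nonempty vertex set X.  Take a largest B ⊆ X with
-- 4 e(B) + e(B, X ∖ B) ≥ 3k∣B∣, colour B recursively, and delete from the lists on A = X ∖ B the colours of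
-- neighbours in B.  Maximality of B makes G[A] sparse relative to the remaining lists:
-- Σ (deg + deg in S) < Σ 3 ∣list∣ over every nonempty S ⊆ A.
--
-- Colour G[A] with as few monochromatic edges as possible.  Taking S to be a single vertex, monochromatic
-- degrees are at most 2, so the monochromatic components are paths and cycles; taking S to be a path, a
-- monochromatic path on s vertices has at least s - 1 options, an option being a vertex together with another
-- colour that also occurs on exactly two of its neighbours.  Switching an option keeps the colouring optimal,
-- so its two targets are ends of path components.  Cut the long components into segments of about 18k vertices
-- and use Haxell's theorem to choose one option in each segment, avoiding conflicts: adjacent options with the
-- same new colour, and options attached to opposite ends of one component.  An option has at most 9(k - 1)
-- conflicts.  After switching, a monochromatic component is a piece of an old one between switched vertices, or
-- one switched vertex with two end pieces.

open import Defs
open import Data.Nat using (ℕ; zero; suc; _+_; _*_; _∸_; _≤_; _<_; z≤n; s≤s; pred; ⌊_/2⌋; ⌈_/2⌉)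
open import Data.Nat.Properties
open import Data.Nat.Tactic.RingSolver using (solve-∀)
open import Data.Nat.ListAction using (sum)
open import Data.Bool using (Bool; true; false; _∧_; _∨_; not; if_then_else_)
open import Data.Fin using (Fin; zero; suc)
import Data.Fin.Properties as Fin
open import Data.List using (List; []; _∷_; _++_; _∷ʳ_; [_]; map; length; allFin; filter; concatMap; take; drop; reverse; deduplicate; initLast; InitLast; _∷ʳ′_)
open import Data.List.Properties using (length-++; length-map; ++-assoc; ++-identityʳ; take++drop≡id; length-take; length-drop; ∷-injective; ∷-injectiveˡ; ∷-injectiveʳ; ≡-dec; unfold-reverse; ∷ʳ-injectiveʳ)
open import Data.List.Membership.Propositional using (_∈_; _∉_; find; lose)
open import Data.List.Membership.Propositional.Properties
  using (∈-map⁺; ∈-map⁻; ∈-++⁺ˡ; ∈-++⁺ʳ; ∈-++⁻; ∈-∃++; ∈-filter⁺; ∈-filter⁻; ∈-allFin; ∈-concatMap⁺; ∈-concatMap⁻; ∈-deduplicate⁺; ∈-deduplicate⁻)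
open import Data.List.Relation.Unary.Any as Any using (Any; here; there; any?)
open import Data.List.Relation.Unary.Any.Properties using (reverse⁺)
open import Data.List.Relation.Unary.All as All using (All; []; _∷_)
import Data.List.Relation.Unary.All.Properties as All
open import Data.List.Relation.Unary.AllPairs using ([]; _∷_)
open import Data.List.Relation.Unary.Linked as Linked using (Linked; []; [-]; _∷_)
open import Data.List.Relation.Unary.Unique.Propositional using (Unique)
import Data.List.Relation.Unary.Unique.Propositional.Properties as Unique
import Data.List.Relation.Unary.Unique.DecPropositional.Properties as DecUnique
open import Data.List.Relation.Binary.Permutation.Propositional using (_↭_; ↭-refl; ↭-sym; ↭-trans; prep; ↭⇒↭ₛ)
open import Data.List.Relation.Binary.Permutation.Propositional.Properties using (∈-resp-↭; ↭-length; shift; ↭-reverse)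
  renaming (map⁺ to ↭-map⁺)
import Data.List.Relation.Binary.Permutation.Setoid.Properties as Permₛ
open import Data.Vec as Vec using (Vec; []; _∷_)
import Data.Vec.Properties as Vec
import Data.Bool
import Data.Bool.Properties
import Data.Unit
import Data.Nat.Divisibility
open import Data.Product using (∃; ∃₂; _×_; _,_; proj₁; proj₂)
import Data.Product.Properties as Product
open import Data.Sum using (_⊎_; inj₁; inj₂; [_,_]′)
open import Data.Empty using (⊥)
open import Function using (_∘_; id; case_of_)
open import Relation.Nullary using (¬_; Dec; yes; no; does; ¬?; _×-dec_; _→-dec_; contradiction)
open import Relation.Nullary.Decidable using (map′; dec-true; dec-false; decidable-stable)
open import Relation.Unary using (Decidable)
open import Relation.Binary using (DecidableEquality)
open import Relation.Binary.PropositionalEquality using (_≡_; _≢_; refl; trans; cong; cong₂; subst; subst₂; _≗_; module ≡-Reasoning; setoid)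
  renaming (sym to ≡-sym)
open import Data.Nat.DivMod using (_/_; _%_; m%n<n; m≡m%n+[m/n]*n; m*n/o*n≡m/o; /-congʳ; n/n≡1; +-distrib-/-∣ʳ)
open import Data.Integer using (-[1+_]; ∣_∣)
import Data.Integer as ℤ
import Data.Integer.Properties as ℤ
import Data.Integer.DivMod as ℤ
open import Data.Rational using (ℚ; mkℚ; 1ℚ; toℚᵘ) renaming (_*_ to _*ℚ_; _+_ to _+ℚ_; _≤_ to _≤ℚ_)
open import Data.Rational.Properties using (toℚᵘ-fromℚᵘ; toℚᵘ-mono-≤; toℚᵘ-homo-+; toℚᵘ-homo-*)
open import Data.Rational.Unnormalised using (mkℚᵘ; _≃_; *≡*; *≤*)
import Data.Rational.Unnormalised.Properties as ℚᵘ

-- The weight of B is made to fit the deletion of colours. Adding S to B raises it by the sum over S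
-- of the degree in X, the degree in S and twice the degree into B; as the degree in X splits over A
-- and B, a neighbour in B is charged 3 in all. It deletes at most one colour, which counts 3 on the
-- right of the sparseness condition, so the two balance. The obstacle is simultaneity: options
-- harmless one by one can interfere when switched together, so conflicts are read off from the
-- original colouring alone. Two nonadjacent vertices attached to the same end need no conflict of
-- their own kind: optimality makes that end a component by itself, hence its own opposite end. For
-- the constants put κ = k - 1. Haxell's theorem needs classes of twice the largest number of
-- conflicts, so 18κ options, which a segment of 18κ + 3 vertices supplies. Leftovers of the cutting
-- are shared by both ends of a component, so a piece reaching an end has about one and a half
-- segments at most; two of them and a switched vertex have at most 54κ + 8 vertices, within 57κ + 6
-- once κ is positive.

-- Lists without repetition.

Unique-resp-↭ : ∀ {A : Set} {xs ys : List A} → xs ↭ ys → Unique xs → Unique ys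
Unique-resp-↭ p = Permₛ.Unique-resp-↭ (setoid _) (↭⇒↭ₛ p)

unique-⊆⇒length≤ : ∀ {A : Set} {xs ys : List A} → Unique xs → (∀ {x} → x ∈ xs → x ∈ ys) → length xs ≤ length ys
unique-⊆⇒length≤ {xs = []} _ _ = z≤n
unique-⊆⇒length≤ {xs = x ∷ xs} {ys = ys} (x# ∷ xs!) ⊆ys
  with ls , rs , refl ← ∈-∃++ (⊆ys (here refl)) = begin
    suc (length xs)         ≤⟨ s≤s (unique-⊆⇒length≤ xs! ⊆rest) ⟩
    suc (length (ls ++ rs)) ≡⟨ ↭-length (shift x ls rs) ⟨
    length (ls ++ x ∷ rs)   ∎
  where
  open ≤-Reasoning
  ⊆rest : ∀ {z} → z ∈ xs → z ∈ ls ++ rs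
  ⊆rest z∈ with ∈-resp-↭ (shift x ls rs) (⊆ys (there z∈))
  ... | here refl = contradiction refl (All.lookup x# z∈)
  ... | there z∈′ = z∈′

pigeonhole : ∀ {A : Set} {xs ys : List A} → DecidableEquality A → Unique xs → length ys < length xs → ∃ λ x → x ∈ xs × x ∉ ys
pigeonhole {xs = xs} {ys = ys} _≟_ xs! ys<xs with any? (λ x → ¬? (any? (x ≟_) ys)) xs
... | yes found = find found
... | no none = contradiction (unique-⊆⇒length≤ xs! ⊆ys) (<⇒≱ ys<xs)
  where
  ⊆ys : ∀ {x} → x ∈ xs → x ∈ ys
  ⊆ys {x} x∈ = decidable-stable (any? (x ≟_) ys) (λ x∉ → none (lose x∈ x∉))

-- Haxell's theorem on independent transversals.
module Transversals {O K : Set} (_≟_ : DecidableEquality O)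
  (N : O → List O) (Valid : O → Set)
  (N-sym : ∀ {a b} → Valid a → Valid b → b ∈ N a → a ∈ N b)
  (class : K → List O) (IsKey : K → Set)
  (class-disjoint : ∀ {k l o} → IsKey k → IsKey l → o ∈ class k → o ∈ class l → k ≡ l)
  (class-valid : ∀ {k o} → IsKey k → o ∈ class k → Valid o)
  (class-unique : ∀ {k} → IsKey k → Unique (class k))
  (Δ : ℕ) (N-small : ∀ {o} → Valid o → length (N o) ≤ Δ)
  (class-large : ∀ {k} → IsKey k → Δ + Δ ≤ length (class k))
  (class-nonempty : ∀ {k} → IsKey k → 0 < length (class k)) where

  Choice : Set
  Choice = List (K × O)

  keys : Choice → List K
  keys = map proj₁

  record Independent (P : Choice) (R : List O) : Set where
    constructor mk
    field
      isKey    : ∀ {k o} → (k , o) ∈ P → IsKey k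
      inClass  : ∀ {k o} → (k , o) ∈ P → o ∈ class k
      avoids   : ∀ {k o} → (k , o) ∈ P → o ∉ R
      pairwise : ∀ {p q} → p ∈ P → q ∈ P → p ≢ q → proj₂ q ∉ N (proj₂ p)
    valid : ∀ {k o} → (k , o) ∈ P → Valid o
    valid p∈ = class-valid (isKey p∈) (inClass p∈)
  open Independent

  -- What the induction delivers: a vertex of `A` that can join the partial transversal, at the
  -- price of moving representatives (`Q` for `P`) but not the set of represented classes.
  -- Everything stays clear of the blocked list `R`.
  record Extension (P : Choice) (A R : List O) : Set where
    constructor extension
    field
      z     : O
      Q     : Choice
      z∈A   : z ∈ A
      z∉R   : z ∉ R
      indep : Independent Q R
      Q↭P   : keys Q ↭ keys P
      z-ok  : ∀ {q} → q ∈ Q → proj₂ q ∉ N z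

  insert : ∀ {Q R k z} → IsKey k → z ∈ class k → z ∉ R → Independent Q R →
           (∀ {q} → q ∈ Q → proj₂ q ∉ N z) → Independent ((k , z) ∷ Q) R
  insert {Q} {R} {k} {z} k-key z∈k z∉R Q-ind z-ok = mk
    (λ { (here refl) → k-key ; (there i) → isKey Q-ind i })
    (λ { (here refl) → z∈k ; (there i) → inClass Q-ind i })
    (λ { (here refl) → z∉R ; (there i) → avoids Q-ind i })
    pairwise′
    where
    pairwise′ : ∀ {p q} → p ∈ (k , z) ∷ Q → q ∈ (k , z) ∷ Q → p ≢ q → proj₂ q ∉ N (proj₂ p)
    pairwise′ (here refl) (here refl) p≢q = contradiction refl p≢q
    pairwise′ (here refl) (there j) _ = z-ok j
    pairwise′ (there i) (here refl) _ z∈N =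
      z-ok i (N-sym (valid Q-ind i) (class-valid k-key z∈k) z∈N)
    pairwise′ (there i) (there j) p≢q = pairwise Q-ind i j p≢q

  -- A is a union of classes from which the vertices in R have been discarded.
  record Problem (m : ℕ) (P : Choice) (A R : List O) : Set where
    constructor problem
    field
      |P|     : length P ≡ m
      P-ind   : Independent P R
      P!      : Unique (keys P)
      A!      : Unique A
      A-valid : ∀ {a} → a ∈ A → Valid a
      A-new   : ∀ {a k} → a ∈ A → k ∈ keys P → a ∉ class k
      R<A     : length R < length A

  replace : ∀ {m P P′ A R R′} → keys P′ ↭ keys P → Independent P′ R′ → length R′ < length A →
            Problem m P A R → Problem m P′ A R′
  replace {P = P} {P′} P′↭P P′-ind R′<A (problem |P| P-ind P! A! A-valid A-new R<A) = problem
    (trans (trans (≡-sym (length-map proj₁ P′)) (trans (↭-length P′↭P) (length-map proj₁ P))) |P|)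
    P′-ind (Unique-resp-↭ (↭-sym P′↭P) P!) A! A-valid
    (λ a∈ k∈ → A-new a∈ (∈-resp-↭ P′↭P k∈)) R′<A

  weaken : ∀ {P R R′} → (∀ {o} → o ∈ R → o ∈ R′) → Independent P R′ → Independent P R
  weaken R⊆R′ ind = mk (isKey ind) (inClass ind) (λ p∈ o∈ → avoids ind p∈ (R⊆R′ o∈)) (pairwise ind)

  -- The chosen vertex u of class y is a neighbour of a (the list M holds neighbours of a that are
  -- avoided by P).  Merging y into A and discarding also M, u and the neighbours of u, a vertex found
  -- for the smaller problem either comes from A, in which case u can be kept, or it can replace u.
  module Displacement
    (m : ℕ) (extend : ∀ {P A R} → Problem m P A R → Extension P A R)
    (P₁ P₂ : Choice) (y : K) (u : O) (A R M us : List O) (a : O)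
    (pr : Problem (suc m) (P₁ ++ (y , u) ∷ P₂) A R)
    (P-ind : Independent (P₁ ++ (y , u) ∷ P₂) (R ++ M))
    (M≡N : M ++ u ∷ us ≡ N a) (a∈A : a ∈ A) where
    open Problem pr hiding (P-ind)

    P Q₀ : Choice
    P = P₁ ++ (y , u) ∷ P₂
    Q₀ = P₁ ++ P₂

    P↭ : P ↭ (y , u) ∷ Q₀
    P↭ = shift (y , u) P₁ P₂

    yu∈P : (y , u) ∈ P
    yu∈P = ∈-resp-↭ (↭-sym P↭) (here refl)

    ∈P : ∀ {q} → q ∈ Q₀ → q ∈ P
    ∈P = ∈-resp-↭ (↭-sym P↭) ∘ there

    keys↭ : keys P ↭ y ∷ keys Q₀
    keys↭ = ↭-map⁺ proj₁ P↭

    keys! : Unique (y ∷ keys Q₀)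
    keys! = Unique-resp-↭ keys↭ P!

    y≢ : ∀ {k} → k ∈ keys Q₀ → y ≢ k
    y≢ k∈ with y# ∷ _ ← keys! = All.lookup y# k∈

    Q₀! : Unique (keys Q₀)
    Q₀! with _ ∷ Q! ← keys! = Q!

    y-key = isKey P-ind yu∈P
    u∈y = inClass P-ind yu∈P
    u-valid = valid P-ind yu∈P

    key-isKey : ∀ {k} → k ∈ keys Q₀ → IsKey k
    key-isKey k∈ with _ , q∈ , refl ← ∈-map⁻ proj₁ k∈ = isKey P-ind (∈P q∈)

    Mu R′ A′ : List O
    Mu = M ∷ʳ u
    R′ = (R ++ Mu) ++ N u
    A′ = A ++ class y

    Mu≡N : Mu ++ us ≡ N a
    Mu≡N = trans (++-assoc M [ u ] us) M≡N

    Q₀-avoids : ∀ {k o} → (k , o) ∈ Q₀ → o ∉ R′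
    Q₀-avoids p∈ o∈ with ∈-++⁻ (R ++ Mu) o∈
    ... | inj₂ o∈Nu = pairwise P-ind yu∈P (∈P p∈) (λ { refl → y≢ (∈-map⁺ proj₁ p∈) refl }) o∈Nu
    ... | inj₁ o∈RMu with ∈-++⁻ R o∈RMu
    ... | inj₁ o∈R = avoids P-ind (∈P p∈) (∈-++⁺ˡ o∈R)
    ... | inj₂ o∈Mu with ∈-++⁻ M o∈Mu
    ... | inj₁ o∈M = avoids P-ind (∈P p∈) (∈-++⁺ʳ R o∈M)
    ... | inj₂ (here refl) = y≢ (∈-map⁺ proj₁ p∈)
          (class-disjoint y-key (isKey P-ind (∈P p∈)) u∈y (inClass P-ind (∈P p∈)))

    R′<A′ : length R′ < length A′
    -- `Mu` is an initial part of `N a`, so it has at most `Δ` elements, as has `N u`; the class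
    -- merged into `A` brings at least `Δ + Δ`. This is where the factor two in the class size is
    -- spent.
    R′<A′ = begin-strict
      length R′                                   ≡⟨ length-++ (R ++ Mu) ⟩
      length (R ++ Mu) + length (N u)             ≡⟨ cong (_+ length (N u)) (length-++ R) ⟩
      length R + length Mu + length (N u)         ≡⟨ +-assoc (length R) (length Mu) _ ⟩
      length R + (length Mu + length (N u))       ≤⟨ +-monoʳ-≤ (length R) (+-mono-≤ |Mu|≤ (N-small u-valid)) ⟩
      length R + (Δ + Δ)                          <⟨ +-mono-<-≤ R<A (class-large y-key) ⟩
      length A + length (class y)                 ≡⟨ length-++ A ⟨
      length A′                                   ∎
      where
      open ≤-Reasoning
      |Mu|≤ : length Mu ≤ Δ
      |Mu|≤ = begin
        length Mu               ≤⟨ m≤m+n _ (length us) ⟩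
        length Mu + length us   ≡⟨ length-++ Mu ⟨
        length (Mu ++ us)       ≡⟨ cong length Mu≡N ⟩
        length (N a)            ≤⟨ N-small (A-valid a∈A) ⟩
        Δ                       ∎

    A′-new : ∀ {o k} → o ∈ A′ → k ∈ keys Q₀ → o ∉ class k
    A′-new o∈ k∈ o∈k with ∈-++⁻ A o∈
    ... | inj₁ o∈A = A-new o∈A (∈-resp-↭ (↭-sym keys↭) (there k∈)) o∈k
    ... | inj₂ o∈y = y≢ k∈ (class-disjoint y-key (key-isKey k∈) o∈y o∈k)

    smaller : Problem m Q₀ A′ R′
    smaller = problem
      (suc-injective (trans (≡-sym (↭-length P↭)) |P|))
      (mk (isKey P-ind ∘ ∈P) (inClass P-ind ∘ ∈P) Q₀-avoids (λ p∈ q∈ → pairwise P-ind (∈P p∈) (∈P q∈)))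
      Q₀!
      (Unique.++⁺ A! (class-unique y-key) (λ { (o∈A , o∈y) → A-new o∈A (∈-map⁺ proj₁ yu∈P) o∈y }))
      (λ o∈ → [ A-valid , class-valid y-key ]′ (∈-++⁻ A o∈))
      A′-new R′<A′

    result : Extension P A R ⊎
             (∃ λ P′ → keys P′ ↭ keys P × Independent P′ (R ++ Mu))
    result with extend smaller
    ... | extension z Q z∈A′ z∉R′ Q-ind Q↭ z-ok with ∈-++⁻ A z∈A′
    ... | inj₁ z∈A = inj₁ (extension z ((y , u) ∷ Q) z∈A (z∉R′ ∘ ∈-++⁺ˡ ∘ ∈-++⁺ˡ)
            (insert y-key u∈y (λ u∈R → avoids P-ind yu∈P (∈-++⁺ˡ u∈R))
              (weaken (∈-++⁺ˡ ∘ ∈-++⁺ˡ) Q-ind) (λ q∈ q∈N → avoids Q-ind q∈ (∈-++⁺ʳ (R ++ Mu) q∈N)))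
            (↭-trans (prep y Q↭) (↭-sym keys↭))
            (λ { (here refl) u∈Nz → z∉R′ (∈-++⁺ʳ (R ++ Mu) (N-sym (A-valid z∈A) u-valid u∈Nz))
               ; (there q∈) → z-ok q∈ }))
    ... | inj₂ z∈y = inj₂ ((y , z) ∷ Q , ↭-trans (prep y Q↭) (↭-sym keys↭) ,
            insert y-key z∈y (z∉R′ ∘ ∈-++⁺ˡ) (weaken ∈-++⁺ˡ Q-ind) z-ok)

  -- `M` is the part of `N a` already scanned, and the current choice avoids it. A chosen vertex met
  -- in the scan is displaced without undoing this, unless an extension turns up on the way. When
  -- the scan ends no chosen vertex is a neighbour of `a`, so `a` itself extends the choice.
  retry : ∀ {m} (extend : ∀ {j P A R} → suc j ≡ m → Problem j P A R → Extension P A R) →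
          ∀ us M {P A R a} → M ++ us ≡ N a → Problem m P A R → Independent P (R ++ M) →
          a ∈ A → a ∉ R → Extension P A R
  retry ih [] M {P} {R = R} M≡N pr P-ind a∈A a∉R =
    extension _ P a∈A a∉R (weaken ∈-++⁺ˡ P-ind) ↭-refl
      (λ q∈ q∈N → avoids P-ind q∈ (∈-++⁺ʳ R (subst (_ ∈_) (trans (≡-sym M≡N) (++-identityʳ M)) q∈N)))
  retry ih (u ∷ us) M {P} {R = R} M≡N pr P-ind a∈A a∉R
    with any? (λ q → u ≟ proj₂ q) P
  ... | no u∉P = retry ih us (M ∷ʳ u) (trans (++-assoc M [ u ] us) M≡N) pr
          (mk (isKey P-ind) (inClass P-ind) avoids′ (pairwise P-ind)) a∈A a∉R
    where
    avoids′ : ∀ {k o} → (k , o) ∈ P → o ∉ R ++ M ∷ʳ u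
    avoids′ p∈ o∈ with ∈-++⁻ R o∈
    ... | inj₁ o∈R = avoids P-ind p∈ (∈-++⁺ˡ o∈R)
    ... | inj₂ o∈Mu with ∈-++⁻ M o∈Mu
    ... | inj₁ o∈M = avoids P-ind p∈ (∈-++⁺ʳ R o∈M)
    ... | inj₂ (here refl) = u∉P (lose p∈ refl)
  ... | yes u∈P with find u∈P
  ... | (y , _) , yu∈P , refl with ∈-∃++ yu∈P
  ... | P₁ , P₂ , refl
    with refl ← trans (≡-sym (Problem.|P| pr)) (↭-length (shift (y , u) P₁ P₂))
    with Displacement.result (length (P₁ ++ P₂)) (ih refl) P₁ P₂ y u _ R M us _ pr P-ind M≡N a∈A
  ... | inj₁ done = done
  ... | inj₂ (P′ , P′↭P , P′-ind)
    with extension z Q z∈A z∉R Q-ind Q↭ z-ok ←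
      retry ih us (M ∷ʳ u) (trans (++-assoc M [ u ] us) M≡N)
        (replace P′↭P (weaken ∈-++⁺ˡ P′-ind) (Problem.R<A pr) pr) P′-ind a∈A a∉R =
    extension z Q z∈A z∉R Q-ind (↭-trans Q↭ P′↭P) z-ok

  -- Induction on the number `m` of represented classes: a displacement recurses after moving one
  -- class from `P` into `A`. The room left by `R<A` provides the vertex `a` whose neighbours are to
  -- be cleared.
  extend : ∀ m {P A R} → Problem m P A R → Extension P A R
  extend m {P} {A} {R} pr with a , a∈A , a∉R ← pigeonhole _≟_ (Problem.A! pr) (Problem.R<A pr) =
    retry (smaller m) (N a) [] refl pr
      (subst (Independent P) (≡-sym (++-identityʳ R)) (Problem.P-ind pr)) a∈A a∉R
    where
    smaller : ∀ m {j P A R} → suc j ≡ m → Problem j P A R → Extension P A R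
    smaller (suc j) refl = extend j

  -- Classes are added one at a time with nothing blocked, so each call needs just a nonempty class.
  -- This is a separate hypothesis because the size bound is void when `Δ` is 0.
  chooseAll : ∀ {ks} → Unique ks → All IsKey ks → ∃ λ P → Independent P [] × keys P ↭ ks
  chooseAll [] [] = [] , mk (λ ()) (λ ()) (λ ()) (λ ()) , ↭-refl
  chooseAll {k ∷ ks} (k# ∷ ks!) (k-key ∷ ks-key)
    with P , P-ind , P↭ ← chooseAll ks! ks-key
    with extension z Q z∈k z∉R Q-ind Q↭ z-ok ← extend (length P) (problem refl P-ind
           (Unique-resp-↭ (↭-sym P↭) ks!) (class-unique k-key) (class-valid k-key)
           (λ a∈k l∈ a∈l → All.lookup k# (∈-resp-↭ P↭ l∈)
              (class-disjoint k-key (All.lookup ks-key (∈-resp-↭ P↭ l∈)) a∈k a∈l))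
           (class-nonempty k-key)) =
    (k , z) ∷ Q , insert k-key z∈k z∉R Q-ind z-ok , prep k (↭-trans Q↭ P↭)

  transversal : ∀ {ks} → Unique ks → All IsKey ks → ∃ λ (P : List (K × O)) →
                (∀ {k o} → (k , o) ∈ P → IsKey k × o ∈ class k) ×
                (∀ {p q} → p ∈ P → q ∈ P → p ≢ q → proj₂ q ∉ N (proj₂ p)) ×
                map proj₁ P ↭ ks
  transversal ks! ks-key with P , P-ind , P↭ ← chooseAll ks! ks-key =
    P , (λ p∈ → isKey P-ind p∈ , inClass P-ind p∈) , pairwise P-ind , P↭

-- Finite sums and counting.

∑ : {A : Set} → List A → (A → ℕ) → ℕ
∑ xs f = sum (map f xs)

⟦_⟧ : {P : Set} → Dec P → ℕ
⟦ d ⟧ = b2n (does d)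

module _ {A : Set} where

  ∑-mono-∈ : ∀ xs {f g : A → ℕ} → (∀ {x} → x ∈ xs → f x ≤ g x) → ∑ xs f ≤ ∑ xs g
  ∑-mono-∈ [] f≤g = z≤n
  ∑-mono-∈ (x ∷ xs) f≤g = +-mono-≤ (f≤g (here refl)) (∑-mono-∈ xs (f≤g ∘ there))

  ∑-mono : ∀ xs {f g : A → ℕ} → (∀ x → f x ≤ g x) → ∑ xs f ≤ ∑ xs g
  ∑-mono xs f≤g = ∑-mono-∈ xs (λ {x} _ → f≤g x)

  ∑-cong : ∀ xs {f g : A → ℕ} → (∀ x → f x ≡ g x) → ∑ xs f ≡ ∑ xs g
  ∑-cong [] f≡g = refl
  ∑-cong (x ∷ xs) f≡g = cong₂ _+_ (f≡g x) (∑-cong xs f≡g)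

  ∑-+ : ∀ xs (f g : A → ℕ) → ∑ xs (λ x → f x + g x) ≡ ∑ xs f + ∑ xs g
  ∑-+ [] f g = refl
  ∑-+ (x ∷ xs) f g = trans (cong (f x + g x +_) (∑-+ xs f g)) (interchange (f x) (g x) (∑ xs f) (∑ xs g))
    where
    interchange : ∀ a b c d → a + b + (c + d) ≡ a + c + (b + d)
    interchange = solve-∀

  ∑-* : ∀ xs c (f : A → ℕ) → ∑ xs (λ x → c * f x) ≡ c * ∑ xs f
  ∑-* [] c f = ≡-sym (*-zeroʳ c)
  ∑-* (x ∷ xs) c f = trans (cong (c * f x +_) (∑-* xs c f)) (≡-sym (*-distribˡ-+ c (f x) (∑ xs f)))

  ∑-zero : ∀ xs → ∑ xs (λ (_ : A) → 0) ≡ 0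
  ∑-zero [] = refl
  ∑-zero (x ∷ xs) = ∑-zero xs

  ∑-one : ∀ xs → ∑ xs (λ (_ : A) → 1) ≡ length xs
  ∑-one [] = refl
  ∑-one (x ∷ xs) = cong suc (∑-one xs)

module _ {A : Set} where

  ∑-swap : ∀ {B : Set} xs ys (f : A → B → ℕ) →
           ∑ xs (λ x → ∑ ys (f x)) ≡ ∑ ys (λ y → ∑ xs (λ x → f x y))
  ∑-swap [] ys f = ≡-sym (∑-zero ys)
  ∑-swap (x ∷ xs) ys f = trans (cong (∑ ys (f x) +_) (∑-swap xs ys f)) (≡-sym (∑-+ ys (f x) _))

  module _ (_≟_ : DecidableEquality A) where

    ∑-outside : ∀ x xs (f : A → ℕ) → x ∉ xs → ∑ xs (λ y → ⟦ x ≟ y ⟧ * f y) ≡ 0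
    ∑-outside x [] f x∉ = refl
    ∑-outside x (y ∷ xs) f x∉
      rewrite dec-false (x ≟ y) (λ x≡y → x∉ (here x≡y)) = ∑-outside x xs f (x∉ ∘ there)

    ∑-single : ∀ {x xs} → Unique xs → x ∈ xs → (f : A → ℕ) → ∑ xs (λ y → ⟦ x ≟ y ⟧ * f y) ≡ f x
    ∑-single {x} {_ ∷ xs} (x# ∷ _) (here refl) f rewrite dec-true (x ≟ x) refl =
      trans (cong₂ _+_ (+-identityʳ (f x)) (∑-outside x xs f (λ x∈ → All.lookup x# x∈ refl))) (+-identityʳ (f x))
    ∑-single {x} {y ∷ xs} (y# ∷ xs!) (there x∈) f
      rewrite dec-false (x ≟ y) (λ { refl → All.lookup y# x∈ refl }) = ∑-single xs! x∈ f

    indicator : List A → A → ℕ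
    indicator S w = ⟦ any? (w ≟_) S ⟧

    -- Passes between sums over a list and masked sums over all vertices, the two forms in which
    -- sparseness is used.
    ∑-indicator : ∀ {xs} → Unique xs → (∀ x → x ∈ xs) → ∀ {S} → Unique S → (f : A → ℕ) →
                  ∑ xs (λ w → indicator S w * f w) ≡ ∑ S f
    ∑-indicator {xs} xs! x∈xs {[]} _ f = ∑-zero xs
    ∑-indicator {xs} xs! x∈xs {s ∷ S} (s# ∷ S!) f = begin
      ∑ xs (λ w → indicator (s ∷ S) w * f w)
        ≡⟨ ∑-cong xs peel ⟩
      ∑ xs (λ w → ⟦ s ≟ w ⟧ * f w + indicator S w * f w)
        ≡⟨ ∑-+ xs _ _ ⟩
      ∑ xs (λ w → ⟦ s ≟ w ⟧ * f w) + ∑ xs (λ w → indicator S w * f w)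
        ≡⟨ cong₂ _+_ (∑-single xs! (x∈xs s) f) (∑-indicator xs! x∈xs S! f) ⟩
      f s + ∑ S f ∎
      where
      open ≡-Reasoning
      peel : ∀ w → indicator (s ∷ S) w * f w ≡ ⟦ s ≟ w ⟧ * f w + indicator S w * f w
      peel w with w ≟ s
      ... | yes refl rewrite dec-true (w ≟ w) refl
                           | dec-false (any? (w ≟_) S) (λ w∈S → All.lookup s# w∈S refl) =
        ≡-sym (+-identityʳ (f w + 0))
      ... | no w≢s rewrite dec-false (s ≟ w) (w≢s ∘ ≡-sym) = refl

module _ {n : ℕ} where

  ∑V : (Fin n → ℕ) → ℕ
  ∑V = ∑ (allFin n)

  ∑V-single : ∀ v f → ∑V (λ w → ⟦ v Fin.≟ w ⟧ * f w) ≡ f v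
  ∑V-single v f = ∑-single Fin._≟_ (Unique.allFin⁺ n) (∈-allFin v) f

  count : (Fin n → Bool) → ℕ
  count p = ∑V (λ v → b2n (p v))

  select : (Fin n → Bool) → List (Fin n)
  select p = filter (λ v → p v Data.Bool.≟ true) (allFin n)

  select⁺ : ∀ {p v} → p v ≡ true → v ∈ select p
  select⁺ {p} {v} pv = ∈-filter⁺ (λ v → p v Data.Bool.≟ true) (∈-allFin v) pv

  select⁻ : ∀ {p v} → v ∈ select p → p v ≡ true
  select⁻ {p} v∈ = proj₂ (∈-filter⁻ (λ v → p v Data.Bool.≟ true) {xs = allFin n} v∈)

  length-select : ∀ p → length (select p) ≡ count p
  length-select p = go (allFin n)
    where
    go : ∀ xs → length (filter (λ v → p v Data.Bool.≟ true) xs) ≡ ∑ xs (λ v → b2n (p v))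
    go [] = refl
    go (x ∷ xs) with p x
    ... | true = cong suc (go xs)
    ... | false = go xs

  unique≤count : ∀ {p xs} → Unique xs → (∀ {x} → x ∈ xs → p x ≡ true) → length xs ≤ count p
  unique≤count {p} xs! xs⊆p =
    ≤-trans (unique-⊆⇒length≤ xs! (λ x∈ → select⁺ (xs⊆p x∈))) (≤-reflexive (length-select p))

∧-true⁻ : ∀ {a b} → a ∧ b ≡ true → a ≡ true × b ≡ true
∧-true⁻ {true} {true} _ = refl , refl

does⁻ : ∀ {P : Set} (d : Dec P) → does d ≡ true → P
does⁻ (yes p) _ = p

-- Minimisers by exhaustive search.

module _ {X : Set} where

  search : ∀ {n} (L : Fin n → List X) {P : Vec X n → Set} → Decidable P →
           Dec (∃ λ v → (∀ i → Vec.lookup v i ∈ L i) × P v)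
  search {zero} L P? = map′ (λ p → [] , (λ ()) , p) (λ { ([] , _ , p) → p }) (P? [])
  search {suc n} L {P} P? = map′ to from (any? (λ x → search (L ∘ suc) (λ v → P? (x ∷ v))) (L zero))
    where
    to : Any (λ x → ∃ λ v → (∀ i → Vec.lookup v i ∈ L (suc i)) × P (x ∷ v)) (L zero) →
         ∃ λ v → (∀ i → Vec.lookup v i ∈ L i) × P v
    to found with x , x∈ , v , v∈ , p ← find found = x ∷ v , (λ { zero → x∈ ; (suc i) → v∈ i }) , p
    from : (∃ λ v → (∀ i → Vec.lookup v i ∈ L i) × P v) →
           Any (λ x → ∃ λ v → (∀ i → Vec.lookup v i ∈ L (suc i)) × P (x ∷ v)) (L zero)
    from (x ∷ v , v∈ , p) = lose (v∈ zero) (v , v∈ ∘ suc , p)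

  module _ {n : ℕ} (L : Fin n → List X) {P : (Fin n → X) → Set} (P? : Decidable P)
    (P-resp : ∀ {φ ψ} → φ ≗ ψ → P φ → P ψ)
    (f : (Fin n → X) → ℕ) (f-resp : ∀ {φ ψ} → φ ≗ ψ → f φ ≡ f ψ) where

    Minimal : (Fin n → X) → Set
    Minimal φ = (∀ i → φ i ∈ L i) × P φ × (∀ ψ → (∀ i → ψ i ∈ L i) → P ψ → f φ ≤ f ψ)

    -- Descent: a search looks for an admissible assignment of strictly smaller value, and `f φ`
    -- bounds the number of rounds. The search runs over vectors, and a competitor is only pointwise
    -- equal to its tabulation, hence `P-resp` and `f-resp`.
    minimise : ∀ φ → (∀ i → φ i ∈ L i) → P φ → ∃ Minimal
    minimise φ φ∈ Pφ = go (f φ) φ φ∈ Pφ ≤-refl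
      where
      go : ∀ m φ → (∀ i → φ i ∈ L i) → P φ → f φ ≤ m → ∃ Minimal
      go m φ φ∈ Pφ f≤m with search L (λ v → P? (Vec.lookup v) ×-dec (suc (f (Vec.lookup v)) ≤? f φ))
      go m φ φ∈ Pφ f≤m | no none = φ , φ∈ , Pφ , λ ψ ψ∈ Pψ → ≮⇒≥ λ f< → none
        ( Vec.tabulate ψ
        , (λ i → subst (_∈ L i) (≡-sym (Vec.lookup∘tabulate ψ i)) (ψ∈ i))
        , P-resp (≡-sym ∘ Vec.lookup∘tabulate ψ) Pψ
        , subst (_< f φ) (f-resp (≡-sym ∘ Vec.lookup∘tabulate ψ)) f<)
      go zero φ φ∈ Pφ f≤m | yes (v , v∈ , Pv , f<) = contradiction (≤-trans f< f≤m) λ ()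
      go (suc m) φ φ∈ Pφ f≤m | yes (v , v∈ , Pv , f<) =
        go m (Vec.lookup v) v∈ Pv (≤-pred (≤-trans f< f≤m))

-- Colour counts and the recolouring of one vertex.

does-≟-comm : ∀ (x y : ℕ) → does (x ≟ y) ≡ does (y ≟ x)
does-≟-comm x y with x ≟ y
... | yes refl = refl
... | no x≢y = trans (dec-false (x ≟ y) x≢y) (≡-sym (dec-false (y ≟ x) (x≢y ∘ ≡-sym)))

length-filter≡∑ : ∀ {A : Set} {P : A → Set} (P? : Decidable P) xs → length (filter P? xs) ≡ ∑ xs (λ x → ⟦ P? x ⟧)
length-filter≡∑ P? [] = refl
length-filter≡∑ P? (x ∷ xs) with does (P? x)
... | true = cong suc (length-filter≡∑ P? xs)
... | false = length-filter≡∑ P? xs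

∑-⟦≟⟧≤1 : ∀ x {xs : List ℕ} → Unique xs → ∑ xs (λ c → ⟦ x ≟ c ⟧) ≤ 1
∑-⟦≟⟧≤1 x {xs} xs! = ≤-trans (≤-reflexive (∑-cong xs (λ c → ≡-sym (*-identityʳ _)))) bound
  where
  bound : ∑ xs (λ c → ⟦ x ≟ c ⟧ * 1) ≤ 1
  bound with any? (x ≟_) xs
  ... | yes x∈ = ≤-reflexive (∑-single _≟_ xs! x∈ (λ _ → 1))
  ... | no x∉ = ≤-trans (≤-reflexive (∑-outside _≟_ x xs (λ _ → 1) x∉)) z≤n

module _ {n : ℕ} where

  recolour : (Fin n → ℕ) → Fin n → ℕ → Fin n → ℕ
  recolour φ v c w = if does (v Fin.≟ w) then c else φ w

  recolour-other : ∀ φ {v w} c → v ≢ w → recolour φ v c w ≡ φ w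
  recolour-other φ {v} {w} c v≢w rewrite dec-false (v Fin.≟ w) v≢w = refl

module Counting {n : ℕ} (G : Graph n) where

  adj-irrefl : ∀ {u w} → adj G u w ≡ true → u ≢ w
  adj-irrefl {u} uw refl = case trans (≡-sym uw) (irrefl G u) of λ ()

  adj-sym : ∀ {u w} → adj G u w ≡ true → adj G w u ≡ true
  adj-sym {u} {w} uw = trans (Graph.sym G w u) uw

  hasColour : (Fin n → ℕ) → ℕ → Fin n → Fin n → Bool
  hasColour φ c v w = adj G v w ∧ does (φ w ≟ c)

  cnt : (Fin n → ℕ) → ℕ → Fin n → ℕ
  cnt φ c v = count (hasColour φ c v)

  deg : Fin n → ℕ
  deg v = count (adj G v)

  -- Twice the number of monochromatic edges, each being seen from both ends.
  mono : (Fin n → ℕ) → ℕ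
  mono φ = ∑V (λ u → cnt φ (φ u) u)

  hasColour⁺ : ∀ {φ c v w} → adj G v w ≡ true → φ w ≡ c → hasColour φ c v w ≡ true
  hasColour⁺ {φ} {c} {v} {w} vw refl rewrite vw = dec-true (φ w ≟ φ w) refl

  hasColour⁻ : ∀ {φ c v w} → hasColour φ c v w ≡ true → adj G v w ≡ true × φ w ≡ c
  hasColour⁻ {φ} {c} {v} {w} h with vw , w≡c ← ∧-true⁻ {adj G v w} h = vw , does⁻ (φ w ≟ c) w≡c

  cnt-resp : ∀ {φ ψ} → φ ≗ ψ → ∀ c v → cnt φ c v ≡ cnt ψ c v
  cnt-resp φ≗ψ c v = ∑-cong (allFin n) (λ w → cong (λ d → b2n (adj G v w ∧ does (d ≟ c))) (φ≗ψ w))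

  mono-resp : ∀ {φ ψ} → φ ≗ ψ → mono φ ≡ mono ψ
  mono-resp {φ} {ψ} φ≗ψ = ∑-cong (allFin n) λ u →
    trans (cnt-resp φ≗ψ (φ u) u) (cong (λ c → cnt ψ c u) (φ≗ψ u))

  -- Only ordered pairs containing `v` change, and each edge at `v` gives two of them. With the lost
  -- edges moved to the left there is no subtraction, and the identity of double sums holds pair by
  -- pair.
  mono-recolour : ∀ φ v c → mono (recolour φ v c) + 2 * cnt φ (φ v) v ≡ mono φ + 2 * cnt φ c v
  mono-recolour φ v c = begin
    mono ψ + 2 * cnt φ (φ v) v                                          ≡⟨ sums ψ (φ v) ⟨
    ∑V (λ u → ∑V (λ w → e ψ u w + (⟦ v Fin.≟ u ⟧ * h (φ v) w + ⟦ v Fin.≟ w ⟧ * h (φ v) u)))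
      ≡⟨ ∑-cong (allFin n) (λ u → ∑-cong (allFin n) (pointwise u)) ⟩
    ∑V (λ u → ∑V (λ w → e φ u w + (⟦ v Fin.≟ u ⟧ * h c w + ⟦ v Fin.≟ w ⟧ * h c u)))
      ≡⟨ sums φ c ⟩
    mono φ + 2 * cnt φ c v                                              ∎
    where
    open ≡-Reasoning
    ψ = recolour φ v c
    e : (Fin n → ℕ) → Fin n → Fin n → ℕ
    e χ u w = b2n (hasColour χ (χ u) u w)
    h : ℕ → Fin n → ℕ
    h d w = b2n (hasColour φ d v w)
    sums : ∀ χ d → ∑V (λ u → ∑V (λ w → e χ u w + (⟦ v Fin.≟ u ⟧ * h d w + ⟦ v Fin.≟ w ⟧ * h d u)))
                   ≡ mono χ + 2 * cnt φ d v
    sums χ d = begin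
      ∑V (λ u → ∑V (λ w → e χ u w + (⟦ v Fin.≟ u ⟧ * h d w + ⟦ v Fin.≟ w ⟧ * h d u)))
        ≡⟨ ∑-cong (allFin n) (λ u → trans (∑-+ (allFin n) (e χ u) _)
             (cong (∑V (e χ u) +_) (trans (∑-+ (allFin n) _ _)
               (cong₂ _+_ (∑-* (allFin n) ⟦ v Fin.≟ u ⟧ (h d)) (∑V-single v (λ _ → h d u)))))) ⟩
      ∑V (λ u → cnt χ (χ u) u + (⟦ v Fin.≟ u ⟧ * cnt φ d v + h d u))
        ≡⟨ trans (∑-+ (allFin n) _ _) (cong (mono χ +_) (∑-+ (allFin n) _ _)) ⟩
      mono χ + (∑V (λ u → ⟦ v Fin.≟ u ⟧ * cnt φ d v) + cnt φ d v)
        ≡⟨ cong (λ s → mono χ + (s + cnt φ d v)) (∑V-single v (λ _ → cnt φ d v)) ⟩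
      mono χ + (cnt φ d v + cnt φ d v)
        ≡⟨ cong (λ s → mono χ + (cnt φ d v + s)) (+-identityʳ (cnt φ d v)) ⟨
      mono χ + 2 * cnt φ d v ∎
    pointwise : ∀ u w → e ψ u w + (⟦ v Fin.≟ u ⟧ * h (φ v) w + ⟦ v Fin.≟ w ⟧ * h (φ v) u)
                      ≡ e φ u w + (⟦ v Fin.≟ u ⟧ * h c w + ⟦ v Fin.≟ w ⟧ * h c u)
    pointwise u w with v Fin.≟ u | v Fin.≟ w
    ... | no _ | no _ = refl
    -- Both corrections fall on the pair (v , v), where they vanish with `adj G v v`.
    ... | yes refl | yes refl rewrite irrefl G v = refl
    ... | yes refl | no _ = swap (h c w) (h (φ v) w)
      where
      swap : ∀ a b → a + (b + 0 + 0) ≡ b + (a + 0 + 0)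
      swap = solve-∀
    ... | no _ | yes refl
      rewrite Graph.sym G u v | does-≟-comm c (φ u) | does-≟-comm (φ v) (φ u) =
      swap (h c u) (h (φ v) u)
      where
      swap : ∀ a b → a + (b + 0) ≡ b + (a + 0)
      swap = solve-∀

  cnt-recolour-far : ∀ φ {v x} c d → adj G x v ≡ false → cnt (recolour φ v c) d x ≡ cnt φ d x
  cnt-recolour-far φ {v} {x} c d x≁v = ∑-cong (allFin n) (λ w → cong b2n (pointwise w))
    where
    pointwise : ∀ w → hasColour (recolour φ v c) d x w ≡ hasColour φ d x w
    pointwise w with v Fin.≟ w
    ... | yes refl rewrite x≁v = refl
    ... | no _ = refl

  cnt-recolour-near : ∀ φ {v x} c → adj G x v ≡ true → φ v ≢ c → cnt (recolour φ v c) c x ≡ suc (cnt φ c x)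
  cnt-recolour-near φ {v} {x} c x~v v≢c =
    trans (trans (∑-cong (allFin n) pointwise) (∑-+ (allFin n) _ _))
          (cong (_+ cnt φ c x) (∑V-single v (λ _ → 1)))
    where
    pointwise : ∀ w → b2n (hasColour (recolour φ v c) c x w)
                      ≡ ⟦ v Fin.≟ w ⟧ * 1 + b2n (hasColour φ c x w)
    pointwise w with v Fin.≟ w
    ... | yes refl rewrite x~v | dec-true (c ≟ c) refl | dec-false (φ v ≟ c) v≢c = refl
    ... | no _ = refl

-- Optimal colourings and their options.

module Colourings {n : ℕ} (G : Graph n) (L : Fin n → List ℕ) (L! : ∀ v → Unique (L v))
  (deg< : ∀ v → Counting.deg G v < 3 * length (L v)) where
  open Counting G public

  -- A neighbour has one colour, and this occurs at most once in `L v`.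
  ∑cnt≤deg : ∀ φ v → ∑ (L v) (λ c → cnt φ c v) ≤ deg v
  ∑cnt≤deg φ v = begin
    ∑ (L v) (λ c → cnt φ c v)                                   ≡⟨ ∑-swap (L v) (allFin n) _ ⟩
    ∑V (λ w → ∑ (L v) (λ c → b2n (hasColour φ c v w)))          ≤⟨ ∑-mono (allFin n) pointwise ⟩
    deg v                                                       ∎
    where
    open ≤-Reasoning
    pointwise : ∀ w → ∑ (L v) (λ c → b2n (adj G v w ∧ does (φ w ≟ c))) ≤ b2n (adj G v w)
    pointwise w with adj G v w
    ... | true = ∑-⟦≟⟧≤1 (φ w) (L! v)
    ... | false = ≤-reflexive (∑-zero (L v))

  Proper : (Fin n → ℕ) → Set
  Proper φ = ∀ v → φ v ∈ L v

  recolour-proper : ∀ {φ v c} → Proper φ → c ∈ L v → Proper (recolour φ v c)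
  recolour-proper {v = v} φ∈ c∈ w with v Fin.≟ w
  ... | yes refl = c∈
  ... | no _ = φ∈ w

  record IsMin (φ : Fin n → ℕ) : Set where
    field
      proper  : Proper φ
      minimal : ∀ ψ → Proper ψ → mono φ ≤ mono ψ
  open IsMin public

  someColour : ∀ v → ∃ λ c → c ∈ L v
  someColour v with L v | deg< v
  ... | c ∷ _ | _ = c , here refl

  min-exists : ∃ IsMin
  min-exists with φ , φ∈ , _ , φ-min ← minimise L {λ _ → Data.Unit.⊤} (λ _ → yes _) (λ _ _ → _) mono mono-resp
                    (λ v → proj₁ (someColour v)) (λ v → proj₂ (someColour v)) _ =
    φ , record { proper = φ∈ ; minimal = λ ψ ψ∈ → φ-min ψ ψ∈ _ }

  module _ {φ : Fin n → ℕ} (φ-min : IsMin φ) where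

    own≤other : ∀ {v c} → c ∈ L v → cnt φ (φ v) v ≤ cnt φ c v
    own≤other {v} {c} c∈ = *-cancelˡ-≤ 2 (+-cancelˡ-≤ (mono φ) _ _ (begin
      mono φ + 2 * cnt φ (φ v) v
        ≤⟨ +-monoˡ-≤ _ (minimal φ-min _ (recolour-proper {φ} (proper φ-min) c∈)) ⟩
      mono (recolour φ v c) + 2 * cnt φ (φ v) v
        ≡⟨ mono-recolour φ v c ⟩
      mono φ + 2 * cnt φ c v ∎))
      where open ≤-Reasoning

    recolour-min : ∀ {v c} → c ∈ L v → cnt φ c v ≤ cnt φ (φ v) v → IsMin (recolour φ v c)
    recolour-min {v} {c} c∈ c≤ = record
      { proper = recolour-proper {φ} (proper φ-min) c∈
      ; minimal = λ ψ ψ∈ → ≤-trans (+-cancelʳ-≤ (2 * cnt φ (φ v) v) _ _ (begin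
          mono (recolour φ v c) + 2 * cnt φ (φ v) v ≡⟨ mono-recolour φ v c ⟩
          mono φ + 2 * cnt φ c v                    ≤⟨ +-monoʳ-≤ (mono φ) (*-monoʳ-≤ 2 c≤) ⟩
          mono φ + 2 * cnt φ (φ v) v                ∎)) (minimal φ-min ψ ψ∈) }
      where open ≤-Reasoning

    -- Otherwise, by minimality, every colour of `L v` would occur on at least three neighbours,
    -- which is more than the degree allows.
    own≤2 : ∀ v → cnt φ (φ v) v ≤ 2
    own≤2 v = ≮⇒≥ λ 2<cnt → <-irrefl refl (begin-strict
      deg v                        <⟨ deg< v ⟩
      3 * length (L v)             ≡⟨ cong (3 *_) (∑-one (L v)) ⟨
      3 * ∑ (L v) (λ _ → 1)        ≡⟨ ∑-* (L v) 3 _ ⟨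
      ∑ (L v) (λ _ → 3)            ≤⟨ ∑-mono-∈ (L v) (λ c∈ → ≤-trans 2<cnt (own≤other c∈)) ⟩
      ∑ (L v) (λ c → cnt φ c v)    ≤⟨ ∑cnt≤deg φ v ⟩
      deg v                        ∎)
      where open ≤-Reasoning

  -- v can be given colour c without changing the number of monochromatic edges.
  record Option (φ : Fin n → ℕ) (v : Fin n) (c : ℕ) : Set where
    constructor option
    field
      c∈L : c ∈ L v
      c≢  : φ v ≢ c
      own≡2 : cnt φ (φ v) v ≡ 2
      new≡2 : cnt φ c v ≡ 2
  open Option public

  option-min : ∀ {φ v c} → IsMin φ → Option φ v c → IsMin (recolour φ v c)
  option-min φ-min (option c∈ _ own new) = recolour-min φ-min c∈ (≤-reflexive (trans new (≡-sym own)))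

  -- After `v` is switched to `c` the colouring is still optimal, and `x` has gained `v` as a
  -- neighbour of its own colour. The bound of two then leaves at most one before the switch.
  target≤1 : ∀ {φ v c x} → IsMin φ → Option φ v c → adj G v x ≡ true → φ x ≡ c → cnt φ c x ≤ 1
  target≤1 {φ} {v} {c} {x} φ-min o vx refl = ≤-pred (begin
    suc (cnt φ (φ x) x)                          ≡⟨ cnt-recolour-near φ (φ x) (adj-sym vx) (c≢ o) ⟨
    cnt ψ (φ x) x                                ≡⟨ cong (λ d → cnt ψ d x) (recolour-other φ (φ x) (adj-irrefl vx)) ⟨
    cnt ψ (ψ x) x                                ≤⟨ own≤2 (option-min φ-min o) x ⟩
    2                                            ∎)
    where
    open ≤-Reasoning
    ψ = recolour φ v c

  -- Switching `v` leaves the option of `w` intact, as the two are not adjacent. In the new optimal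
  -- colouring `x` already counts `v`, so `target≤1` applied to `w` leaves room for nothing else.
  common-target : ∀ {φ v w c x} → IsMin φ → Option φ v c → Option φ w c → v ≢ w → adj G w v ≡ false →
                  adj G v x ≡ true → adj G w x ≡ true → φ x ≡ c → cnt φ c x ≡ 0
  common-target {φ} {v} {w} {c} {x} φ-min o o′ v≢w w≁v vx wx x≡c =
    n≤0⇒n≡0 (≤-pred (≤-trans (≤-reflexive (≡-sym (cnt-recolour-near φ c (adj-sym vx) (c≢ o))))
      (target≤1 (option-min φ-min o) o″ wx (trans (recolour-other φ c (adj-irrefl vx)) x≡c))))
    where
    ψ = recolour φ v c
    ψw : ψ w ≡ φ w
    ψw = recolour-other φ c v≢w
    far : ∀ d → cnt ψ d w ≡ cnt φ d w
    far d = cnt-recolour-far φ c d w≁v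
    o″ : Option ψ w c
    o″ = option (c∈L o′) (λ e → c≢ o′ (trans (≡-sym ψw) e))
           (trans (cong (λ d → cnt ψ d w) ψw) (trans (far (φ w)) (own≡2 o′)))
           (trans (far c) (new≡2 o′))

  module Options (φ : Fin n → ℕ) where

    isOption? : ∀ v c → Dec (φ v ≢ c × cnt φ c v ≡ 2)
    isOption? v c = ¬? (φ v ≟ c) ×-dec (cnt φ c v ≟ 2)

    options : Fin n → List ℕ
    options v = filter (isOption? v) (L v)

    options⁻ : ∀ {v c} → cnt φ (φ v) v ≡ 2 → c ∈ options v → Option φ v c
    options⁻ {v} own c∈ with c∈L , c≢ , new ← ∈-filter⁻ (isOption? v) {xs = L v} c∈ = option c∈L c≢ own new

    options-unique : ∀ v → Unique (options v)
    options-unique v = Unique.filter⁺ (isOption? v) (L! v)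

    -- As `φ v` occurs on two neighbours, minimality puts every colour of `L v` on at least two.
    -- Apart from `φ v`, a colour on exactly two is an option and any other is on at least three, so
    -- the deficit against 3 per colour is one for each option and one for `φ v`.
    many-options : IsMin φ → ∀ v → cnt φ (φ v) v ≡ 2 → 3 * length (L v) ≤ deg v + suc (length (options v))
    many-options φ-min v own = begin
      3 * length (L v)             ≡⟨ cong (3 *_) (∑-one (L v)) ⟨
      3 * ∑ (L v) (λ _ → 1)        ≡⟨ ∑-* (L v) 3 _ ⟨
      ∑ (L v) (λ _ → 3)            ≤⟨ ∑-mono-∈ (L v) pointwise ⟩
      ∑ (L v) (λ c → cnt φ c v + (⟦ φ v ≟ c ⟧ + ⟦ isOption? v c ⟧))
        ≡⟨ trans (∑-+ (L v) _ _) (cong (∑ (L v) (λ c → cnt φ c v) +_) (∑-+ (L v) _ _)) ⟩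
      ∑ (L v) (λ c → cnt φ c v) + (∑ (L v) (λ c → ⟦ φ v ≟ c ⟧) + ∑ (L v) (λ c → ⟦ isOption? v c ⟧))
        ≤⟨ +-mono-≤ (∑cnt≤deg φ v) (+-mono-≤ (∑-⟦≟⟧≤1 (φ v) (L! v)) (≤-reflexive (≡-sym (length-filter≡∑ (isOption? v) (L v))))) ⟩
      deg v + suc (length (options v)) ∎
      where
      open ≤-Reasoning
      pointwise : ∀ {c} → c ∈ L v → 3 ≤ cnt φ c v + (⟦ φ v ≟ c ⟧ + ⟦ isOption? v c ⟧)
      pointwise {c} c∈ with φ v ≟ c | cnt φ c v ≟ 2 | subst (_≤ cnt φ c v) own (own≤other φ-min c∈)
      ... | yes eq | _ | 2≤ rewrite dec-true (φ v ≟ c) eq = +-mono-≤ 2≤ (s≤s z≤n)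
      ... | no neq | yes cnt≡2 | _ rewrite dec-false (φ v ≟ c) neq | cnt≡2 = ≤-refl
      ... | no _ | no cnt≢2 | 2≤ = ≤-trans (≤∧≢⇒< 2≤ (cnt≢2 ∘ ≡-sym)) (m≤m+n _ _)

-- Splittings and neighbouring positions in lists.

module _ {A : Set} where

  ++-split : ∀ (as {bs} cs {ds} : List A) → as ++ bs ≡ cs ++ ds →
             (∃ λ es → cs ≡ as ++ es × bs ≡ es ++ ds) ⊎ (∃ λ es → as ≡ cs ++ es × ds ≡ es ++ bs)
  ++-split [] cs eq = inj₁ (cs , refl , eq)
  ++-split (a ∷ as) [] eq = inj₂ (a ∷ as , refl , ≡-sym eq)
  ++-split (a ∷ as) (c ∷ cs) eq with refl , eq′ ← ∷-injective eq with ++-split as cs eq′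
  ... | inj₁ (es , refl , q) = inj₁ (es , refl , q)
  ... | inj₂ (es , refl , q) = inj₂ (es , refl , q)

  unique-++ʳ : ∀ (ls : List A) {rs} → Unique (ls ++ rs) → Unique rs
  unique-++ʳ [] rs! = rs!
  unique-++ʳ (_ ∷ ls) (_ ∷ u) = unique-++ʳ ls u

  unique-++ˡ : ∀ (ls : List A) {rs} → Unique (ls ++ rs) → Unique ls
  unique-++ˡ [] _ = []
  unique-++ˡ (_ ∷ ls) (x# ∷ u) = All.++⁻ˡ ls x# ∷ unique-++ˡ ls u

  unique-++-disjoint : ∀ (ls : List A) {rs x} → Unique (ls ++ rs) → x ∈ ls → x ∉ rs
  unique-++-disjoint (_ ∷ ls) (x# ∷ _) (here refl) x∈ = All.lookup x# (∈-++⁺ʳ ls x∈) refl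
  unique-++-disjoint (_ ∷ ls) (_ ∷ u) (there x∈ls) x∈ = unique-++-disjoint ls u x∈ls x∈

  unique-occurrence : ∀ (ls ls′ : List A) {a rs rs′} → Unique (ls ++ a ∷ rs) →
                      ls ++ a ∷ rs ≡ ls′ ++ a ∷ rs′ → ls ≡ ls′ × rs ≡ rs′
  unique-occurrence [] [] u eq = refl , ∷-injectiveʳ eq
  unique-occurrence [] (_ ∷ ls′) (a# ∷ _) refl = contradiction refl (All.lookup a# (∈-++⁺ʳ ls′ (here refl)))
  unique-occurrence (_ ∷ ls) [] (a# ∷ _) refl = contradiction refl (All.lookup a# (∈-++⁺ʳ ls (here refl)))
  unique-occurrence (_ ∷ ls) (_ ∷ ls′) (_ ∷ u) eq with refl , eq′ ← ∷-injective eq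
    with refl , refl ← unique-occurrence ls ls′ u eq′ = refl , refl

  unique-first : ∀ (x : A) {xs ls rs} → Unique (x ∷ xs) → x ∷ xs ≡ ls ++ x ∷ rs → ls ≡ []
  unique-first x u eq = ≡-sym (proj₁ (unique-occurrence [] _ u eq))

  unique-last : ∀ {x : A} {xs ls rs} → Unique (xs ∷ʳ x) → xs ∷ʳ x ≡ ls ++ x ∷ rs → rs ≡ []
  unique-last {xs = xs} u eq = ≡-sym (proj₂ (unique-occurrence xs _ u eq))

  Adjacent : List A → A → A → Set
  Adjacent xs a b = ∃₂ λ ls rs → xs ≡ ls ++ a ∷ b ∷ rs

  adjacent-after : ∀ {xs} ls ps {rs} {a b : A} → Unique xs → xs ≡ ls ++ ps ++ rs → a ∈ ps → Adjacent xs a b →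
                   b ∈ ps ⊎ (∃ λ rs′ → rs ≡ b ∷ rs′)
  adjacent-after ls ps {rs} {a} {b} xs! refl a∈ (ls′ , rs′ , eq) with ∈-∃++ a∈
  ... | ps₁ , ps₂ , refl = finish ps₂ (proj₂ (unique-occurrence (ls ++ ps₁) ls′ (subst Unique eq′ xs!) (trans (≡-sym eq′) eq)))
    where
    eq′ : ls ++ (ps₁ ++ a ∷ ps₂) ++ rs ≡ (ls ++ ps₁) ++ a ∷ (ps₂ ++ rs)
    eq′ = trans (cong (ls ++_) (++-assoc ps₁ (a ∷ ps₂) rs)) (≡-sym (++-assoc ls ps₁ _))
    finish : ∀ ps₂ → ps₂ ++ rs ≡ b ∷ rs′ → b ∈ ps₁ ++ a ∷ ps₂ ⊎ (∃ λ rs′ → rs ≡ b ∷ rs′)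
    finish [] eq = inj₂ (rs′ , eq)
    finish (_ ∷ ps₂) refl = inj₁ (∈-++⁺ʳ ps₁ (there (here refl)))

  adjacent-before : ∀ {xs} ls ps {rs} {a b : A} → Unique xs → xs ≡ ls ++ ps ++ rs → a ∈ ps → Adjacent xs b a →
                    b ∈ ps ⊎ (∃ λ ls′ → ls ≡ ls′ ∷ʳ b)
  adjacent-before ls ps {rs} {a} {b} xs! refl a∈ (ls′ , rs′ , eq) with ∈-∃++ a∈
  ... | ps₁ , ps₂ , refl = finish (initLast ps₁)
          (proj₁ (unique-occurrence (ls ++ ps₁) (ls′ ∷ʳ b) (subst Unique eq′ xs!)
            (trans (≡-sym eq′) (trans eq (≡-sym (++-assoc ls′ [ b ] (a ∷ rs′)))))))
    where
    eq′ : ls ++ (ps₁ ++ a ∷ ps₂) ++ rs ≡ (ls ++ ps₁) ++ a ∷ (ps₂ ++ rs)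
    eq′ = trans (cong (ls ++_) (++-assoc ps₁ (a ∷ ps₂) rs)) (≡-sym (++-assoc ls ps₁ _))
    finish : ∀ {ps₁} → InitLast ps₁ → ls ++ ps₁ ≡ ls′ ∷ʳ b →
             b ∈ ps₁ ++ a ∷ ps₂ ⊎ (∃ λ ls′ → ls ≡ ls′ ∷ʳ b)
    finish [] eq = inj₂ (ls′ , trans (≡-sym (++-identityʳ ls)) eq)
    finish (qs ∷ʳ′ q) eq with refl ← ∷ʳ-injectiveʳ (ls ++ qs) ls′ (trans (++-assoc ls qs [ q ]) eq) =
      inj₁ (∈-++⁺ˡ (∈-++⁺ʳ qs (here refl)))

-- Paths and cycles in a graph of maximum degree two.
module Paths {n : ℕ} (_~_ : Fin n → Fin n → Set) (_~?_ : ∀ u v → Dec (u ~ v))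
  (~-sym : ∀ {u v} → u ~ v → v ~ u) (~-irrefl : ∀ {u} → ¬ (u ~ u))
  (degree≤2 : ∀ {a b c d} → a ~ b → a ~ c → a ~ d → b ≡ c ⊎ b ≡ d ⊎ c ≡ d) where

  linked-++ʳ : ∀ ls {rs} → Linked _~_ (ls ++ rs) → Linked _~_ rs
  linked-++ʳ [] l = l
  linked-++ʳ (_ ∷ ls) l = linked-++ʳ ls (Linked.tail l)

  linked-++ˡ : ∀ ls {rs} → Linked _~_ (ls ++ rs) → Linked _~_ ls
  linked-++ˡ [] _ = []
  linked-++ˡ (_ ∷ []) _ = [-]
  linked-++ˡ (_ ∷ x ∷ ls) (r ∷ l) = r ∷ linked-++ˡ (x ∷ ls) l

  linked-at : ∀ ls {a b rs} → Linked _~_ (ls ++ a ∷ b ∷ rs) → a ~ b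
  linked-at ls l = Linked.head (linked-++ʳ ls l)

  linked-∷ʳ : ∀ ls {a b} → Linked _~_ (ls ∷ʳ a) → a ~ b → Linked _~_ (ls ∷ʳ a ∷ʳ b)
  linked-∷ʳ [] _ ab = ab ∷ [-]
  linked-∷ʳ (_ ∷ []) (r ∷ _) ab = r ∷ ab ∷ [-]
  linked-∷ʳ (_ ∷ y ∷ ls) (r ∷ l) ab = r ∷ linked-∷ʳ (y ∷ ls) l ab

  linked-reverse : ∀ {xs} → Linked _~_ xs → Linked _~_ (reverse xs)
  linked-reverse [] = []
  linked-reverse [-] = [-]
  linked-reverse {x ∷ y ∷ xs} (r ∷ l) =
    subst (Linked _~_) (≡-sym eq) (linked-∷ʳ (reverse xs)
      (subst (Linked _~_) (unfold-reverse y xs) (linked-reverse l)) (~-sym r))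
    where
    eq : reverse (x ∷ y ∷ xs) ≡ reverse xs ∷ʳ y ∷ʳ x
    eq = trans (unfold-reverse x (y ∷ xs)) (cong (_∷ʳ x) (unfold-reverse y xs))

  linked-closed : ∀ {Z : Fin n → Set} → (∀ {a b} → Z a → a ~ b → Z b) →
                  ∀ {xs a b} → Linked _~_ xs → a ∈ xs → Z a → b ∈ xs → Z b
  linked-closed Z-closed [-] (here refl) Za (here refl) = Za
  linked-closed Z-closed (r ∷ l) (here refl) Za (here refl) = Za
  linked-closed Z-closed (r ∷ l) (here refl) Za (there b∈) = linked-closed Z-closed l (here refl) (Z-closed Za r) b∈
  linked-closed Z-closed (r ∷ l) (there a∈) Za (there b∈) = linked-closed Z-closed l a∈ Za b∈
  linked-closed Z-closed (r ∷ l) (there a∈) Za (here refl) =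
    Z-closed (linked-closed Z-closed l a∈ Za (here refl)) (~-sym r)

  -- A path, listed from end to end, that cannot be prolonged; degree at most two then makes the
  -- list closed under adjacency. A cycle is listed in the same way, its two ends being adjacent.
  record Component (xs : List (Fin n)) : Set where
    field
      first last  : Fin n
      tail        : List (Fin n)
      init        : List (Fin n)
      first-eq    : xs ≡ first ∷ tail
      last-eq     : xs ≡ init ∷ʳ last
      unique      : Unique xs
      linked      : Linked _~_ xs
      first-stuck : ∀ {b} → first ~ b → b ∈ xs
      last-stuck  : ∀ {b} → last ~ b → b ∈ xs

    first∈ : first ∈ xs
    first∈ = subst (first ∈_) (≡-sym first-eq) (here refl)

    last∈ : last ∈ xs
    last∈ = subst (last ∈_) (≡-sym last-eq) (∈-++⁺ʳ init (here refl))

    Interior : Fin n → Set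
    Interior a = ∃₂ λ ls p → ∃₂ λ q rs → xs ≡ ls ++ p ∷ a ∷ q ∷ rs

    locate : ∀ {a} → a ∈ xs → a ≡ first ⊎ a ≡ last ⊎ Interior a
    locate {a} a∈ with ∈-∃++ a∈
    ... | ls , rs , eq = go (initLast ls) rs eq
      where
      go : ∀ {ls} → InitLast ls → ∀ rs → xs ≡ ls ++ a ∷ rs → a ≡ first ⊎ a ≡ last ⊎ Interior a
      go [] rs eq = inj₁ (∷-injectiveˡ (trans (≡-sym eq) first-eq))
      go (ls ∷ʳ′ p) [] eq = inj₂ (inj₁ (∷ʳ-injectiveʳ (ls ∷ʳ p) init (trans (≡-sym eq) last-eq)))
      go (ls ∷ʳ′ p) (q ∷ rs) eq = inj₂ (inj₂ (ls , p , q , rs , trans eq (++-assoc ls [ p ] _)))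

    interior-neighbours : ∀ {a} ls p q rs → xs ≡ ls ++ p ∷ a ∷ q ∷ rs → a ~ p × a ~ q × p ≢ q
    interior-neighbours {a} ls p q rs refl =
      ~-sym (linked-at ls linked) ,
      Linked.head (Linked.tail (linked-++ʳ ls linked)) ,
      (λ { refl → case unique-++ʳ ls unique of λ { ((_ ∷ p# ∷ _) ∷ _) → p# refl } })

    interior-closed : ∀ {a b} ls p q rs → xs ≡ ls ++ p ∷ a ∷ q ∷ rs → a ~ b → b ≡ p ⊎ b ≡ q
    interior-closed {a} {b} ls p q rs eq ab with interior-neighbours ls p q rs eq
    ... | ap , aq , p≢q with degree≤2 ap aq ab
    ... | inj₁ p≡q = contradiction p≡q p≢q
    ... | inj₂ (inj₁ p≡b) = inj₁ (≡-sym p≡b)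
    ... | inj₂ (inj₂ q≡b) = inj₂ (≡-sym q≡b)

    adjacents : ∀ {a} ls p q rs → xs ≡ ls ++ p ∷ a ∷ q ∷ rs → Adjacent xs p a × Adjacent xs a q
    adjacents ls p q rs eq = (ls , q ∷ rs , eq) , (ls ∷ʳ p , rs , trans eq (≡-sym (++-assoc ls [ p ] _)))

    Wraps : Fin n → Fin n → Set
    Wraps a b = (a ≡ first × b ≡ last) ⊎ (a ≡ last × b ≡ first)

    -- An interior vertex has its two list neighbours and no others; the ends are covered by the
    -- stuck fields. An edge between the two ends is reported as `Wraps` even in a list of two
    -- vertices, where it is also an edge of the list.
    closed : ∀ {a b} → a ∈ xs → a ~ b → b ∈ xs × (Adjacent xs a b ⊎ Adjacent xs b a ⊎ Wraps a b)
    closed {a} {b} a∈ ab with locate a∈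
    ... | inj₂ (inj₂ (ls , p , q , rs , eq)) with adjacents ls p q rs eq | interior-closed ls p q rs eq ab
    ...   | pa , aq | inj₁ refl = subst (b ∈_) (≡-sym eq) (∈-++⁺ʳ ls (here refl)) , inj₂ (inj₁ pa)
    ...   | pa , aq | inj₂ refl = subst (b ∈_) (≡-sym eq) (∈-++⁺ʳ ls (there (there (here refl)))) , inj₁ aq
    closed {a} {b} a∈ ab | inj₁ refl = b∈ , other
      where
      b∈ = first-stuck ab
      other : Adjacent xs a b ⊎ Adjacent xs b a ⊎ Wraps a b
      other with locate b∈
      ... | inj₁ refl = contradiction ab ~-irrefl
      ... | inj₂ (inj₁ refl) = inj₂ (inj₂ (inj₁ (refl , refl)))
      ... | inj₂ (inj₂ (ls , p , q , rs , eq)) with adjacents ls p q rs eq | interior-closed ls p q rs eq (~-sym ab)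
      ...   | pb , bq | inj₁ refl = inj₁ pb
      ...   | pb , bq | inj₂ refl = inj₂ (inj₁ bq)
    closed {a} {b} a∈ ab | inj₂ (inj₁ refl) = b∈ , other
      where
      b∈ = last-stuck ab
      other : Adjacent xs a b ⊎ Adjacent xs b a ⊎ Wraps a b
      other with locate b∈
      ... | inj₁ refl = inj₂ (inj₂ (inj₂ (refl , refl)))
      ... | inj₂ (inj₁ refl) = contradiction ab ~-irrefl
      ... | inj₂ (inj₂ (ls , p , q , rs , eq)) with adjacents ls p q rs eq | interior-closed ls p q rs eq (~-sym ab)
      ...   | pb , bq | inj₁ refl = inj₁ pb
      ...   | pb , bq | inj₂ refl = inj₂ (inj₁ bq)

    first-neighbour : first ≢ last → ∃ (first ~_)
    first-neighbour f≢l with tail | first-eq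
    ... | [] | eq = contradiction (∷ʳ-injectiveʳ [] init (trans (≡-sym eq) last-eq)) f≢l
    ... | y ∷ _ | eq = y , linked-at [] (subst (Linked _~_) eq linked)

    last-neighbour : first ≢ last → ∃ (last ~_)
    last-neighbour f≢l with init | last-eq | initLast init
    ... | _ | eq | [] = contradiction (≡-sym (∷ʳ-injectiveʳ [] [] (trans (≡-sym eq) first-eq′))) f≢l
      where
      first-eq′ : xs ≡ [ first ]
      first-eq′ = trans eq (cong [_] (≡-sym (∷-injectiveˡ (trans (≡-sym first-eq) eq))))
    ... | _ | eq | ys ∷ʳ′ y = y , ~-sym (linked-at ys (subst (Linked _~_) (trans eq (++-assoc ys [ y ] _)) linked))
  open Component public

  record Stuck (x : Fin n) (xs : List (Fin n)) : Set where
    field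
      head  : Fin n
      front rest : List (Fin n)
      eq     : head ∷ rest ≡ front ++ x ∷ xs
      uniq   : Unique (head ∷ rest)
      link   : Linked _~_ (head ∷ rest)
      stuck  : ∀ {b} → head ~ b → b ∈ head ∷ rest

  -- A list without repetition has at most `n` vertices, so fuel `n` suffices to prolong the path at
  -- its head until it contains every neighbour of the head.
  grow : ∀ fuel x xs → n ≤ fuel + length xs → Unique (x ∷ xs) → Linked _~_ (x ∷ xs) → Stuck x xs
  grow zero x xs n≤ xs! l = contradiction
    (≤-trans (unique-⊆⇒length≤ xs! (λ {y} _ → ∈-allFin y)) (≤-reflexive (Data.List.Properties.length-tabulate id)))
    (<⇒≱ (s≤s n≤))
  grow (suc fuel) x xs n≤ xs! l with Fin.any? (λ b → (x ~? b) ×-dec ¬? (any? (b Fin.≟_) (x ∷ xs)))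
  ... | no none = record
    { head = x ; front = [] ; rest = xs ; eq = refl ; uniq = xs! ; link = l
    ; stuck = λ {b} xb → decidable-stable (any? (b Fin.≟_) (x ∷ xs)) (λ b∉ → none (b , xb , b∉)) }
  ... | yes (b , xb , b∉) = record
    { Stuck s hiding (front; eq)
    ; front = Stuck.front s ∷ʳ b
    ; eq = trans (Stuck.eq s) (≡-sym (++-assoc (Stuck.front s) [ b ] (x ∷ xs))) }
    where
    s = grow fuel b (x ∷ xs) (≤-trans n≤ (≤-reflexive (≡-sym (+-suc fuel (length xs)))))
          (All.¬Any⇒All¬ (x ∷ xs) b∉ ∷ xs!) (~-sym xb ∷ l)

  -- The path grown from `u` is reversed and grown at its other end. The first end stays stuck
  -- because the second phase only adds vertices.
  componentOf : ∀ u → ∃ λ xs → u ∈ xs × Component xs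
  componentOf u with grow n u [] (m≤m+n n 0) ([] ∷ []) [-]
  ... | record { head = y ; front = zs ; rest = ys ; eq = eq ; uniq = ys! ; link = l ; stuck = y-stuck } =
    finish (reverse (y ∷ ys)) refl
    where
    rev-eq : reverse (y ∷ ys) ≡ reverse ys ∷ʳ y
    rev-eq = unfold-reverse y ys
    finish : ∀ rs → rs ≡ reverse (y ∷ ys) → ∃ λ xs → u ∈ xs × Component xs
    finish [] eq₀ with reverse ys | trans eq₀ rev-eq
    ... | [] | ()
    ... | _ ∷ _ | ()
    finish (r ∷ rs) eq₀ with grow n r rs (m≤m+n n _)
           (subst Unique (≡-sym eq₀) (Unique-resp-↭ (↭-sym (↭-reverse (y ∷ ys))) ys!))
           (subst (Linked _~_) (≡-sym eq₀) (linked-reverse l))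
    ... | record { head = x ; front = ws ; rest = xs ; eq = eq₁ ; uniq = xs! ; link = l₁ ; stuck = x-stuck } =
      x ∷ xs , ⊆xs (subst (u ∈_) (≡-sym eq) (∈-++⁺ʳ zs (here refl))) , record
        { first = x ; last = y ; tail = xs ; init = ws ++ reverse ys
        ; first-eq = refl
        ; last-eq = trans eq₁ (trans (cong (ws ++_) (trans eq₀ rev-eq)) (≡-sym (++-assoc ws (reverse ys) [ y ])))
        ; unique = xs! ; linked = l₁ ; first-stuck = x-stuck ; last-stuck = λ yb → ⊆xs (y-stuck yb) }
      where
      ⊆xs : ∀ {v} → v ∈ y ∷ ys → v ∈ x ∷ xs
      ⊆xs v∈ = subst (_ ∈_) (≡-sym eq₁) (∈-++⁺ʳ ws (subst (_ ∈_) (≡-sym eq₀) (reverse⁺ v∈)))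

  record Cover (us : List (Fin n)) : Set where
    field
      comps     : List (List (Fin n))
      component : ∀ {xs} → xs ∈ comps → Component xs
      covers    : ∀ {u} → u ∈ us → ∃ λ xs → xs ∈ comps × u ∈ xs
      disjoint  : ∀ {xs ys u} → xs ∈ comps → ys ∈ comps → u ∈ xs → u ∈ ys → xs ≡ ys

  -- A component is added only for a vertex not yet covered. If it met an old one, closedness of the
  -- old one, followed along the new path, would put that vertex in the old one.
  cover : ∀ us → Cover us
  cover [] = record { comps = [] ; component = λ () ; covers = λ () ; disjoint = λ () }
  cover (u ∷ us) = extendBy (any? (λ xs → any? (u Fin.≟_) xs) comps)
    where
    open Cover (cover us)
    extendBy : Dec (Any (u ∈_) comps) → Cover (u ∷ us)
    extendBy (yes covered) = record
      { comps = comps ; component = component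
      ; covers = λ { (here refl) → find covered ; (there v∈) → covers v∈ }
      ; disjoint = disjoint }
    extendBy (no uncovered) with componentOf u
    ... | xs , u∈xs , C = record
      { comps = xs ∷ comps
      ; component = λ { (here refl) → C ; (there ys∈) → component ys∈ }
      ; covers = λ { (here refl) → xs , here refl , u∈xs
                   ; (there v∈) → let ys , ys∈ , v∈ys = covers v∈ in ys , there ys∈ , v∈ys }
      ; disjoint = disjoint′ }
      where
      apart : ∀ {ys v} → ys ∈ comps → v ∈ xs → v ∉ ys
      apart ys∈ v∈xs v∈ys = uncovered (lose ys∈
        (linked-closed (λ a∈ ab → proj₁ (closed (component ys∈) a∈ ab)) (linked C) v∈xs v∈ys u∈xs))
      disjoint′ : ∀ {ys zs v} → ys ∈ xs ∷ comps → zs ∈ xs ∷ comps → v ∈ ys → v ∈ zs → ys ≡ zs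
      disjoint′ (here refl) (here refl) _ _ = refl
      disjoint′ (here refl) (there zs∈) v∈ys v∈zs = contradiction v∈zs (apart zs∈ v∈ys)
      disjoint′ (there ys∈) (here refl) v∈ys v∈zs = contradiction v∈ys (apart ys∈ v∈zs)
      disjoint′ (there ys∈) (there zs∈) = disjoint ys∈ zs∈

-- Cutting lists into segments.

module _ {A : Set} where

  ++⇒length≤ˡ : ∀ {xs : List A} ls {rs} → xs ≡ ls ++ rs → length ls ≤ length xs
  ++⇒length≤ˡ ls {rs} refl = ≤-trans (m≤m+n (length ls) (length rs)) (≤-reflexive (≡-sym (length-++ ls)))

  ++⇒length≤ʳ : ∀ {xs : List A} ls {rs} → xs ≡ ls ++ rs → length rs ≤ length xs
  ++⇒length≤ʳ ls {rs} refl = ≤-trans (m≤n+m (length rs) (length ls)) (≤-reflexive (≡-sym (length-++ ls)))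

  -- Options are taken at these vertices only: both neighbours of such a vertex in its component lie
  -- in the same segment, so one switch per segment never switches two adjacent vertices of a
  -- component.
  inner : List A → List A
  inner xs = take (length xs ∸ 2) (drop 1 xs)

  length-inner : ∀ xs → length (inner xs) ≡ length xs ∸ 2
  length-inner xs = begin
    length (inner xs)                            ≡⟨ length-take (length xs ∸ 2) (drop 1 xs) ⟩
    (length xs ∸ 2) ⊓ length (drop 1 xs)         ≡⟨ cong ((length xs ∸ 2) ⊓_) (length-drop 1 xs) ⟩
    (length xs ∸ 2) ⊓ (length xs ∸ 1)            ≡⟨ m≤n⇒m⊓n≡m (∸-monoʳ-≤ (length xs) (s≤s z≤n)) ⟩
    length xs ∸ 2                                ∎
    where
    open ≡-Reasoning
    open Data.Nat using (_⊓_)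

  inner-eq : ∀ xs → 2 ≤ length xs → ∃₂ λ a b → xs ≡ a ∷ inner xs ++ [ b ]
  inner-eq (_ ∷ []) (s≤s ())
  inner-eq (a ∷ x ∷ xs) _ = a , proj₁ (go x xs) , cong (a ∷_) (proj₂ (go x xs))
    where
    go : ∀ x xs → ∃ λ b → x ∷ xs ≡ take (length xs) (x ∷ xs) ++ [ b ]
    go x [] = x , refl
    go x (y ∷ ys) = proj₁ (go y ys) , cong (x ∷_) (proj₂ (go y ys))

  inner⊆ : ∀ xs {v} → v ∈ inner xs → v ∈ xs
  inner⊆ (a ∷ []) ()
  inner⊆ (a ∷ x ∷ xs) {v} v∈ with _ , _ , eq ← inner-eq (a ∷ x ∷ xs) (s≤s (s≤s z≤n)) =
    subst (v ∈_) (≡-sym eq) (there (∈-++⁺ˡ v∈))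

  inner-interior : ∀ s → 2 ≤ length s → ∀ {v} → v ∈ inner s → ∃₂ λ ls p → ∃₂ λ q rs → s ≡ ls ++ p ∷ v ∷ q ∷ rs
  inner-interior s 2≤ v∈ with a , b , eq ← inner-eq s 2≤ with inner s | ∈-∃++ v∈
  ... | _ | m₁ , m₂ , refl = go a m₁ m₂ eq
    where
    go : ∀ {s v b} a m₁ m₂ → s ≡ a ∷ (m₁ ++ v ∷ m₂) ++ [ b ] → ∃₂ λ ls p → ∃₂ λ q rs → s ≡ ls ++ p ∷ v ∷ q ∷ rs
    go {b = b} a [] [] eq = [] , a , b , [] , eq
    go {b = b} a [] (q ∷ m₂) eq = [] , a , q , m₂ ++ [ b ] , eq
    go a (x ∷ m₁) m₂ refl with ls , p , q , rs , eq ← go x m₁ m₂ refl = a ∷ ls , p , q , rs , cong (a ∷_) eq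

-- Segments of length ℓ = suc ℓ′.
module Chopping {A : Set} (ℓ′ : ℕ) (1≤ℓ′ : 1 ≤ ℓ′) where

  h : ℕ
  h = ⌊ suc ℓ′ /2⌋

  1≤h : 1 ≤ h
  1≤h = ⌊n/2⌋-mono (s≤s 1≤ℓ′)

  h≤ℓ′ : h ≤ ℓ′
  h≤ℓ′ = ≤-pred (⌊n/2⌋<n ℓ′)

  2h≤ℓ : h + h ≤ suc ℓ′
  2h≤ℓ = ≤-trans (+-monoʳ-≤ h (⌊n/2⌋≤⌈n/2⌉ (suc ℓ′))) (≤-reflexive (⌊n/2⌋+⌈n/2⌉≡n (suc ℓ′)))

  data Chop : List (List A) → List A → Set where
    rest    : ∀ {zs} → length zs ≤ h → Chop [] zs
    segment : ∀ s {ss zs} → length s ≡ suc ℓ′ → Chop ss zs → Chop (s ∷ ss) (s ++ zs)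

  chop : ∀ q t zs → length zs ≡ q * suc ℓ′ + t → t ≤ h → ∃ λ ss → Chop ss zs
  chop zero t zs |zs| t≤h = [] , rest (≤-trans (≤-reflexive |zs|) t≤h)
  chop (suc q) t zs |zs| t≤h
    with ss , c ← chop q t (drop (suc ℓ′) zs)
           (trans (length-drop (suc ℓ′) zs) (trans (cong (_∸ suc ℓ′) (trans |zs| (+-assoc (suc ℓ′) _ t))) (m+n∸m≡n (suc ℓ′) _))) t≤h =
    _ , subst (Chop _) (take++drop≡id (suc ℓ′) zs)
      (segment (take (suc ℓ′) zs) (trans (length-take (suc ℓ′) zs) (m≤n⇒m⊓n≡m ℓ≤)) c)
    where
    ℓ≤ : suc ℓ′ ≤ length zs
    ℓ≤ = subst (suc ℓ′ ≤_) (≡-sym (trans |zs| (+-assoc (suc ℓ′) _ t))) (m≤m+n (suc ℓ′) _)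

  segment⁻ : ∀ {ss zs s} → Chop ss zs → s ∈ ss → length s ≡ suc ℓ′ × ∃₂ λ ls rs → zs ≡ ls ++ s ++ rs
  segment⁻ (segment s {zs = zs} |s| c) (here refl) = |s| , [] , zs , refl
  segment⁻ (segment s |s| c) (there s∈) with |s′| , ls , rs , refl ← segment⁻ c s∈ =
    |s′| , s ++ ls , rs , ≡-sym (++-assoc s ls _)

  segments-disjoint : ∀ {ss zs s s′ v} → Chop ss zs → Unique zs → s ∈ ss → s′ ∈ ss → v ∈ s → v ∈ s′ → s ≡ s′
  segments-disjoint (segment s _ c) zs! (here refl) (here refl) _ _ = refl
  segments-disjoint (segment s _ c) zs! (here refl) (there s′∈) v∈s v∈s′ with _ , ls , rs , refl ← segment⁻ c s′∈ =
    contradiction (∈-++⁺ʳ ls (∈-++⁺ˡ v∈s′)) (unique-++-disjoint s zs! v∈s)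
  segments-disjoint (segment s _ c) zs! (there s∈) (here refl) v∈s v∈s′ with _ , ls , rs , refl ← segment⁻ c s∈ =
    contradiction (∈-++⁺ʳ ls (∈-++⁺ˡ v∈s)) (unique-++-disjoint s zs! v∈s′)
  segments-disjoint (segment s _ c) zs! (there s∈) (there s′∈) =
    segments-disjoint c (unique-++ʳ s zs!) s∈ s′∈

  record Chopped (xs : List A) : Set where
    field
      pre zs  : List A
      segs    : List (List A)
      eq      : xs ≡ pre ++ zs
      |pre|   : length pre ≤ h
      chopped : Chop segs zs

  chopUp : ∀ xs → Chopped xs
  chopUp xs = record
    { pre = take a xs ; zs = drop a xs ; eq = ≡-sym (take++drop≡id a xs)
    ; |pre| = ≤-trans (≤-reflexive (length-take a xs)) (≤-trans (m⊓n≤m a N) a≤h)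
    ; chopped = proj₂ pieces }
    where

    N = length xs
    q = N / suc ℓ′
    r = N % suc ℓ′
    -- The remainder is shared between the two ends, at most half a segment each. Left at one end it
    -- could be almost a whole segment, and the final bound would grow from about three segment
    -- lengths to four.
    a = ⌊ r /2⌋
    b = ⌈ r /2⌉
    b≤h : b ≤ h
    -- `⌈ r /2⌉` is `⌊ suc r /2⌋` by definition, so `r < suc ℓ′` is exactly what monotonicity needs.
    b≤h = ⌊n/2⌋-mono (m%n<n N (suc ℓ′))
    a≤h : a ≤ h
    a≤h = ≤-trans (⌊n/2⌋≤⌈n/2⌉ r) b≤h
    |zs| : length (drop a xs) ≡ q * suc ℓ′ + b
    |zs| = begin
      length (drop a xs)              ≡⟨ length-drop a xs ⟩
      N ∸ a                           ≡⟨ cong (_∸ a) (m≡m%n+[m/n]*n N (suc ℓ′)) ⟩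
      r + q * suc ℓ′ ∸ a              ≡⟨ cong (λ r → r + q * suc ℓ′ ∸ a) (⌊n/2⌋+⌈n/2⌉≡n r) ⟨
      a + b + q * suc ℓ′ ∸ a          ≡⟨ cong (_∸ a) (+-assoc a b _) ⟩
      a + (b + q * suc ℓ′) ∸ a        ≡⟨ m+n∸m≡n a _ ⟩
      b + q * suc ℓ′                  ≡⟨ +-comm b _ ⟩
      q * suc ℓ′ + b                  ∎
      where open ≡-Reasoning
    pieces = chop q b (drop a xs) |zs| b≤h

  -- Bounds a stretch that reaches an end of the list and avoids a set hitting every segment: half a
  -- segment of leftover and a proper part of one segment.
  E : ℕ
  E = ℓ′ + h

  module _ {xs : List A} (C : Chopped xs) where
    open Chopped C

    short-or-segment : length xs ≤ suc ℓ′ ⊎ ∃ (_∈ segs)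
    short-or-segment with segs | chopped
    ... | [] | rest |zs| = inj₁ (≤-trans (≤-reflexive (trans (cong length eq) (length-++ pre))) (≤-trans (+-mono-≤ |pre| |zs|) 2h≤ℓ))
    ... | s ∷ _ | _ = inj₂ (s , here refl)

    segment-of : ∀ {s} → s ∈ segs → length s ≡ suc ℓ′ × ∃₂ λ ls rs → xs ≡ ls ++ s ++ rs
    segment-of s∈ with |s| , ls , rs , zs≡ ← segment⁻ chopped s∈ =
      |s| , pre ++ ls , rs , trans eq (trans (cong (pre ++_) zs≡) (≡-sym (++-assoc pre ls _)))

    segments-apart : ∀ {s s′ v} → Unique xs → s ∈ segs → s′ ∈ segs → v ∈ s → v ∈ s′ → s ≡ s′
    segments-apart xs! = segments-disjoint chopped (unique-++ʳ pre (subst Unique eq xs!))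

  module Hitting (T : A → Set) (T? : Decidable T) where

    Hit : List A → Set
    Hit s = ∃ λ t → t ∈ s × T t

    Free : List A → Set
    Free p = ∀ {v} → v ∈ p → ¬ T v

    free-not-hit : ∀ {s p} → Hit s → (∀ {v} → v ∈ s → v ∈ p) → ¬ Free p
    free-not-hit (t , t∈ , Tt) s⊆p p-free = p-free (s⊆p t∈) Tt

    free⇒rest : ∀ {ss zs} → Chop ss zs → (∀ {s} → s ∈ ss → Hit s) → Free zs → length zs ≤ h
    free⇒rest (rest |zs|) hits free = |zs|
    free⇒rest (segment s _ c) hits free = contradiction (λ {v} → free {v}) (free-not-hit (hits (here refl)) ∈-++⁺ˡ)

    proper-prefix : ∀ {s : List A} p es → length s ≡ suc ℓ′ → s ≡ p ++ es → Hit s → Free p → length p ≤ ℓ′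
    proper-prefix p [] |s| eq hit free =
      contradiction (λ {v} → free {v}) (free-not-hit hit (λ v∈ → subst (_ ∈_) (trans eq (++-identityʳ p)) v∈))
    proper-prefix p (e ∷ es) |s| refl hit free = ≤-pred (≤-trans
      (≤-trans (m<m+n (length p) (s≤s z≤n)) (≤-reflexive (≡-sym (length-++ p)))) (≤-reflexive |s|))

    proper-suffix : ∀ {s : List A} es p → length s ≡ suc ℓ′ → s ≡ es ++ p → Hit s → Free p → length p ≤ ℓ′
    proper-suffix [] p |s| refl hit free = contradiction (λ {v} → free {v}) (free-not-hit hit id)
    proper-suffix (e ∷ es) p |s| refl hit free = ≤-pred (≤-trans (s≤s (++⇒length≤ʳ es refl)) (≤-reflexive |s|))

    prefix : ∀ {ss zs} → Chop ss zs → (∀ {s} → s ∈ ss → Hit s) → ∀ p rs → zs ≡ p ++ rs → Free p → length p ≤ ℓ′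
    prefix (rest |zs|) hits p rs eq free = ≤-trans (≤-trans (++⇒length≤ˡ p eq) |zs|) h≤ℓ′
    prefix (segment s |s| c) hits p rs eq free with ++-split s p eq
    ... | inj₁ (es , refl , _) = contradiction (λ {v} → free {v}) (free-not-hit (hits (here refl)) ∈-++⁺ˡ)
    ... | inj₂ (es , s≡ , _) = proper-prefix p es |s| s≡ (hits (here refl)) free

    suffix : ∀ {ss zs} → Chop ss zs → (∀ {s} → s ∈ ss → Hit s) → ∀ ls p → zs ≡ ls ++ p → Free p → length p ≤ ℓ′ + h
    suffix (rest |zs|) hits ls p eq free = ≤-trans (≤-trans (++⇒length≤ʳ ls eq) |zs|) (m≤n+m h ℓ′)
    suffix (segment s |s| c) hits ls p eq free with ++-split s ls eq
    ... | inj₁ (es , _ , zs≡) = suffix c (hits ∘ there) es p zs≡ free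
    ... | inj₂ (es , s≡ , refl) = ≤-trans (≤-reflexive (length-++ es))
            (+-mono-≤ (proper-suffix ls es |s| s≡ (hits (here refl)) (free ∘ ∈-++⁺ˡ))
                      (free⇒rest c (hits ∘ there) (free ∘ ∈-++⁺ʳ es)))

    -- A free stretch contains no whole segment, so it runs at most from a proper suffix of one
    -- segment into a proper prefix of what follows. The `suc` comes from a stretch inside a single
    -- segment, bounded by the whole segment; `1≤h` absorbs it later.
    infix′ : ∀ {ss zs} → Chop ss zs → (∀ {s} → s ∈ ss → Hit s) → ∀ ls p rs → zs ≡ ls ++ p ++ rs → Free p → length p ≤ suc (ℓ′ + ℓ′)
    infix′ (rest |zs|) hits ls p rs eq free =
      ≤-trans (≤-trans (≤-trans (++⇒length≤ˡ p refl) (++⇒length≤ʳ ls eq)) |zs|) (≤-trans h≤ℓ′ (≤-trans (m≤m+n ℓ′ ℓ′) (n≤1+n _)))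
    infix′ (segment s |s| c) hits ls p rs eq free with ++-split s ls eq
    ... | inj₁ (es , _ , zs≡) = infix′ c (hits ∘ there) es p rs zs≡ free
    ... | inj₂ (es , s≡ , eq′) with ++-split es p (≡-sym eq′)
    ...   | inj₁ (es′ , refl , zs≡) = ≤-trans (≤-reflexive (length-++ es)) (≤-trans
              (+-mono-≤ (proper-suffix ls es |s| s≡ (hits (here refl)) (free ∘ ∈-++⁺ˡ))
                        (prefix c (hits ∘ there) es′ rs zs≡ (free ∘ ∈-++⁺ʳ es))) (n≤1+n _))
    ...   | inj₂ (es′ , refl , _) = ≤-trans (++⇒length≤ˡ p refl)
              (≤-trans (++⇒length≤ʳ ls s≡) (≤-trans (≤-reflexive |s|) (s≤s (m≤m+n ℓ′ ℓ′))))

    module _ {xs : List A} (C : Chopped xs) (hits : ∀ {s} → s ∈ Chopped.segs C → Hit s) where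
      open Chopped C

      free-prefix : ∀ p rs → xs ≡ p ++ rs → Free p → length p ≤ E
      free-prefix p rs xs≡ free with ++-split pre p (trans (≡-sym eq) xs≡)
      ... | inj₁ (es , refl , zs≡) = ≤-trans (≤-reflexive (length-++ pre)) (≤-trans
              (+-mono-≤ |pre| (prefix chopped hits es rs zs≡ (free ∘ ∈-++⁺ʳ pre))) (≤-reflexive (+-comm h ℓ′)))
      ... | inj₂ (es , pre≡ , _) = ≤-trans (++⇒length≤ˡ p pre≡) (≤-trans |pre| (m≤n+m h ℓ′))

      free-suffix : ∀ ls p → xs ≡ ls ++ p → Free p → length p ≤ E
      free-suffix ls p xs≡ free with ++-split pre ls (trans (≡-sym eq) xs≡)
      ... | inj₁ (es , _ , zs≡) = suffix chopped hits es p zs≡ free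
      ... | inj₂ (es , pre≡ , refl) = ≤-trans (≤-reflexive (length-++ es)) (+-mono-≤
              (≤-trans (≤-trans (++⇒length≤ʳ ls pre≡) |pre|) h≤ℓ′)
              (free⇒rest chopped hits (free ∘ ∈-++⁺ʳ es)))

      free-infix : ∀ ls p rs → xs ≡ ls ++ p ++ rs → Free p → length p ≤ E + E
      free-infix ls p rs xs≡ free with ++-split pre ls (trans (≡-sym eq) xs≡)
      ... | inj₁ (es , _ , zs≡) = ≤-trans (infix′ chopped hits es p rs zs≡ free) (≤-trans
              (≤-trans (+-monoˡ-≤ (ℓ′ + ℓ′) 1≤h) (≤-reflexive (trans (≡-sym (+-assoc h ℓ′ ℓ′)) (cong (_+ ℓ′) (+-comm h ℓ′)))))
              (+-monoʳ-≤ E (m≤m+n ℓ′ h)))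
      ... | inj₂ (es , pre≡ , eq′) with ++-split es p (≡-sym eq′)
      ...   | inj₂ (es′ , es≡ , _) = ≤-trans (≤-trans (≤-trans (++⇒length≤ˡ p es≡) (++⇒length≤ʳ ls pre≡)) |pre|)
                (≤-trans (m≤n+m h ℓ′) (m≤m+n E E))
      ...   | inj₁ (es′ , refl , zs≡) = ≤-trans (≤-reflexive (length-++ es)) (+-mono-≤
                (≤-trans (≤-trans (++⇒length≤ʳ ls pre≡) |pre|) (m≤n+m h ℓ′))
                (≤-trans (prefix chopped hits es′ rs zs≡ (free ∘ ∈-++⁺ʳ es)) (m≤m+n ℓ′ h)))

    StartsHit : List A → Set
    StartsHit rs = rs ≡ [] ⊎ ∃₂ λ t rs′ → rs ≡ t ∷ rs′ × T t

    EndsHit : List A → Set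
    EndsHit ls = ls ≡ [] ⊎ ∃₂ λ ls′ t → ls ≡ ls′ ∷ʳ t × T t

    -- Maximality is recorded by the borders: on each side the stretch stops at an end of the list
    -- or at a vertex of `T`.
    record Run (xs : List A) (u : A) : Set where
      field
        ls p rs : List A
        eq      : xs ≡ ls ++ p ++ rs
        u∈p     : u ∈ p
        free    : Free p
        left    : EndsHit ls
        right   : StartsHit rs

    initial-run : ∀ xs → ∃₂ λ p rs → xs ≡ p ++ rs × Free p × StartsHit rs
    initial-run [] = [] , [] , refl , (λ ()) , inj₁ refl
    initial-run (x ∷ xs) with T? x
    ... | yes Tx = [] , x ∷ xs , refl , (λ ()) , inj₂ (x , xs , refl , Tx)
    ... | no ¬Tx with p , rs , refl , free , right ← initial-run xs =
      x ∷ p , rs , refl , (λ { (here refl) → ¬Tx ; (there v∈) → free v∈ }) , right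

    run : ∀ {xs u} → u ∈ xs → ¬ T u → Run xs u
    run {x ∷ xs} (here refl) ¬Tx with p , rs , refl , free , right ← initial-run xs = record
      { ls = [] ; p = x ∷ p ; rs = rs ; eq = refl ; u∈p = here refl
      ; free = λ { (here refl) → ¬Tx ; (there v∈) → free v∈ } ; left = inj₁ refl ; right = right }
    run {x ∷ xs} (there u∈) ¬Tu with run u∈ ¬Tu
    ... | record { ls = ls ; p = p ; rs = rs ; eq = eq ; u∈p = u∈p ; free = free
                 ; left = inj₂ (ls′ , t , refl , Tt) ; right = right } = record
      { ls = x ∷ ls′ ∷ʳ t ; p = p ; rs = rs ; eq = cong (x ∷_) eq ; u∈p = u∈p ; free = free
      ; left = inj₂ (x ∷ ls′ , t , refl , Tt) ; right = right }
    ... | record { p = p ; rs = rs ; eq = eq ; u∈p = u∈p ; free = free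
                 ; left = inj₁ refl ; right = right } with T? x
    ...   | yes Tx = record
      { ls = [ x ] ; p = p ; rs = rs ; eq = cong (x ∷_) eq ; u∈p = u∈p ; free = free
      ; left = inj₂ ([] , x , refl , Tx) ; right = right }
    ...   | no ¬Tx = record
      { ls = [] ; p = x ∷ p ; rs = rs ; eq = cong (x ∷_) eq ; u∈p = there u∈p
      ; free = λ { (here refl) → ¬Tx ; (there v∈) → free v∈ } ; left = inj₁ refl ; right = right }

-- Counting along paths, and the length of segments.

-- A path on s vertices has s - 1 edges, each counted in both orders; the 2 on the right replaces
-- the subtraction.
∑-linked : ∀ {A : Set} {R : A → A → Set} (f : A → A → ℕ) → (∀ {a b} → R a b → 1 ≤ f a b × 1 ≤ f b a) →
           ∀ {S} → Linked R S → length S + length S ≤ 2 + ∑ S (λ v → ∑ S (f v))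
∑-linked f R⇒ [] = z≤n
∑-linked f R⇒ [-] = s≤s (s≤s z≤n)
∑-linked f R⇒ {a ∷ b ∷ S} (ab ∷ l) with R⇒ ab
... | 1≤fab , 1≤fba = begin
  length (a ∷ S′) + length (a ∷ S′)                     ≡⟨ shape (length S′) ⟩
  2 + (length S′ + length S′)                           ≤⟨ +-monoʳ-≤ 2 (∑-linked f R⇒ l) ⟩
  2 + (2 + ∑ S′ (λ v → ∑ S′ (f v)))                     ≤⟨ +-monoʳ-≤ 2 (+-monoˡ-≤ _ (+-mono-≤ (row 1≤fab) (col 1≤fba))) ⟩
  2 + (∑ (a ∷ S′) (f a) + ∑ S′ (λ v → f v a) + ∑ S′ (λ v → ∑ S′ (f v)))
    ≡⟨ cong (2 +_) (+-assoc (∑ (a ∷ S′) (f a)) _ _) ⟩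
  2 + (∑ (a ∷ S′) (f a) + (∑ S′ (λ v → f v a) + ∑ S′ (λ v → ∑ S′ (f v))))
    ≡⟨ cong (λ s → 2 + (∑ (a ∷ S′) (f a) + s)) (∑-+ S′ (λ v → f v a) _) ⟨
  2 + ∑ (a ∷ S′) (λ v → ∑ (a ∷ S′) (f v))               ∎
  where
  open ≤-Reasoning
  S′ = b ∷ S
  shape : ∀ m → suc m + suc m ≡ 2 + (m + m)
  shape = solve-∀
  row : 1 ≤ f a b → 1 ≤ ∑ (a ∷ S′) (f a)
  row 1≤ = ≤-trans (≤-trans 1≤ (m≤m+n _ _)) (m≤n+m _ (f a a))
  col : 1 ≤ f b a → 1 ≤ ∑ S′ (λ v → f v a)
  col 1≤ = ≤-trans 1≤ (m≤m+n _ _)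

unique-pairs : ∀ {A B : Set} (f : A → List B) {as} → Unique as → (∀ a → Unique (f a)) →
               Unique (concatMap (λ a → map (a ,_) (f a)) as)
unique-pairs f [] f! = []
unique-pairs f {a ∷ as} (a# ∷ as!) f! = Unique.++⁺ (Unique.map⁺ (λ { refl → refl }) (f! a)) (unique-pairs f as! f!)
  λ { (i , j) → case ∈-map⁻ (a ,_) i , find (∈-concatMap⁻ (λ a → map (a ,_) (f a)) {xs = as} j) of
      λ { ((_ , _ , refl) , (a′ , a′∈ , k)) → case ∈-map⁻ (a′ ,_) k of
      λ { (_ , _ , refl) → All.lookup a# a′∈ refl } } }

count-strict : ∀ {n} {p q : Fin n → Bool} b → (∀ w → p w ≡ true → q w ≡ true) → q b ≡ true → p b ≡ false →
               suc (count p) ≤ count q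
count-strict {n} {p} {q} b p⊆q qb ¬pb = begin
  1 + count p                                        ≡⟨ cong (_+ count p) (∑V-single b (λ _ → 1)) ⟨
  ∑V (λ w → ⟦ b Fin.≟ w ⟧ * 1) + count p             ≡⟨ ∑-+ (allFin n) _ _ ⟨
  ∑V (λ w → ⟦ b Fin.≟ w ⟧ * 1 + b2n (p w))           ≤⟨ ∑-mono (allFin n) pointwise ⟩
  count q                                            ∎
  where
  open ≤-Reasoning
  pointwise : ∀ w → ⟦ b Fin.≟ w ⟧ * 1 + b2n (p w) ≤ b2n (q w)
  pointwise w with b Fin.≟ w
  ... | yes refl rewrite qb | ¬pb = ≤-refl
  ... | no _ with p w | p⊆q w
  ...   | true | q-true rewrite q-true refl = ≤-refl
  ...   | false | _ = z≤n

not-does⁺ : ∀ {P : Set} (d : Dec P) → ¬ P → not (does d) ≡ true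
not-does⁺ d ¬p = cong not (dec-false d ¬p)

not-does⁻ : ∀ {P : Set} (d : Dec P) → not (does d) ≡ true → ¬ P
not-does⁻ (no ¬p) _ = ¬p

∧-true⁺ : ∀ {a b} → a ≡ true → b ≡ true → a ∧ b ≡ true
∧-true⁺ refl refl = refl

-- This is `ℓ′`: a segment has `ℓ′` + 1 vertices, hence `ℓ′` - 1 inner ones and at least `ℓ′` - 2
-- options. The class size `Δ + Δ`, that is 18κ, leads to 18κ + 2; for κ = 0 this would allow an
-- empty class, so 3 is taken.
segmentLength : ℕ → ℕ
segmentLength zero = 3
segmentLength (suc j) = 18 * suc j + 2

2≤segmentLength : ∀ κ → 2 ≤ segmentLength κ
2≤segmentLength zero = s≤s (s≤s z≤n)
2≤segmentLength (suc j) = m≤n+m 2 (18 * suc j)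

-- Segments, options and conflicts in an optimal colouring.

module Clustering {n : ℕ} (G : Graph n) (L : Fin n → List ℕ) (L! : ∀ v → Unique (L v)) (κ : ℕ)
  (|L|≤ : ∀ v → length (L v) ≤ suc κ)
  (sparse : ∀ {S} → Unique S → 0 < length S →
            ∑ S (λ v → count (adj G v) + ∑ S (λ w → b2n (adj G v w))) < ∑ S (λ v → 3 * length (L v))) where

  deg<3|L| : ∀ v → Counting.deg G v < 3 * length (L v)
  deg<3|L| v = begin-strict
    count (adj G v)                                      ≡⟨ +-identityʳ _ ⟨
    count (adj G v) + 0                                  ≤⟨ +-monoʳ-≤ (count (adj G v)) z≤n ⟩
    count (adj G v) + (b2n (adj G v v) + 0)              ≡⟨ +-identityʳ _ ⟨
    count (adj G v) + (b2n (adj G v v) + 0) + 0          <⟨ sparse {[ v ]} ([] ∷ []) (s≤s z≤n) ⟩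
    3 * length (L v) + 0                                 ≡⟨ +-identityʳ _ ⟩
    3 * length (L v)                                     ∎
    where open ≤-Reasoning

  open Colourings G L L! deg<3|L|

  deg≤ : ∀ v → deg v ≤ 3 * κ + 2
  deg≤ v = ≤-pred (≤-trans (deg<3|L| v) (≤-trans (*-monoʳ-≤ 3 (|L|≤ v)) (≤-reflexive (shape κ))))
    where
    shape : ∀ κ → 3 * suc κ ≡ suc (3 * κ + 2)
    shape = solve-∀

module Minimum {n : ℕ} (G : Graph n) (L : Fin n → List ℕ) (L! : ∀ v → Unique (L v)) (κ : ℕ)
  (|L|≤ : ∀ v → length (L v) ≤ suc κ)
  (sparse : ∀ {S} → Unique S → 0 < length S →
            ∑ S (λ v → count (adj G v) + ∑ S (λ w → b2n (adj G v w))) < ∑ S (λ v → 3 * length (L v)))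
  (deg<3|L| : ∀ v → Counting.deg G v < 3 * length (L v))
  (deg≤ : ∀ v → Counting.deg G v ≤ 3 * κ + 2)
  (φ : Fin n → ℕ) (φ-min : Colourings.IsMin G L L! deg<3|L| φ) where

  open Colourings G L L! deg<3|L|

  own : Fin n → ℕ
  own v = cnt φ (φ v) v

  _~_ : Fin n → Fin n → Set
  u ~ v = adj G u v ≡ true × φ u ≡ φ v

  _~?_ : ∀ u v → Dec (u ~ v)
  u ~? v = (adj G u v Data.Bool.≟ true) ×-dec (φ u ≟ φ v)

  ~-sym : ∀ {u v} → u ~ v → v ~ u
  ~-sym (uv , eq) = adj-sym uv , ≡-sym eq

  neighbours≤own : ∀ {v xs} → Unique xs → (∀ {x} → x ∈ xs → v ~ x) → length xs ≤ own v
  neighbours≤own {v} xs! v~ = unique≤count xs! (λ x∈ → hasColour⁺ {φ} (proj₁ (v~ x∈)) (≡-sym (proj₂ (v~ x∈))))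

  two-neighbours : ∀ {v a b} → v ~ a → v ~ b → a ≢ b → own v ≡ 2
  two-neighbours va vb a≢b = ≤-antisym (own≤2 φ-min _)
    (neighbours≤own ((a≢b ∷ []) ∷ [] ∷ []) λ { (here refl) → va ; (there (here refl)) → vb })

  ~-degree : ∀ {a b c d} → a ~ b → a ~ c → a ~ d → b ≡ c ⊎ b ≡ d ⊎ c ≡ d
  ~-degree {a} {b} {c} {d} ab ac ad with b Fin.≟ c | b Fin.≟ d | c Fin.≟ d
  ... | yes eq | _ | _ = inj₁ eq
  ... | no _ | yes eq | _ = inj₂ (inj₁ eq)
  ... | no _ | no _ | yes eq = inj₂ (inj₂ eq)
  ... | no b≢c | no b≢d | no c≢d = contradiction (≤-trans
          (neighbours≤own ((b≢c ∷ b≢d ∷ []) ∷ (c≢d ∷ []) ∷ [] ∷ [])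
            λ { (here refl) → ab ; (there (here refl)) → ac ; (there (there (here refl))) → ad })
          (own≤2 φ-min a)) λ { (s≤s (s≤s ())) }

  ~-irrefl : ∀ {u} → ¬ (u ~ u)
  ~-irrefl (uu , _) = adj-irrefl uu refl

  open Paths _~_ _~?_ ~-sym ~-irrefl ~-degree

  module Covered (cov : Cover (allFin n)) where
    open Cover cov

    -- Ends of components.

    interior-own : ∀ {xs a} (C : Component xs) → Interior C a → own a ≡ 2
    interior-own C (ls , p , q , rs , eq) with ap , aq , p≢q ← interior-neighbours C ls p q rs eq =
      two-neighbours ap aq p≢q

    -- Defined by the colour count and not by the position in the list, so that no vertex of a cycle
    -- qualifies; an isolated vertex does.
    IsEnd : Fin n → Set
    IsEnd v = own v ≤ 1

    end⇒first-or-last : ∀ {xs a} (C : Component xs) → a ∈ xs → IsEnd a → a ≡ first C ⊎ a ≡ last C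
    end⇒first-or-last C a∈ a-end with locate C a∈
    ... | inj₁ eq = inj₁ eq
    ... | inj₂ (inj₁ eq) = inj₂ eq
    ... | inj₂ (inj₂ int) = contradiction (subst (_≤ 1) (interior-own C int) a-end) λ { (s≤s ()) }

    same-colour : ∀ {xs a b} → Component xs → a ∈ xs → b ∈ xs → φ a ≡ φ b
    same-colour {a = a} C a∈ b∈ =
      linked-closed {λ v → φ a ≡ φ v} (λ eq vw → trans eq (proj₂ vw)) (linked C) a∈ refl b∈

    home : Fin n → List (Fin n)
    home v = proj₁ (covers (∈-allFin v))

    home∈ : ∀ v → home v ∈ comps
    home∈ v = proj₁ (proj₂ (covers (∈-allFin v)))

    ∈home : ∀ v → v ∈ home v
    ∈home v = proj₂ (proj₂ (covers (∈-allFin v)))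

    -- For an end `v`, the opposite end of its component, which is `v` itself if `v` is isolated.
    other : Fin n → Fin n
    other v = if does (v Fin.≟ first C) then last C else first C
      where C = component (home∈ v)

    -- A list determines its first and last vertex, so any `Component` record for `xs` may replace
    -- the one chosen in `other`.
    other-spec : ∀ {xs v} (C : Component xs) → xs ∈ comps → v ∈ xs →
                 (v ≡ first C → other v ≡ last C) × (v ≢ first C → other v ≡ first C)
    other-spec {v = v} C xs∈ v∈ with refl ← disjoint xs∈ (home∈ v) v∈ (∈home v) = is-first , not-first
      where
      C′ = component (home∈ v)
      first≡ : first C ≡ first C′
      first≡ = ∷-injectiveˡ (trans (≡-sym (first-eq C)) (first-eq C′))
      last≡ : last C ≡ last C′
      last≡ = ∷ʳ-injectiveʳ (init C) (init C′) (trans (≡-sym (last-eq C)) (last-eq C′))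
      is-first : v ≡ first C → other v ≡ last C
      is-first eq rewrite dec-true (v Fin.≟ first C′) (trans eq first≡) = ≡-sym last≡
      not-first : v ≢ first C → other v ≡ first C
      not-first neq rewrite dec-false (v Fin.≟ first C′) (λ eq → neq (trans eq (≡-sym first≡))) = ≡-sym first≡

    end-pair : ∀ {xs a b} → xs ∈ comps → a ∈ xs → b ∈ xs → IsEnd a → IsEnd b → a ≡ b ⊎ a ≡ other b
    end-pair {xs} {a} {b} xs∈ a∈ b∈ a-end b-end = go (component xs∈)
      where
      go : Component xs → a ≡ b ⊎ a ≡ other b
      go C with other-spec C xs∈ b∈ | end⇒first-or-last C a∈ a-end | end⇒first-or-last C b∈ b-end
      ... | _ | inj₁ a≡f | inj₁ b≡f = inj₁ (trans a≡f (≡-sym b≡f))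
      ... | _ | inj₂ a≡l | inj₂ b≡l = inj₁ (trans a≡l (≡-sym b≡l))
      ... | b-first , _ | inj₂ a≡l | inj₁ b≡f = inj₂ (trans a≡l (≡-sym (b-first b≡f)))
      ... | b-first , not-first | inj₁ a≡f | inj₂ b≡l with b Fin.≟ first C
      ...   | yes b≡f = inj₁ (trans a≡f (≡-sym b≡f))
      ...   | no b≢f = inj₂ (trans a≡f (≡-sym (not-first b≢f)))

    other∈ : ∀ {xs v} → xs ∈ comps → v ∈ xs → other v ∈ xs
    other∈ {xs} {v} xs∈ v∈ = go (component xs∈)
      where
      go : Component xs → other v ∈ xs
      go C with other-spec C xs∈ v∈ | v Fin.≟ first C
      ... | is-first , _ | yes eq = subst (_∈ xs) (≡-sym (is-first eq)) (last∈ C)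
      ... | _ , not-first | no neq = subst (_∈ xs) (≡-sym (not-first neq)) (first∈ C)

    other-colour : ∀ v → φ (other v) ≡ φ v
    other-colour v = same-colour (component (home∈ v)) (other∈ (home∈ v) (∈home v)) (∈home v)

    other-involutive : ∀ {v} → IsEnd v → other (other v) ≡ v
    other-involutive {v} v-end = go (component (home∈ v))
      where
      go : Component (home v) → other (other v) ≡ v
      go C with other-spec C (home∈ v) (∈home v) | other-spec C (home∈ v) (other∈ (home∈ v) (∈home v))
              | end⇒first-or-last C (∈home v) v-end | v Fin.≟ first C
      ... | _ | _ | inj₁ v≡f | no v≢f = contradiction v≡f v≢f
      ... | _ , not-first | o-first , _ | inj₂ v≡l | no v≢f = trans (o-first (not-first v≢f)) (≡-sym v≡l)
      ... | is-first , _ | o-first , o-not-first | _ | yes v≡f with other v Fin.≟ first C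
      ...   | yes o≡f = trans (o-first o≡f) (trans (≡-sym (is-first v≡f)) (trans o≡f (≡-sym v≡f)))
      ...   | no o≢f = trans (o-not-first o≢f) (≡-sym v≡f)

    other-neighbour : ∀ {v} → IsEnd v → other v ≢ v → ∃ (v ~_) × ∃ (other v ~_)
    other-neighbour {v} v-end o≢v = go (component (home∈ v))
      where
      go : Component (home v) → ∃ (v ~_) × ∃ (other v ~_)
      go C with other-spec C (home∈ v) (∈home v) | end⇒first-or-last C (∈home v) v-end | v Fin.≟ first C
      ... | _ | inj₁ v≡f | no v≢f = contradiction v≡f v≢f
      ... | is-first , _ | _ | yes v≡f =
        subst (λ v → ∃ (v ~_)) (≡-sym v≡f) (first-neighbour C f≢l) ,
        subst (λ v → ∃ (v ~_)) (≡-sym (is-first v≡f)) (last-neighbour C f≢l)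
        where
        f≢l : first C ≢ last C
        f≢l f≡l = o≢v (trans (is-first v≡f) (trans (≡-sym f≡l) (≡-sym v≡f)))
      ... | _ , not-first | inj₂ v≡l | no v≢f =
        subst (λ v → ∃ (v ~_)) (≡-sym v≡l) (last-neighbour C f≢l) ,
        subst (λ v → ∃ (v ~_)) (≡-sym (not-first v≢f)) (first-neighbour C f≢l)
        where
        f≢l : first C ≢ last C
        f≢l f≡l = v≢f (trans v≡l (≡-sym f≡l))

    target-end : ∀ {v c x} → Option φ v c → adj G v x ≡ true → φ x ≡ c → IsEnd x
    target-end o vx refl = target≤1 φ-min o vx refl

    -- Conflicts between options.

    O : Set
    O = Fin n × ℕ

    Valid : O → Set
    Valid (v , c) = Option φ v c

    -- Neighbours that might be switched to `c` as well. One coloured `c` already has that colour;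
    -- one coloured `φ v` lies in the component of `v`, where the choice of one inner vertex per
    -- segment keeps switched vertices apart.
    nearby : Fin n → ℕ → Fin n → Bool
    nearby v c w = adj G v w ∧ not (does (φ w ≟ φ v)) ∧ not (does (φ w ≟ c))

    -- Vertices whose switch to `c` would attach them to the end opposite the target `x`, so that
    -- the old component of `x` could link them to `v`.
    across : Fin n → ℕ → Fin n → Fin n → Bool
    across v c x w = adj G (other x) w ∧ not (does (φ w ≟ c)) ∧ not (does (v Fin.≟ w))

    targets : Fin n → ℕ → List (Fin n)
    targets v c = select (hasColour φ c v)

    N : O → List O
    N (v , c) = map (_, c) (select (nearby v c)) ++
                concatMap (λ x → map (_, c) (select (across v c x))) (targets v c)

    N-nearby : ∀ {v w c} → adj G v w ≡ true → φ w ≢ φ v → φ w ≢ c → (w , c) ∈ N (v , c)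
    N-nearby {v} {w} {c} vw w≢v w≢c = ∈-++⁺ˡ (∈-map⁺ (_, c) (select⁺ {p = nearby v c}
      (∧-true⁺ vw (∧-true⁺ (not-does⁺ (φ w ≟ φ v) w≢v) (not-does⁺ (φ w ≟ c) w≢c)))))

    N-across : ∀ {v w c x} → adj G v x ≡ true → φ x ≡ c → adj G (other x) w ≡ true → φ w ≢ c → v ≢ w →
               (w , c) ∈ N (v , c)
    N-across {v} {w} {c} {x} vx x≡c xw w≢c v≢w = ∈-++⁺ʳ _ (∈-concatMap⁺ _ (lose
      (select⁺ {p = hasColour φ c v} (hasColour⁺ {φ} vx x≡c))
      (∈-map⁺ (_, c) (select⁺ {p = across v c x}
        (∧-true⁺ xw (∧-true⁺ (not-does⁺ (φ w ≟ c) w≢c) (not-does⁺ (v Fin.≟ w) v≢w)))))))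

    -- If `w` attaches opposite the target `x` of `v`, then `other x` is a target of `w`, and its
    -- opposite end is `x` again, since `other` is an involution on ends and targets are ends.
    N-sym : ∀ {a b} → Valid a → Valid b → b ∈ N a → a ∈ N b
    N-sym {v , c} {w , d} o o′ wd∈ with ∈-++⁻ (map (_, c) (select (nearby v c))) wd∈
    ... | inj₁ i with _ , w∈ , refl ← ∈-map⁻ (_, c) i
      with vw , r ← ∧-true⁻ (select⁻ {p = nearby v c} w∈) with w≢v , _ ← ∧-true⁻ r =
      N-nearby (adj-sym vw) (not-does⁻ (φ w ≟ φ v) w≢v ∘ ≡-sym) (c≢ o)
    ... | inj₂ i with x , x∈ , j ← find (∈-concatMap⁻ (λ x → map (_, c) (select (across v c x))) {xs = targets v c} i)
      with _ , w∈ , refl ← ∈-map⁻ (_, c) j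
      with xw , r ← ∧-true⁻ (select⁻ {p = across v c x} w∈) with _ , v≢w ← ∧-true⁻ r
      with vx , x≡c ← hasColour⁻ {φ} {c} {v} (select⁻ {p = hasColour φ c v} x∈) =
      N-across (adj-sym xw) (trans (other-colour x) x≡c)
        (subst (λ y → adj G y v ≡ true) (≡-sym (other-involutive (target-end o vx x≡c))) (adj-sym vx))
        (c≢ o) (not-does⁻ (v Fin.≟ w) v≢w ∘ ≡-sym)

    -- Two neighbours of `v` have its own colour and two others have colour `c`; none of these is
    -- nearby.
    nearby-count : ∀ {v c} → Option φ v c → count (nearby v c) + 4 ≤ deg v
    nearby-count {v} {c} o = begin
      count (nearby v c) + 4                             ≡⟨ cong (count (nearby v c) +_) (cong₂ _+_ (own≡2 o) (new≡2 o)) ⟨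
      count (nearby v c) + (cnt φ (φ v) v + cnt φ c v)   ≡⟨ cong (count (nearby v c) +_) (∑-+ (allFin n) _ _) ⟨
      count (nearby v c) + ∑V (λ w → b2n (hasColour φ (φ v) v w) + b2n (hasColour φ c v w))
                                                         ≡⟨ ∑-+ (allFin n) _ _ ⟨
      ∑V (λ w → b2n (nearby v c w) + (b2n (hasColour φ (φ v) v w) + b2n (hasColour φ c v w)))
                                                         ≤⟨ ∑-mono (allFin n) pointwise ⟩
      deg v                                              ∎
      where
      open ≤-Reasoning
      pointwise : ∀ w → b2n (nearby v c w) + (b2n (hasColour φ (φ v) v w) + b2n (hasColour φ c v w)) ≤ b2n (adj G v w)
      pointwise w with adj G v w
      ... | false = z≤n
      ... | true with φ w ≟ φ v | φ w ≟ c
      ...   | yes w≡v | yes w≡c = contradiction (trans (≡-sym w≡v) w≡c) (c≢ o)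
      ...   | yes w≡v | no w≢c rewrite dec-true (φ w ≟ φ v) w≡v | dec-false (φ w ≟ c) w≢c = ≤-refl
      ...   | no w≢v | yes w≡c rewrite dec-false (φ w ≟ φ v) w≢v | dec-true (φ w ≟ c) w≡c = ≤-refl
      ...   | no w≢v | no w≢c rewrite dec-false (φ w ≟ φ v) w≢v | dec-false (φ w ≟ c) w≢c = ≤-refl

    -- At least one neighbour of `other x` is excluded: `v` if `x` is its own opposite end, and
    -- otherwise a neighbour in the same component, which has colour `c`.
    across-count : ∀ {v c x} → Option φ v c → adj G v x ≡ true → φ x ≡ c → count (across v c x) ≤ 3 * κ + 1
    across-count {v} {c} {x} o vx x≡c = ≤-pred (≤-trans strict (≤-trans (deg≤ (other x)) (≤-reflexive (+-suc (3 * κ) 1))))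
      where
      ⊆adj : ∀ w → across v c x w ≡ true → adj G (other x) w ≡ true
      ⊆adj w r = proj₁ (∧-true⁻ r)
      not-across : ∀ {w} → φ w ≡ c ⊎ v ≡ w → across v c x w ≡ false
      not-across {w} bad with across v c x w in eq
      ... | false = refl
      ... | true with w≢c , v≢w ← ∧-true⁻ (proj₂ (∧-true⁻ {adj G (other x) w} eq)) =
        contradiction bad [ not-does⁻ (φ w ≟ c) w≢c , not-does⁻ (v Fin.≟ w) v≢w ]′
      strict : suc (count (across v c x)) ≤ deg (other x)
      strict with other x Fin.≟ x
      ... | yes o≡x = count-strict v ⊆adj
              (subst (λ y → adj G y v ≡ true) (≡-sym o≡x) (adj-sym vx)) (not-across (inj₂ refl))
      ... | no o≢x with _ , b , ob , colour ← other-neighbour (target-end o vx x≡c) o≢x =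
        count-strict b ⊆adj ob (not-across (inj₁ (trans (≡-sym colour) (trans (other-colour x) x≡c))))

    Δ : ℕ
    Δ = 9 * κ

    -- Degree at most 3κ + 2 leaves at most 3κ - 2 nearby conflicts, and each of the two targets
    -- adds at most 3κ + 1, in all 9κ.
    N-small : ∀ {o} → Valid o → length (N o) ≤ Δ
    N-small {v , c} o = begin
      length (N (v , c))
        ≡⟨ length-++ (map (_, c) (select (nearby v c))) ⟩
      length (map (_, c) (select (nearby v c))) + length (concatMap f (targets v c))
        ≡⟨ cong (_+ length (concatMap f (targets v c))) (trans (length-map (_, c) (select (nearby v c))) (length-select (nearby v c))) ⟩
      count (nearby v c) + length (concatMap f (targets v c))
        ≤⟨ +-monoʳ-≤ (count (nearby v c)) (bound (targets v c) id) ⟩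
      count (nearby v c) + length (targets v c) * (3 * κ + 1)
        ≡⟨ cong (λ m → count (nearby v c) + m * (3 * κ + 1)) (trans (length-select (hasColour φ c v)) (new≡2 o)) ⟩
      count (nearby v c) + 2 * (3 * κ + 1)
        ≡⟨ shape₁ (count (nearby v c)) κ ⟩
      count (nearby v c) + 2 + 6 * κ
        ≤⟨ +-monoˡ-≤ (6 * κ) (+-cancelʳ-≤ 2 _ _ (≤-trans (≤-reflexive (+-assoc _ 2 2)) (≤-trans (nearby-count o) (deg≤ v)))) ⟩
      3 * κ + 6 * κ
        ≡⟨ shape₂ κ ⟩
      Δ ∎
      where
      open ≤-Reasoning
      f : Fin n → List O
      f x = map (_, c) (select (across v c x))
      shape₁ : ∀ a κ → a + 2 * (3 * κ + 1) ≡ a + 2 + 6 * κ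
      shape₁ = solve-∀
      shape₂ : ∀ κ → 3 * κ + 6 * κ ≡ 9 * κ
      shape₂ = solve-∀
      bound : ∀ xs → (∀ {x} → x ∈ xs → x ∈ targets v c) → length (concatMap f xs) ≤ length xs * (3 * κ + 1)
      bound [] _ = z≤n
      bound (x ∷ xs) ⊆ with vx , x≡c ← hasColour⁻ {φ} {c} {v} (select⁻ {p = hasColour φ c v} (⊆ (here refl))) =
        ≤-trans (≤-reflexive (length-++ (f x))) (+-mono-≤
          (≤-trans (≤-reflexive (trans (length-map (_, c) (select (across v c x))) (length-select (across v c x))))
                   (across-count o vx x≡c))
          (bound xs (⊆ ∘ there)))

    -- Segments of components.

    ℓ′ : ℕ
    ℓ′ = segmentLength κ

    2≤ℓ′ : 2 ≤ ℓ′
    2≤ℓ′ = 2≤segmentLength κ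

    open Chopping {Fin n} ℓ′ (≤-trans (n≤1+n 1) 2≤ℓ′)
    open Options φ

    module Chopped′ (chopOf : ∀ xs → Chopped xs) where

      segsOf : List (Fin n) → List (List (Fin n))
      segsOf xs = Chopped.segs (chopOf xs)

      segments : List (List (Fin n))
      segments = concatMap segsOf comps

      segment-home : ∀ {s} → s ∈ segments → ∃ λ xs → xs ∈ comps × s ∈ segsOf xs
      segment-home s∈ = find (∈-concatMap⁻ segsOf {xs = comps} s∈)

      segments-disjoint′ : ∀ {s s′ v} → s ∈ segments → s′ ∈ segments → v ∈ s → v ∈ s′ → s ≡ s′
      segments-disjoint′ s∈ s′∈ v∈s v∈s′
        with xs , xs∈ , s∈xs ← segment-home s∈ | ys , ys∈ , s′∈ys ← segment-home s′∈
        with _ , ls , rs , eq ← segment-of (chopOf xs) s∈xs | _ , ls′ , rs′ , eq′ ← segment-of (chopOf ys) s′∈ys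
        with refl ← disjoint xs∈ ys∈ (subst (_ ∈_) (≡-sym eq) (∈-++⁺ʳ ls (∈-++⁺ˡ v∈s)))
                                     (subst (_ ∈_) (≡-sym eq′) (∈-++⁺ʳ ls′ (∈-++⁺ˡ v∈s′))) =
        segments-apart (chopOf xs) (unique (component xs∈)) s∈xs s′∈ys v∈s v∈s′

      classOf : List (Fin n) → List O
      classOf s = concatMap (λ v → map (v ,_) (options v)) (inner s)

      module Segment {s : List (Fin n)} (s∈ : s ∈ segments) where
        xs = proj₁ (segment-home s∈)
        C = component (proj₁ (proj₂ (segment-home s∈)))
        pos = segment-of (chopOf xs) (proj₂ (proj₂ (segment-home s∈)))

        |s| : length s ≡ suc ℓ′
        |s| = proj₁ pos

        split : ∃₂ λ ls rs → xs ≡ ls ++ s ++ rs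
        split = proj₂ pos

        2≤|s| : 2 ≤ length s
        2≤|s| = ≤-trans (≤-trans 2≤ℓ′ (n≤1+n ℓ′)) (≤-reflexive (≡-sym |s|))

        inner-position : ∀ {v} → v ∈ inner s → ∃₂ λ ls p → ∃₂ λ q rs → xs ≡ ls ++ p ∷ v ∷ q ∷ rs × p ∈ s × q ∈ s
        inner-position {v} v∈ with ls , rs , eq ← split | ms , p , q , ns , s≡ ← inner-interior s 2≤|s| v∈ =
          ls ++ ms , p , q , ns ++ rs ,
          trans eq (trans (cong (λ s → ls ++ s ++ rs) s≡)
            (trans (cong (ls ++_) (++-assoc ms _ rs)) (≡-sym (++-assoc ls ms _)))) ,
          subst (p ∈_) (≡-sym s≡) (∈-++⁺ʳ ms (here refl)) ,
          subst (q ∈_) (≡-sym s≡) (∈-++⁺ʳ ms (there (there (here refl))))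

        inner-own : ∀ {v} → v ∈ inner s → own v ≡ 2
        inner-own v∈ with ls , p , q , rs , eq , _ ← inner-position v∈ = interior-own C (ls , p , q , rs , eq)

        inner-closed : ∀ {v w} → v ∈ inner s → v ~ w → w ∈ s
        inner-closed v∈ vw with ls , p , q , rs , eq , p∈ , q∈ ← inner-position v∈
          with interior-closed C ls p q rs eq vw
        ... | inj₁ refl = p∈
        ... | inj₂ refl = q∈

        inner-unique : Unique (inner s)
        inner-unique with ls , rs , eq ← split =
          Unique.take⁺ (length s ∸ 2) (Unique.drop⁺ 1
            (unique-++ˡ s (unique-++ʳ ls (subst Unique eq (unique C)))))

        inner-linked : Linked _~_ (inner s)
        inner-linked with ls , rs , eq ← split | a , b , s≡ ← inner-eq s 2≤|s| =
          linked-++ˡ (inner s) (Linked.tail (subst (Linked _~_) s≡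
            (linked-++ˡ s (linked-++ʳ ls (subst (Linked _~_) eq (linked C))))))

        |inner| : suc (length (inner s)) ≡ ℓ′
        |inner| = trans (cong suc (trans (length-inner s) (cong (_∸ 2) |s|))) (go ℓ′ 2≤ℓ′)
          where
          go : ∀ m → 2 ≤ m → suc (suc m ∸ 2) ≡ m
          go (suc m) _ = refl

        class = classOf s

        class⁻ : ∀ {v c} → (v , c) ∈ class → v ∈ inner s × Option φ v c
        class⁻ o∈ with v , v∈ , i ← find (∈-concatMap⁻ (λ v → map (v ,_) (options v)) {xs = inner s} o∈)
          with _ , c∈ , refl ← ∈-map⁻ (v ,_) i = v∈ , options⁻ (inner-own v∈) c∈

        class-unique : Unique class
        class-unique = unique-pairs options inner-unique options-unique

        |class| : length class ≡ ∑ (inner s) (λ v → length (options v))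
        |class| = go (inner s)
          where
          go : ∀ vs → length (concatMap (λ v → map (v ,_) (options v)) vs) ≡ ∑ vs (λ v → length (options v))
          go [] = refl
          go (v ∷ vs) = trans (length-++ (map (v ,_) (options v))) (cong₂ _+_ (length-map (v ,_) (options v)) (go vs))

        -- The path inner s has length inner s ∸ 1 edges, so sparseness leaves about one option per vertex.
        class-large : ℓ′ ≤ 2 + length class
        class-large = begin
          ℓ′                      ≡⟨ |inner| ⟨
          suc (length S)          ≤⟨ +-cancelʳ-≤ (length S) _ _ (≤-trans (+-cancelˡ-≤ (∑ S deg) _ _ bound) (≤-reflexive shape)) ⟩
          2 + length class        ∎
          where
          open ≤-Reasoning
          S = inner s
          S>0 : 0 < length S
          S>0 = ≤-pred (≤-trans 2≤ℓ′ (≤-reflexive (≡-sym |inner|)))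
          shape : 2 + (length S + length class) ≡ 2 + length class + length S
          shape = cong (2 +_) (+-comm (length S) (length class))
          -- Three facts are chained: the path contributes at least 2|S| - 2 to the degrees inside
          -- `S`, sparseness bounds the degrees by the lists, and `many-options` bounds the lists by
          -- degrees and options. Then `∑ S deg` and one |S| cancel.
          bound : ∑ S deg + (suc (length S) + length S) ≤ ∑ S deg + (2 + (length S + length class))
          bound = begin
            ∑ S deg + suc (length S + length S)
              ≤⟨ +-monoʳ-≤ (∑ S deg) (s≤s (∑-linked (λ v w → b2n (adj G v w))
                   (λ (ab , _) → ≤-reflexive (≡-sym (cong b2n ab)) , ≤-reflexive (≡-sym (cong b2n (adj-sym ab)))) inner-linked)) ⟩
            ∑ S deg + (3 + ∑ S (λ v → ∑ S (λ w → b2n (adj G v w))))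
              ≡⟨ rearrange (∑ S deg) _ ⟩
            2 + suc (∑ S deg + ∑ S (λ v → ∑ S (λ w → b2n (adj G v w))))
              ≡⟨ cong (λ m → 2 + suc m) (∑-+ S deg _) ⟨
            2 + suc (∑ S (λ v → deg v + ∑ S (λ w → b2n (adj G v w))))
              ≤⟨ +-monoʳ-≤ 2 (sparse inner-unique S>0) ⟩
            2 + ∑ S (λ v → 3 * length (L v))
              ≤⟨ +-monoʳ-≤ 2 (∑-mono-∈ S (λ {v} v∈ → many-options φ-min v (inner-own v∈))) ⟩
            2 + ∑ S (λ v → deg v + suc (length (options v)))
              ≡⟨ cong (2 +_) (trans (∑-+ S deg _) (cong (∑ S deg +_) (∑-+ S (λ _ → 1) _))) ⟩
            2 + (∑ S deg + (∑ S (λ _ → 1) + ∑ S (λ v → length (options v))))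
              ≡⟨ cong₂ (λ a b → 2 + (∑ S deg + (a + b))) (∑-one S) (≡-sym |class|) ⟩
            2 + (∑ S deg + (length S + length class))
              ≡⟨ rearrange₂ (∑ S deg) (length S + length class) ⟩
            ∑ S deg + (2 + (length S + length class)) ∎
            where
            rearrange : ∀ a b → a + (3 + b) ≡ 2 + suc (a + b)
            rearrange = solve-∀
            rearrange₂ : ∀ a b → 2 + (a + b) ≡ a + (2 + b)
            rearrange₂ = solve-∀

-- Arithmetic of the constants.

segmentLength-large : ∀ κ m → segmentLength κ ≤ 2 + m → 9 * κ + 9 * κ ≤ m × 0 < m
segmentLength-large zero m 3≤ = z≤n , ≤-pred (≤-pred 3≤)
segmentLength-large (suc j) m large = ≤-trans (≤-reflexive (shape (suc j))) 18≤m , ≤-trans (s≤s z≤n) 18≤m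
  where
  shape : ∀ κ → 9 * κ + 9 * κ ≡ 18 * κ
  shape = solve-∀
  18≤m : 18 * suc j ≤ m
  18≤m = +-cancelʳ-≤ 2 _ _ (≤-trans large (≤-reflexive (+-comm 2 m)))

clusterBound : ℕ → ℕ
clusterBound κ = 57 * κ + 6

-- Serves the components too short to contain a segment.
segment≤bound : ∀ κ → suc (segmentLength κ) ≤ clusterBound κ
segment≤bound zero = s≤s (s≤s (s≤s (s≤s z≤n)))
segment≤bound (suc j) = ≤-trans (≤-trans (≤-reflexive (≡-sym (+-suc (18 * suc j) 2)))
  (+-monoʳ-≤ (18 * suc j) (s≤s (s≤s (s≤s z≤n))))) (+-monoˡ-≤ 6 (*-monoˡ-≤ (suc j) (≤-trans (m≤m+n 18 39) ≤-refl)))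

-- With κ = j + 1 and ℓ = 18κ + 2 the left side is at most 3ℓ + 2 = 54κ + 8, which exceeds 57κ + 6
-- only for κ = 0.
double-end≤bound : ∀ j h → h + h ≤ suc (segmentLength (suc j)) →
  suc ((segmentLength (suc j) + h) + (segmentLength (suc j) + h)) ≤ clusterBound (suc j)
double-end≤bound j h 2h≤ = begin
  suc ((ℓ + h) + (ℓ + h))   ≡⟨ regroup ℓ h ⟩
  suc (ℓ + ℓ + (h + h))     ≤⟨ s≤s (+-monoʳ-≤ (ℓ + ℓ) 2h≤) ⟩
  suc (ℓ + ℓ + suc ℓ)       ≡⟨ triple j ⟩
  54 * j + 62               ≤⟨ +-mono-≤ (*-monoˡ-≤ j (m≤m+n 54 3)) (n≤1+n 62) ⟩
  57 * j + 63               ≡⟨ total j ⟩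
  clusterBound (suc j)      ∎
  where
  open ≤-Reasoning
  ℓ = segmentLength (suc j)
  regroup : ∀ a b → 1 + ((a + b) + (a + b)) ≡ 1 + (a + a + (b + b))
  regroup = solve-∀
  triple : ∀ i → 1 + ((18 * (1 + i) + 2) + (18 * (1 + i) + 2) + (1 + (18 * (1 + i) + 2))) ≡ 54 * i + 62
  triple = solve-∀
  total : ∀ i → 57 * i + 63 ≡ 57 * (1 + i) + 6
  total = solve-∀

-- Switching an independent choice of options.

-- A closed list through `u` contains the monochromatic component of `u`, so exhibiting a short one
-- is enough; it may contain more than the component, and repetitions.
Clustered : ∀ {n} → Graph n → (Fin n → ℕ) → ℕ → Set
Clustered {n} G ψ m = ∀ u → ∃ λ W → u ∈ W × length W ≤ m ×
  (∀ {a b} → a ∈ W → adj G a b ≡ true → ψ a ≡ ψ b → b ∈ W)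

module Breaking {n : ℕ} (G : Graph n) (L : Fin n → List ℕ) (L! : ∀ v → Unique (L v)) (κ : ℕ)
  (|L|≤ : ∀ v → length (L v) ≤ suc κ)
  (sparse : ∀ {S} → Unique S → 0 < length S →
            ∑ S (λ v → count (adj G v) + ∑ S (λ w → b2n (adj G v w))) < ∑ S (λ v → 3 * length (L v)))
  (deg<3|L| : ∀ v → Counting.deg G v < 3 * length (L v))
  (deg≤ : ∀ v → Counting.deg G v ≤ 3 * κ + 2)
  (φ : Fin n → ℕ) (φ-min : Colourings.IsMin G L L! deg<3|L| φ) where

  open Colourings G L L! deg<3|L|
  open Minimum G L L! κ |L|≤ sparse deg<3|L| deg≤ φ φ-min
  open Paths _~_ _~?_ ~-sym ~-irrefl ~-degree

  module _ (cov : Cover (allFin n)) where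
    open Cover cov
    open Covered cov
    open Chopping {Fin n} ℓ′ (≤-trans (n≤1+n 1) 2≤ℓ′)

    module _ (chopOf : ∀ xs → Chopped xs) where
      open Chopped′ chopOf

      _≟ₒ_ : DecidableEquality O
      _≟ₒ_ = Product.≡-dec Fin._≟_ _≟_

      class-sizes : ∀ {s} → s ∈ segments → Δ + Δ ≤ length (classOf s) × 0 < length (classOf s)
      class-sizes {s} s∈ = segmentLength-large κ (length (classOf s)) (Segment.class-large s∈)

      Choice : Set
      Choice = List (List (Fin n) × O)

      IsChosen : Choice → Set
      IsChosen P = (∀ {s : List (Fin n)} {o : O} → (s , o) ∈ P → s ∈ segments × o ∈ classOf s) ×
                   (∀ {p q : List (Fin n) × O} → p ∈ P → q ∈ P → p ≢ q → proj₂ q ∉ N (proj₂ p)) ×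
                   Unique (map proj₁ P) × (∀ {s : List (Fin n)} → s ∈ segments → s ∈ map proj₁ P)

      choice-exists : ∃ IsChosen
      choice-exists = finish (Transversals.transversal _≟ₒ_ N Valid (λ {a} {b} → N-sym {a} {b}) classOf (_∈ segments)
        (λ {s} {s′} s∈ s′∈ o∈ o∈′ → segments-disjoint′ s∈ s′∈
           (inner⊆ s (proj₁ (Segment.class⁻ s∈ o∈))) (inner⊆ s′ (proj₁ (Segment.class⁻ s′∈ o∈′))))
        (λ s∈ o∈ → proj₂ (Segment.class⁻ s∈ o∈))
        (λ s∈ → Segment.class-unique s∈)
        Δ (λ {o} → N-small {o})
        (λ s∈ → proj₁ (class-sizes s∈)) (λ s∈ → proj₂ (class-sizes s∈))
        ks! (All.tabulate (∈-deduplicate⁻ (≡-dec Fin._≟_) segments)))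
        where
        ks : List (List (Fin n))
        ks = deduplicate (≡-dec Fin._≟_) segments
        ks! : Unique ks
        ks! = DecUnique.deduplicate-! (≡-dec Fin._≟_) segments
        finish : (∃ λ P → (∀ {s : List (Fin n)} {o : O} → (s , o) ∈ P → s ∈ segments × o ∈ classOf s) ×
                   (∀ {p q : List (Fin n) × O} → p ∈ P → q ∈ P → p ≢ q → proj₂ q ∉ N (proj₂ p)) × map proj₁ P ↭ ks) → ∃ IsChosen
        finish (P , P∈ , P-ind , P↭) = P , P∈ , P-ind , Unique-resp-↭ (↭-sym P↭) ks! ,
          λ s∈ → ∈-resp-↭ (↭-sym P↭) (∈-deduplicate⁺ (≡-dec Fin._≟_) s∈)

      module Switch (P : Choice)
        (P∈ : ∀ {s : List (Fin n)} {o : O} → (s , o) ∈ P → s ∈ segments × o ∈ classOf s)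
        (P-ind : ∀ {p q : List (Fin n) × O} → p ∈ P → q ∈ P → p ≢ q → proj₂ q ∉ N (proj₂ p))
        (P! : Unique (map proj₁ P)) (P-hits : ∀ {s : List (Fin n)} → s ∈ segments → s ∈ map proj₁ P) where

        bound : ℕ
        bound = clusterBound κ

        -- The vertices that change colour.
        T : Fin n → Set
        T v = Any (λ q → v ≡ proj₁ (proj₂ q)) P

        T? : Decidable T
        T? v = any? (λ q → v Fin.≟ proj₁ (proj₂ q)) P

        open Hitting T T?

        chosen : ∀ {v} → T v → ∃₂ λ (s : List (Fin n)) (c : ℕ) → (s , v , c) ∈ P
        chosen t with (s , _ , c) , q∈ , refl ← find t = s , c , q∈

        chosen-T : ∀ {s v c} → (s , v , c) ∈ P → T v
        chosen-T q∈ = lose q∈ refl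

        P-option : ∀ {s v c} → (s , v , c) ∈ P → s ∈ segments × v ∈ inner s × Option φ v c
        P-option q∈ with s∈ , o∈ ← P∈ q∈ = s∈ , Segment.class⁻ s∈ o∈

        T-option : ∀ {v} → T v → ∃ (Option φ v)
        T-option t with _ , c , q∈ ← chosen t = c , proj₂ (proj₂ (P-option q∈))

        T-own : ∀ {v} → T v → own v ≡ 2
        T-own t = own≡2 (proj₂ (T-option t))

        keys-functional : ∀ {Q : Choice} {s o o′} → Unique (map proj₁ Q) → (s , o) ∈ Q → (s , o′) ∈ Q → o ≡ o′
        keys-functional _ (here refl) (here refl) = refl
        keys-functional (s# ∷ _) (here refl) (there j) = contradiction refl (All.lookup s# (∈-map⁺ proj₁ j))
        keys-functional (s# ∷ _) (there i) (here refl) = contradiction refl (All.lookup s# (∈-map⁺ proj₁ i))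
        keys-functional (_ ∷ Q!) (there i) (there j) = keys-functional Q! i j

        -- Both component neighbours of a chosen vertex lie in its own segment, and a segment
        -- contributes one chosen vertex.
        T-isolated : ∀ {v w} → T v → T w → ¬ (v ~ w)
        T-isolated {v} {w} tv tw vw = go (chosen tv) (chosen tw)
          where
          clash : ∀ {s c s′ c′} → s ≡ s′ → (s , v , c) ∈ P → (s′ , w , c′) ∈ P → ⊥
          clash refl q∈ q∈′ = adj-irrefl (proj₁ vw) (cong proj₁ (keys-functional P! q∈ q∈′))
          go : (∃₂ λ (s : List (Fin n)) (c : ℕ) → (s , v , c) ∈ P) → (∃₂ λ (s : List (Fin n)) (c : ℕ) → (s , w , c) ∈ P) → ⊥
          go (s , c , q∈) (s′ , c′ , q∈′) =
            let s∈ , v∈ , _ = P-option q∈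
                s′∈ , w∈ , _ = P-option q∈′
            in clash (segments-disjoint′ s∈ s′∈ (Segment.inner-closed s∈ v∈ vw) (inner⊆ s′ w∈)) q∈ q∈′

        no-conflict : ∀ {s v c s′ w c′} → (s , v , c) ∈ P → (s′ , w , c′) ∈ P → v ≢ w → (w , c′) ∉ N (v , c)
        no-conflict q∈ q∈′ v≢w = P-ind q∈ q∈′ (λ { refl → v≢w refl })

        segment-hit : ∀ {s} → s ∈ segments → Hit s
        segment-hit {s} s∈ with (s , v , c) , q∈ , refl ← ∈-map⁻ proj₁ (P-hits s∈) =
          v , inner⊆ s (proj₁ (proj₂ (P-option q∈))) , chosen-T q∈

        component-hits : ∀ {xs s} → xs ∈ comps → s ∈ segsOf xs → Hit s
        component-hits xs∈ s∈ = segment-hit (∈-concatMap⁺ segsOf (lose xs∈ s∈))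

        -- An option is a second colour in a list of at most κ + 1, so κ is not 0, the one case in
        -- which the numerical estimate fails.
        option⇒bound : ∀ {v c} → Option φ v c → suc (E + E) ≤ bound
        option⇒bound {v} {c} o = go κ refl
          where
          go : ∀ j → j ≡ κ → suc (E + E) ≤ bound
          go zero refl = contradiction
            (≤-trans (unique-⊆⇒length≤ {xs = φ v ∷ c ∷ []} {L v} ((c≢ o ∷ []) ∷ [] ∷ [])
              (λ { (here refl) → proper φ-min v ; (there (here refl)) → c∈L o })) (|L|≤ v)) λ { (s≤s ()) }
          go (suc j) refl = double-end≤bound j h 2h≤ℓ

        T⇒bound : ∀ {v} → T v → suc (E + E) ≤ bound
        T⇒bound t = option⇒bound (proj₂ (T-option t))

        -- A part of an old component that is closed once the switched vertices are taken out. The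
        -- sharper bound `E` is kept for pieces containing an end, since only these can be attached
        -- to a switched vertex.
        record Piece (p : List (Fin n)) : Set where
          field
            xs     : List (Fin n)
            xs∈    : xs ∈ comps
            ⊆xs    : ∀ {v} → v ∈ p → v ∈ xs
            free   : Free p
            size   : length p ≤ bound
            end    : ∀ {a} → a ∈ p → IsEnd a → length p ≤ E
            closed′ : ∀ {a b} → a ∈ p → a ~ b → b ∈ p ⊎ T b

        module InComponent {xs : List (Fin n)} (xs∈ : xs ∈ comps) (C : Component xs) where

          hits : ∀ {s} → s ∈ segsOf xs → Hit s
          hits = component-hits xs∈

          before-first : ∀ ls p rs → xs ≡ ls ++ p ++ rs → first C ∈ p → ls ≡ []
          before-first ls p rs eq f∈ with p₁ , p₂ , refl ← ∈-∃++ f∈ =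
            Data.List.Properties.++-conicalˡ ls p₁ (unique-first (first C)
              (subst Unique (first-eq C) (unique C))
              (trans (≡-sym (first-eq C)) (trans eq
                (trans (cong (ls ++_) (++-assoc p₁ _ rs)) (≡-sym (++-assoc ls p₁ _))))))

          after-last : ∀ ls p rs → xs ≡ ls ++ p ++ rs → last C ∈ p → rs ≡ []
          after-last ls p rs eq l∈ with p₁ , p₂ , refl ← ∈-∃++ l∈ =
            Data.List.Properties.++-conicalʳ p₂ rs (unique-last {xs = init C}
              (subst Unique (last-eq C) (unique C))
              (trans (≡-sym (last-eq C)) (trans eq
                (trans (cong (ls ++_) (++-assoc p₁ _ rs)) (≡-sym (++-assoc ls p₁ _))))))

          first∈prefix : ∀ {u} p rs → xs ≡ p ++ rs → u ∈ p → first C ∈ p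
          first∈prefix (x ∷ p) rs eq _ = here (∷-injectiveˡ (trans (≡-sym (first-eq C)) eq))

          last∈suffix : ∀ {u} ls p → xs ≡ ls ++ p → u ∈ p → last C ∈ p
          last∈suffix ls p eq u∈ with initLast p
          ... | p′ ∷ʳ′ y = subst (_∈ p′ ∷ʳ y) (≡-sym (∷ʳ-injectiveʳ (init C) (ls ++ p′)
                  (trans (≡-sym (last-eq C)) (trans eq (≡-sym (++-assoc ls p′ [ y ])))))) (∈-++⁺ʳ p′ (here refl))

          module _ {u} (R : Run xs u) where
            open Run R

            p⊆xs : ∀ {v} → v ∈ p → v ∈ xs
            p⊆xs v∈ = subst (_ ∈_) (≡-sym eq) (∈-++⁺ʳ ls (∈-++⁺ˡ v∈))

            run-adjacent : ∀ {a b} → a ∈ p → Adjacent xs a b ⊎ Adjacent xs b a → b ∈ p ⊎ T b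
            run-adjacent a∈ (inj₁ ab) with adjacent-after ls p (unique C) eq a∈ ab
            ... | inj₁ b∈ = inj₁ b∈
            ... | inj₂ (rs′ , rs≡) with right
            ...   | inj₁ rs≡[] = case trans (≡-sym rs≡) rs≡[] of λ ()
            ...   | inj₂ (t , _ , rs≡t , Tt) = inj₂ (subst T (∷-injectiveˡ (trans (≡-sym rs≡t) rs≡)) Tt)
            run-adjacent a∈ (inj₂ ba) with adjacent-before ls p (unique C) eq a∈ ba
            ... | inj₁ b∈ = inj₁ b∈
            ... | inj₂ (ls′ , ls≡) with left
            ...   | inj₁ ls≡[] = case Data.List.Properties.++-conicalʳ ls′ _ (trans (≡-sym ls≡) ls≡[]) of λ ()
            ...   | inj₂ (ls″ , t , ls≡t , Tt) = inj₂ (subst T (∷ʳ-injectiveʳ ls″ ls′ (trans (≡-sym ls≡t) ls≡)) Tt)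

            run-closed : ∀ {a b} → a ∈ p → a ~ b → b ∈ p ⊎ T b ⊎ Wraps C a b
            run-closed a∈ ab with proj₂ (closed C (p⊆xs a∈) ab)
            ... | inj₁ adj = [ inj₁ , inj₂ ∘ inj₁ ]′ (run-adjacent a∈ (inj₁ adj))
            ... | inj₂ (inj₁ adj) = [ inj₁ , inj₂ ∘ inj₁ ]′ (run-adjacent a∈ (inj₂ adj))
            ... | inj₂ (inj₂ wraps) = inj₂ (inj₂ wraps)

            run-end : ∀ {a} → a ∈ p → IsEnd a → length p ≤ E
            run-end a∈ a-end with end⇒first-or-last C (p⊆xs a∈) a-end
            ... | inj₁ refl with refl ← before-first ls p rs eq a∈ = free-prefix (chopOf xs) hits p rs eq free
            ... | inj₂ refl with refl ← after-last ls p rs eq a∈ =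
              free-suffix (chopOf xs) hits ls p (trans eq (cong (ls ++_) (++-identityʳ p))) free

            run-piece : length p ≤ bound →
                        (∀ {a b} → a ∈ p → a ~ b → Wraps C a b → b ∈ p ⊎ T b) → Piece p
            run-piece size wraps = record
              { xs = xs ; xs∈ = xs∈ ; ⊆xs = p⊆xs ; free = free ; size = size ; end = run-end
              ; closed′ = λ a∈ ab → case run-closed a∈ ab of λ
                  { (inj₁ b∈) → inj₁ b∈ ; (inj₂ (inj₁ Tb)) → inj₂ Tb ; (inj₂ (inj₂ w)) → wraps a∈ ab w } }

            run-size : ∀ {t} → T t → length p ≤ bound
            run-size Tt = ≤-trans (free-infix (chopOf xs) hits ls p rs eq free) (≤-trans (n≤1+n _) (T⇒bound Tt))

          -- In a list of two vertices the edge between the ends is the path edge itself, so a cycle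
          -- requires three.
          Cyclic : Set
          Cyclic = first C ~ last C × 3 ≤ length xs

          Cyclic? : Dec Cyclic
          Cyclic? = (first C ~? last C) ×-dec (3 ≤? length xs)

          short-adjacent : length xs ≤ 2 → first C ~ last C → Adjacent xs (first C) (last C)
          short-adjacent |xs|≤2 fl = go (tail C) (first-eq C)
            where
            f≢l : first C ≢ last C
            f≢l = adj-irrefl (proj₁ fl)
            go : ∀ tl → xs ≡ first C ∷ tl → Adjacent xs (first C) (last C)
            go [] eq = contradiction (∷ʳ-injectiveʳ [] (init C) (trans (≡-sym eq) (last-eq C))) f≢l
            go (y ∷ []) eq with refl ← ∷ʳ-injectiveʳ [ first C ] (init C) (trans (≡-sym eq) (last-eq C)) = [] , [] , eq
            go (y ∷ z ∷ tl) eq = contradiction (subst (λ xs → length xs ≤ 2) eq |xs|≤2) λ { (s≤s (s≤s ())) }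

          acyclic-closed : ¬ Cyclic → ∀ {a b} → a ~ b → Wraps C a b → Adjacent xs a b ⊎ Adjacent xs b a
          acyclic-closed ¬cyc ab (inj₁ (refl , refl)) = inj₁ (short-adjacent (≤-pred (≰⇒> (λ 3≤ → ¬cyc (ab , 3≤)))) ab)
          acyclic-closed ¬cyc ab (inj₂ (refl , refl)) = inj₂ (short-adjacent (≤-pred (≰⇒> (λ 3≤ → ¬cyc (~-sym ab , 3≤)))) (~-sym ab))

          -- A listed end of a cycle is adjacent to its neighbour in the list and to the other
          -- listed end, distinct because there are three vertices. Hence a cycle has no vertex
          -- satisfying `IsEnd`.
          cyclic-own : Cyclic → ∀ {a} → a ∈ xs → own a ≡ 2
          cyclic-own (fl , 3≤) a∈ with locate C a∈
          ... | inj₂ (inj₂ int) = interior-own C int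
          ... | inj₁ refl = go (tail C) (first-eq C)
            where
            go : ∀ tl → xs ≡ first C ∷ tl → own (first C) ≡ 2
            go [] eq = contradiction (subst (λ xs → 3 ≤ length xs) eq 3≤) λ { (s≤s ()) }
            go (y ∷ []) eq = contradiction (subst (λ xs → 3 ≤ length xs) eq 3≤) λ { (s≤s (s≤s ())) }
            go (y ∷ z ∷ tl) eq = two-neighbours (linked-at [] (subst (Linked _~_) eq (linked C))) fl
              (λ { refl → case unique-last {xs = init C} {ls = [ first C ]} {rs = z ∷ tl}
                                 (subst Unique (last-eq C) (unique C)) (trans (≡-sym (last-eq C)) eq) of λ () })
          ... | inj₂ (inj₁ refl) = go (initLast (init C)) (last-eq C)
            where
            go : ∀ {ini} → InitLast ini → xs ≡ ini ∷ʳ last C → own (last C) ≡ 2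
            go [] eq = contradiction (subst (λ xs → 3 ≤ length xs) eq 3≤) λ { (s≤s ()) }
            go (ys ∷ʳ′ y) eq = two-neighbours (~-sym (linked-at ys (subst (Linked _~_) eq′ (linked C)))) (~-sym fl)
              (λ { refl → contradiction (subst (λ ys → 3 ≤ length (ys ++ y ∷ last C ∷ []))
                     (unique-first (first C) (subst Unique (first-eq C) (unique C)) (trans (≡-sym (first-eq C)) eq′))
                     (subst (λ xs → 3 ≤ length xs) eq′ 3≤)) λ { (s≤s (s≤s ())) } })
              where
              eq′ : xs ≡ ys ++ y ∷ last C ∷ []
              eq′ = trans eq (++-assoc ys [ y ] _)

          -- Around a cycle, the run at one end continues with the run at the other end.
          join : ∀ {u v} → Cyclic → (R : Run xs u) (R′ : Run xs v) → Run.rs R ≡ [] → Run.ls R′ ≡ [] →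
                 ∀ {t} → T t → Piece (Run.p R ++ Run.p R′)
          join cyc R R′ refl refl Tt = record
            { xs = xs ; xs∈ = xs∈
            ; ⊆xs = λ v∈ → [ p⊆xs R , p⊆xs R′ ]′ (∈-++⁻ R.p v∈)
            ; free = λ v∈ → [ R.free , R′.free ]′ (∈-++⁻ R.p v∈)
            ; size = ≤-trans (≤-reflexive (length-++ R.p)) (≤-trans
                (+-mono-≤ (free-suffix (chopOf xs) hits R.ls R.p Req R.free)
                          (free-prefix (chopOf xs) hits R′.p R′.rs R′.eq R′.free))
                (≤-trans (n≤1+n _) (T⇒bound Tt)))
            ; end = λ a∈ a-end → contradiction (subst (_≤ 1) (cyclic-own cyc
                ([ p⊆xs R , p⊆xs R′ ]′ (∈-++⁻ R.p a∈))) a-end) λ { (s≤s ()) }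
            ; closed′ = closed″ }
            where
            module R = Run R
            module R′ = Run R′
            Req : xs ≡ R.ls ++ R.p
            Req = trans R.eq (cong (R.ls ++_) (++-identityʳ R.p))
            wraps : ∀ {a b} → Wraps C a b → b ∈ R.p ++ R′.p
            wraps (inj₁ (_ , refl)) = ∈-++⁺ˡ (last∈suffix R.ls R.p Req R.u∈p)
            wraps (inj₂ (_ , refl)) = ∈-++⁺ʳ R.p (first∈prefix R′.p R′.rs R′.eq R′.u∈p)
            closed″ : ∀ {a b} → a ∈ R.p ++ R′.p → a ~ b → b ∈ R.p ++ R′.p ⊎ T b
            closed″ a∈ ab with ∈-++⁻ R.p a∈
            ... | inj₁ a∈p with run-closed R a∈p ab
            ...   | inj₁ b∈ = inj₁ (∈-++⁺ˡ b∈)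
            ...   | inj₂ (inj₁ Tb) = inj₂ Tb
            ...   | inj₂ (inj₂ w) = inj₁ (wraps w)
            closed″ a∈ ab | inj₂ a∈p′ with run-closed R′ a∈p′ ab
            ...   | inj₁ b∈ = inj₁ (∈-++⁺ʳ R.p b∈)
            ...   | inj₂ (inj₁ Tb) = inj₂ Tb
            ...   | inj₂ (inj₂ w) = inj₁ (wraps w)

          ends-hit : ∀ {u} (R : Run xs u) → Run.ls R ≢ [] → Run.rs R ≢ [] → ∀ {b a} → a ∈ Run.p R → ¬ Wraps C a b
          ends-hit R ls≢ rs≢ a∈ (inj₁ (refl , _)) = ls≢ (before-first (Run.ls R) (Run.p R) (Run.rs R) (Run.eq R) a∈)
          ends-hit R ls≢ rs≢ a∈ (inj₂ (refl , _)) = rs≢ (after-last (Run.ls R) (Run.p R) (Run.rs R) (Run.eq R) a∈)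

          whole : ∀ {u} (R : Run xs u) → Run.ls R ≡ [] → Run.rs R ≡ [] → Piece (Run.p R)
          whole R refl refl = run-piece R size
            (λ a∈ ab w → inj₁ (subst (_ ∈_) xs≡p (proj₁ (closed C (p⊆xs R a∈) ab))))
            where
            open Run R
            xs≡p : xs ≡ p
            xs≡p = trans eq (++-identityʳ p)
            size : length p ≤ bound
            size with short-or-segment (chopOf xs)
            ... | inj₁ short = ≤-trans (≤-trans (≤-reflexive (cong length (≡-sym xs≡p))) short) (segment≤bound κ)
            ... | inj₂ (s , s∈) = run-size R (proj₂ (proj₂ (hits s∈)))

          -- A run reaching both ends is the whole component. Any other run is a piece unless it
          -- reaches a listed end of a cycle; it then continues past the closing edge, and is joined
          -- to the run there if the vertex across that edge is not switched.
          piece : ∀ {u} → u ∈ xs → ¬ T u → ∃ λ p → u ∈ p × Piece p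
          piece u∈ ¬Tu = go (run u∈ ¬Tu) Cyclic?
            where
            ∷ʳ≢[] : ∀ {ls} {t : Fin n} {ls′} → ls ≡ ls′ ∷ʳ t → ls ≢ []
            ∷ʳ≢[] {ls′ = ls′} refl eq = case Data.List.Properties.++-conicalʳ ls′ _ eq of λ ()
            go : ∀ {u} (R : Run xs u) → Dec Cyclic → ∃ λ p → u ∈ p × Piece p
            go R cyc? with Run.left R | Run.right R
            go R cyc? | inj₁ ls≡[] | inj₁ rs≡[] = Run.p R , Run.u∈p R , whole R ls≡[] rs≡[]
            go R (no ¬cyc) | inj₂ (_ , _ , _ , Tt) | _ = Run.p R , Run.u∈p R ,
              run-piece R (run-size R Tt) (λ a∈ ab w → run-adjacent R a∈ (acyclic-closed ¬cyc ab w))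
            go R (no ¬cyc) | inj₁ _ | inj₂ (_ , _ , _ , Tt) = Run.p R , Run.u∈p R ,
              run-piece R (run-size R Tt) (λ a∈ ab w → run-adjacent R a∈ (acyclic-closed ¬cyc ab w))
            go R (yes cyc) | inj₂ (_ , _ , ls≡ , Tt) | inj₂ (_ , _ , rs≡ , _) = Run.p R , Run.u∈p R ,
              run-piece R (run-size R Tt)
                (λ a∈ ab w → contradiction w (ends-hit R (∷ʳ≢[] ls≡) (λ rs≡[] → case trans (≡-sym rs≡) rs≡[] of λ ()) a∈))
            go R (yes cyc) | inj₁ ls≡[] | inj₂ (t , _ , rs≡ , Tt) with T? (last C)
            ... | yes Tl = Run.p R , Run.u∈p R , run-piece R (run-size R Tt) λ
              { a∈ ab (inj₁ (_ , refl)) → inj₂ Tl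
              ; a∈ ab (inj₂ (refl , _)) → case trans (≡-sym rs≡) (after-last (Run.ls R) (Run.p R) (Run.rs R) (Run.eq R) a∈) of λ () }
            ... | no ¬Tl with R′ ← run (last∈ C) ¬Tl = Run.p R′ ++ Run.p R , ∈-++⁺ʳ (Run.p R′) (Run.u∈p R) ,
              join cyc R′ R (after-last (Run.ls R′) (Run.p R′) (Run.rs R′) (Run.eq R′) (Run.u∈p R′)) ls≡[] Tt
            go R (yes cyc) | inj₂ (_ , t , ls≡ , Tt) | inj₁ rs≡[] with T? (first C)
            ... | yes Tf = Run.p R , Run.u∈p R , run-piece R (run-size R Tt) λ
              { a∈ ab (inj₂ (_ , refl)) → inj₂ Tf
              ; a∈ ab (inj₁ (refl , _)) → contradiction (before-first (Run.ls R) (Run.p R) (Run.rs R) (Run.eq R) a∈) (∷ʳ≢[] ls≡) }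
            ... | no ¬Tf with R′ ← run (first∈ C) ¬Tf = Run.p R ++ Run.p R′ , ∈-++⁺ˡ (Run.u∈p R) ,
              join cyc R R′ rs≡[] (before-first (Run.ls R′) (Run.p R′) (Run.rs R′) (Run.eq R′) (Run.u∈p R′)) Tt

        piece-of : ∀ {u} → ¬ T u → ∃ λ p → u ∈ p × Piece p
        piece-of {u} = InComponent.piece (home∈ u) (component (home∈ u)) (∈home u)

        newColour : ∀ v → Dec (T v) → ℕ
        newColour v (yes t) = proj₁ (proj₂ (chosen t))
        newColour v (no _) = φ v

        ψ : Fin n → ℕ
        ψ v = newColour v (T? v)

        ψ-free : ∀ {v} → ¬ T v → ψ v ≡ φ v
        ψ-free {v} ¬Tv with T? v
        ... | yes t = contradiction t ¬Tv
        ... | no _ = refl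

        ψ-chosen : ∀ {v} → T v → ∃ λ (s : List (Fin n)) → (s , v , ψ v) ∈ P
        ψ-chosen {v} t with T? v
        ... | yes t′ = proj₁ (chosen t′) , proj₂ (proj₂ (chosen t′))
        ... | no ¬Tv = contradiction t ¬Tv

        ψ-option : ∀ {v} → T v → Option φ v (ψ v)
        ψ-option t = proj₂ (proj₂ (P-option (proj₂ (ψ-chosen t))))

        ψ-proper : Proper ψ
        ψ-proper v = go (T? v)
          where
          go : Dec (T v) → ψ v ∈ L v
          go (yes t) = c∈L (ψ-option t)
          go (no ¬Tv) = subst (_∈ L v) (≡-sym (ψ-free ¬Tv)) (proper φ-min v)

        end-free : ∀ {v} → IsEnd v → ¬ T v
        end-free v-end t = contradiction (subst (_≤ 1) (T-own t) v-end) λ { (s≤s ()) }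

        -- Equal new colours would be a nearby conflict: adjacent switched vertices have different
        -- old colours by `T-isolated`, and `w` does not already have the colour it is switched to.
        switched-apart : ∀ {v w} → T v → T w → adj G v w ≡ true → ψ v ≢ ψ w
        switched-apart {v} {w} tv tw vw ψ≡ with _ , q∈ ← ψ-chosen tv | _ , q∈′ ← ψ-chosen tw =
          no-conflict q∈ q∈′ (adj-irrefl vw) (subst (λ c → (w , c) ∈ N (v , ψ v)) ψ≡
            (N-nearby vw (λ eq → T-isolated tv tw (vw , ≡-sym eq))
              (λ eq → c≢ (ψ-option tw) (trans eq ψ≡))))

        -- The points `x` and `y` are ends of one component, hence equal or opposite. Opposite
        -- points are excluded by an across conflict. At a common point, adjacent `v` and `w` are
        -- excluded by `switched-apart`; otherwise `common-target` isolates `x`, which is then its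
        -- own opposite end and again gives an across conflict.
        only-attachment : ∀ {v w x y p} → T v → T w → Piece p → x ∈ p → y ∈ p →
                          adj G v x ≡ true → φ x ≡ ψ v → adj G w y ≡ true → φ y ≡ ψ w → v ≡ w
        only-attachment {v} {w} {x} {y} tv tw pc x∈ y∈ vx x≡ wy y≡ =
          decidable-stable (v Fin.≟ w) λ v≢w → attached v≢w
            (end-pair (Piece.xs∈ pc) (Piece.⊆xs pc y∈) (Piece.⊆xs pc x∈) y-end x-end)
          where
          ov = ψ-option tv
          ow = ψ-option tw
          x-end = target-end ov vx x≡
          y-end = target-end ow wy y≡
          ψ≡ : ψ v ≡ ψ w
          ψ≡ = trans (≡-sym x≡) (trans (same-colour (component (Piece.xs∈ pc)) (Piece.⊆xs pc x∈) (Piece.⊆xs pc y∈)) y≡)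
          conflict : v ≢ w → adj G (other x) w ≡ true → ⊥
          conflict v≢w ow′ with _ , q∈ ← ψ-chosen tv | _ , q∈′ ← ψ-chosen tw =
            no-conflict q∈ q∈′ v≢w (subst (λ c → (w , c) ∈ N (v , ψ v)) ψ≡
              (N-across vx x≡ ow′ (λ eq → c≢ ow (trans eq ψ≡)) v≢w))
          attached : v ≢ w → y ≡ x ⊎ y ≡ other x → ⊥
          attached v≢w (inj₂ refl) = conflict v≢w (adj-sym wy)
          attached v≢w (inj₁ refl) with adj G w v in wv
          ... | true = switched-apart tv tw (adj-sym wv) ψ≡
          ... | false = conflict v≢w (subst (λ z → adj G z w ≡ true) (≡-sym alone) (adj-sym wy))
            where
            own≡0 : own x ≡ 0
            own≡0 = subst (λ c → cnt φ c x ≡ 0) (≡-sym x≡)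
              (common-target φ-min ov (subst (Option φ w) (≡-sym ψ≡) ow) v≢w wv vx wy x≡)
            alone : other x ≡ x
            alone = decidable-stable (other x Fin.≟ x) λ o≢x →
              let (z , xz) , _ = other-neighbour x-end o≢x in
              contradiction (subst (1 ≤_) own≡0 (neighbours≤own {x} {z ∷ []} ([] ∷ []) λ { (here refl) → xz })) λ ()

        piece-closed : ∀ {p a b} → Piece p → a ∈ p → adj G a b ≡ true → ψ a ≡ ψ b →
                       b ∈ p ⊎ (T b × φ a ≡ ψ b)
        piece-closed {p} {a} {b} pc a∈ ab ψ≡ = go (T? b)
          where
          φa≡ : φ a ≡ ψ b
          φa≡ = trans (≡-sym (ψ-free (Piece.free pc a∈))) ψ≡
          go : Dec (T b) → b ∈ p ⊎ (T b × φ a ≡ ψ b)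
          go (yes t) = inj₂ (t , φa≡)
          go (no ¬Tb) with Piece.closed′ pc a∈ (ab , trans φa≡ (ψ-free ¬Tb))
          ... | inj₁ b∈ = inj₁ b∈
          ... | inj₂ t = contradiction t ¬Tb

        AroundSwitched : Fin n → List (Fin n) → Set
        AroundSwitched v W = v ∈ W × length W ≤ bound × (∀ {a b} → a ∈ W → adj G a b ≡ true → ψ a ≡ ψ b → b ∈ W)

        -- Each of the two pieces contains a target, which is an end, so it has at most `E`
        -- vertices. Both targets may lie in the same piece; it is then listed twice, which the
        -- bound 1 + 2E allows.
        around : ∀ {v x y p q} → T v → (∀ {z} → adj G v z ≡ true → φ z ≡ ψ v → z ≡ x ⊎ z ≡ y) →
                 adj G v x ≡ true → φ x ≡ ψ v → adj G v y ≡ true → φ y ≡ ψ v →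
                 x ∈ p → Piece p → y ∈ q → Piece q → AroundSwitched v (v ∷ p ++ q)
        around {v} {x} {y} {p} {q} tv targets-xy vx x≡ vy y≡ x∈ pp y∈ pq =
          here refl , size , closed″
          where
          size : length (v ∷ p ++ q) ≤ bound
          size = ≤-trans (s≤s (≤-trans (≤-reflexive (length-++ p))
            (+-mono-≤ (Piece.end pp x∈ (target-end (ψ-option tv) vx x≡))
                      (Piece.end pq y∈ (target-end (ψ-option tv) vy y≡))))) (T⇒bound tv)
          at-v : ∀ {b} → adj G v b ≡ true → ψ v ≡ ψ b → Dec (T b) → b ∈ v ∷ p ++ q
          at-v vb ψ≡ (yes tb) = contradiction ψ≡ (switched-apart tv tb vb)
          at-v vb ψ≡ (no ¬Tb) with targets-xy vb (trans (≡-sym (ψ-free ¬Tb)) (≡-sym ψ≡))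
          ... | inj₁ refl = there (∈-++⁺ˡ x∈)
          ... | inj₂ refl = there (∈-++⁺ʳ p y∈)
          closed″ : ∀ {a b} → a ∈ v ∷ p ++ q → adj G a b ≡ true → ψ a ≡ ψ b → b ∈ v ∷ p ++ q
          closed″ {b = b} (here refl) ab ψ≡ = at-v ab ψ≡ (T? b)
          closed″ (there a∈) ab ψ≡ with ∈-++⁻ p a∈
          ... | inj₁ a∈p with piece-closed pp a∈p ab ψ≡
          ...   | inj₁ b∈ = there (∈-++⁺ˡ b∈)
          ...   | inj₂ (tb , a≡) = here (≡-sym (only-attachment tv tb pp x∈ a∈p vx x≡ (adj-sym ab) a≡))
          closed″ (there a∈) ab ψ≡ | inj₂ a∈q with piece-closed pq a∈q ab ψ≡
          ...   | inj₁ b∈ = there (∈-++⁺ʳ p b∈)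
          ...   | inj₂ (tb , a≡) = here (≡-sym (only-attachment tv tb pq y∈ a∈q vy y≡ (adj-sym ab) a≡))

        two-targets : ∀ {v} → T v → ∃₂ λ x y → (adj G v x ≡ true × φ x ≡ ψ v) × (adj G v y ≡ true × φ y ≡ ψ v) ×
                      (∀ {z} → adj G v z ≡ true → φ z ≡ ψ v → z ≡ x ⊎ z ≡ y)
        two-targets {v} tv = go (targets v (ψ v)) refl (trans (length-select (hasColour φ (ψ v) v)) (new≡2 (ψ-option tv)))
          where
          go : ∀ xs → xs ≡ targets v (ψ v) → length xs ≡ 2 →
               ∃₂ λ x y → (adj G v x ≡ true × φ x ≡ ψ v) × (adj G v y ≡ true × φ y ≡ ψ v) ×
                      (∀ {z} → adj G v z ≡ true → φ z ≡ ψ v → z ≡ x ⊎ z ≡ y)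
          go (x ∷ y ∷ []) eq _ = x , y , target (here refl) , target (there (here refl)) , only
            where
            target : ∀ {z} → z ∈ x ∷ y ∷ [] → adj G v z ≡ true × φ z ≡ ψ v
            target {z} z∈ = hasColour⁻ {φ} {ψ v} {v} (select⁻ {p = hasColour φ (ψ v) v} (subst (z ∈_) eq z∈))
            only : ∀ {z} → adj G v z ≡ true → φ z ≡ ψ v → z ≡ x ⊎ z ≡ y
            only {z} vz z≡ with subst (z ∈_) (≡-sym eq) (select⁺ {p = hasColour φ (ψ v) v} (hasColour⁺ {φ} vz z≡))
            ... | here z≡x = inj₁ z≡x
            ... | there (here z≡y) = inj₂ z≡y

        target-piece : ∀ {v x} → T v → adj G v x ≡ true → φ x ≡ ψ v → ∃ λ p → x ∈ p × Piece p
        target-piece tv vx x≡ = piece-of (end-free (target-end (ψ-option tv) vx x≡))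

        SmallClosed : Fin n → Set
        SmallClosed u = ∃ λ W → u ∈ W × length W ≤ bound × (∀ {a b} → a ∈ W → adj G a b ≡ true → ψ a ≡ ψ b → b ∈ W)

        around-switched : ∀ {v} → T v → SmallClosed v
        around-switched tv =
          let x , y , (vx , x≡) , (vy , y≡) , only = two-targets tv
              p , x∈ , pp = target-piece tv vx x≡
              q , y∈ , pq = target-piece tv vy y≡
          in _ , around tv only vx x≡ vy y≡ x∈ pp y∈ pq

        around-attached : ∀ {u p a v} → u ∈ p → Piece p → a ∈ p → T v → adj G v a ≡ true → φ a ≡ ψ v → SmallClosed u
        around-attached {u} {p} {a} {v} u∈ pp a∈ tv va a≡ =
          let x , y , (vx , x≡) , (vy , y≡) , only = two-targets tv
          in [ (λ a≡x → let q , y∈ , pq = target-piece tv vy y≡ in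
                 v ∷ p ++ q , there (∈-++⁺ˡ u∈) ,
                 proj₂ (around tv only vx x≡ vy y≡ (subst (_∈ p) a≡x a∈) pp y∈ pq))
             , (λ a≡y → let q , x∈ , pq = target-piece tv vx x≡ in
                 v ∷ q ++ p , there (∈-++⁺ʳ q u∈) ,
                 proj₂ (around tv only vx x≡ vy y≡ x∈ pq (subst (_∈ p) a≡y a∈) pp)) ]′ (only va a≡)

        attachment? : ∀ a → Dec (∃ λ v → T v × adj G v a ≡ true × φ a ≡ ψ v)
        attachment? a = Fin.any? (λ v → T? v ×-dec (adj G v a Data.Bool.≟ true) ×-dec (φ a ≟ ψ v))

        clustered : Clustered G ψ bound
        clustered u = go (T? u)
          where
          from-piece : (p : List (Fin n)) → u ∈ p → Piece p → Dec (Any (λ a → ∃ λ v → T v × adj G v a ≡ true × φ a ≡ ψ v) p) →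
                       SmallClosed u
          from-piece p u∈ pp (yes attached) =
            let a , a∈ , v , tv , va , a≡ = find attached in around-attached u∈ pp a∈ tv va a≡
          from-piece p u∈ pp (no unattached) = p , u∈ , Piece.size pp , λ {a} {b} a∈ ab ψ≡ →
            [ id , (λ (tb , a≡) → contradiction (lose a∈ (b , tb , adj-sym ab , a≡)) unattached) ]′
              (piece-closed pp a∈ ab ψ≡)
          go : Dec (T u) → SmallClosed u
          go (yes tu) = around-switched tu
          go (no ¬Tu) = let p , u∈ , pp = piece-of ¬Tu in from-piece p u∈ pp (any? attachment? p)

      broken : ∃ λ ψ → Proper ψ × Clustered G ψ (clusterBound κ)
      broken = go choice-exists
        where
        go : ∃ IsChosen → ∃ λ ψ → Proper ψ × Clustered G ψ (clusterBound κ)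
        go (P , P∈ , P-ind , P! , P-hits) =
          Switch.ψ P P∈ P-ind P! P-hits , Switch.ψ-proper P P∈ P-ind P! P-hits , Switch.clustered P P∈ P-ind P! P-hits

  broken-up : ∃ λ ψ → Proper ψ × Clustered G ψ (clusterBound κ)
  broken-up = broken (cover (allFin n))
    (Chopping.chopUp {Fin n} (segmentLength κ) (≤-trans (n≤1+n 1) (2≤segmentLength κ)))

sparse⇒clustered : ∀ {n} (G : Graph n) (L : Fin n → List ℕ) (L! : ∀ v → Unique (L v)) (κ : ℕ)
  (|L|≤ : ∀ v → length (L v) ≤ suc κ)
  (sparse : ∀ {S} → Unique S → 0 < length S →
            ∑ S (λ v → count (adj G v) + ∑ S (λ w → b2n (adj G v w))) < ∑ S (λ v → 3 * length (L v))) →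
  ∃ λ ψ → (∀ v → ψ v ∈ L v) × Clustered G ψ (clusterBound κ)
sparse⇒clustered {n} G L L! κ |L|≤ sparse = go (Colourings.min-exists G L L! deg<)
  where
  deg< = Clustering.deg<3|L| G L L! κ |L|≤ sparse
  deg≤ = Clustering.deg≤ G L L! κ |L|≤ sparse
  go : ∃ (Colourings.IsMin G L L! deg<) → ∃ λ ψ → (∀ v → ψ v ∈ L v) × Clustered G ψ (clusterBound κ)
  go (φ , φ-min) = Breaking.broken-up G L L! κ |L|≤ sparse deg< deg≤ φ φ-min

-- Reduction to the sparse case.

b2n-∧ : ∀ a b → b2n (a ∧ b) ≡ b2n a * b2n b
b2n-∧ true b = ≡-sym (+-identityʳ (b2n b))
b2n-∧ false b = refl

_⊆ᵇ_ : ∀ {n} → (Fin n → Bool) → (Fin n → Bool) → Set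
B ⊆ᵇ X = ∀ v → B v ≡ true → X v ≡ true

count-cong : ∀ {n} {p q : Fin n → Bool} → p ≗ q → count p ≡ count q
count-cong {n} p≗q = ∑-cong (allFin n) (λ v → cong b2n (p≗q v))

count-pos : ∀ {n} {p : Fin n → Bool} v → p v ≡ true → 0 < count p
count-pos v pv = unique≤count {xs = v ∷ []} ([] ∷ []) λ { (here refl) → pv }

module Degrees {n : ℕ} (G : Graph n) where

  degᵢₙ : (Fin n → Bool) → Fin n → ℕ
  degᵢₙ X v = count (λ w → adj G v w ∧ X w)

  ∑-symmetric : ∀ B S → ∑V (λ v → b2n (B v) * degᵢₙ S v) ≡ ∑V (λ v → b2n (S v) * degᵢₙ B v)
  ∑-symmetric B S = begin
    ∑V (λ v → b2n (B v) * degᵢₙ S v)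
      ≡⟨ ∑-cong (allFin n) (λ v → ∑-* (allFin n) (b2n (B v)) _) ⟨
    ∑V (λ v → ∑V (λ w → b2n (B v) * b2n (adj G v w ∧ S w)))
      ≡⟨ ∑-swap (allFin n) (allFin n) _ ⟩
    ∑V (λ w → ∑V (λ v → b2n (B v) * b2n (adj G v w ∧ S w)))
      ≡⟨ ∑-cong (allFin n) (λ w → trans (∑-cong (allFin n) (pointwise w)) (∑-* (allFin n) (b2n (S w)) _)) ⟩
    ∑V (λ w → b2n (S w) * degᵢₙ B w) ∎
    where
    open ≡-Reasoning
    shape : ∀ b a s → b * (a * s) ≡ s * (a * b)
    shape = solve-∀
    pointwise : ∀ w v → b2n (B v) * b2n (adj G v w ∧ S w) ≡ b2n (S w) * b2n (adj G w v ∧ B v)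
    pointwise w v rewrite b2n-∧ (adj G v w) (S w) | b2n-∧ (adj G w v) (B v) | Graph.sym G v w =
      shape (b2n (B v)) (b2n (adj G w v)) (b2n (S w))

  degᵢₙ-cong : ∀ {X Y} → X ≗ Y → ∀ v → degᵢₙ X v ≡ degᵢₙ Y v
  degᵢₙ-cong X≗Y v = count-cong (λ w → cong (adj G v w ∧_) (X≗Y w))

  degᵢₙ-split : ∀ {X Y Z} → (∀ v → b2n (X v) ≡ b2n (Y v) + b2n (Z v)) → ∀ v → degᵢₙ X v ≡ degᵢₙ Y v + degᵢₙ Z v
  degᵢₙ-split {X} {Y} {Z} X≡ v = trans (∑-cong (allFin n) pointwise) (∑-+ (allFin n) _ _)
    where
    pointwise : ∀ w → b2n (adj G v w ∧ X w) ≡ b2n (adj G v w ∧ Y w) + b2n (adj G v w ∧ Z w)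
    pointwise w with adj G v w
    ... | true = X≡ w
    ... | false = refl

  -- Equals 4 e(B) + e(B, X ∖ B).
  weight : (Fin n → Bool) → (Fin n → Bool) → ℕ
  weight X B = ∑V (λ v → b2n (B v) * (degᵢₙ X v + degᵢₙ B v))

  -- The hypothesis says that `U` is the disjoint union of `B` and `S`. The terms of `B` grow by the
  -- edges from `B` to `S`; read from the side of `S` through `∑-symmetric`, these supply the second
  -- copy of the degree into `B`.
  weight-∪ : ∀ X {B S U} → (∀ v → b2n (U v) ≡ b2n (B v) + b2n (S v)) →
             weight X U ≡ weight X B + ∑V (λ v → b2n (S v) * (degᵢₙ X v + degᵢₙ S v + 2 * degᵢₙ B v))
  weight-∪ X {B} {S} {U} U≡ = begin
    weight X U
      ≡⟨ ∑-cong (allFin n) (λ v → trans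
           (cong₂ (λ u d → u * (degᵢₙ X v + d)) (U≡ v) (degᵢₙ-split U≡ v))
           (expand (b2n (B v)) (b2n (S v)) (degᵢₙ X v) (degᵢₙ B v) (degᵢₙ S v))) ⟩
    ∑V (λ v → b2n (B v) * (degᵢₙ X v + degᵢₙ B v) + (b2n (S v) * (degᵢₙ X v + degᵢₙ S v + degᵢₙ B v) + b2n (B v) * degᵢₙ S v))
      ≡⟨ trans (∑-+ (allFin n) _ _) (cong (weight X B +_) (∑-+ (allFin n) _ _)) ⟩
    weight X B + (∑V (λ v → b2n (S v) * (degᵢₙ X v + degᵢₙ S v + degᵢₙ B v)) + ∑V (λ v → b2n (B v) * degᵢₙ S v))
      ≡⟨ cong (λ m → weight X B + (∑V (λ v → b2n (S v) * (degᵢₙ X v + degᵢₙ S v + degᵢₙ B v)) + m)) (∑-symmetric B S) ⟩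
    weight X B + (∑V (λ v → b2n (S v) * (degᵢₙ X v + degᵢₙ S v + degᵢₙ B v)) + ∑V (λ v → b2n (S v) * degᵢₙ B v))
      ≡⟨ cong (weight X B +_) (∑-+ (allFin n) _ _) ⟨
    weight X B + ∑V (λ v → b2n (S v) * (degᵢₙ X v + degᵢₙ S v + degᵢₙ B v) + b2n (S v) * degᵢₙ B v)
      ≡⟨ cong (weight X B +_) (∑-cong (allFin n) (λ v → collect (b2n (S v)) (degᵢₙ X v + degᵢₙ S v) (degᵢₙ B v))) ⟩
    weight X B + ∑V (λ v → b2n (S v) * (degᵢₙ X v + degᵢₙ S v + 2 * degᵢₙ B v)) ∎
    where
    open ≡-Reasoning
    expand : ∀ b s x p q → (b + s) * (x + (p + q)) ≡ b * (x + p) + (s * (x + q + p) + b * q)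
    expand = solve-∀
    collect : ∀ s x p → s * (x + p) + s * p ≡ s * (x + 2 * p)
    collect = solve-∀

  weight-cong : ∀ X {B C} → B ≗ C → weight X B ≡ weight X C
  weight-cong X B≗C = ∑-cong (allFin n) (λ v → cong₂ (λ b d → b2n b * (degᵢₙ X v + d)) (B≗C v) (degᵢₙ-cong B≗C v))

  record Core (k : ℕ) (X : Fin n → Bool) : Set where
    field
      B       : Fin n → Bool
      B⊆X     : B ⊆ᵇ X
      B<X     : count B < count X
      reduced : ∀ S → (∀ v → S v ≡ true → X v ≡ true × B v ≡ false) → 0 < count S →
                ∑V (λ v → b2n (S v) * (degᵢₙ X v + degᵢₙ S v + 2 * degᵢₙ B v)) < 3 * k * count S

  -- B is a largest subset of X with weight at least 3k∣B∣; X itself is too light by sparseness.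
  core : ∀ k X → 2 * ∑V (λ v → b2n (X v) * degᵢₙ X v) < 3 * k * count X → Core k X
  -- A largest set is one with fewest vertices outside it; the search starts from the empty set,
  -- which is trivially heavy.
  core k X sparse = finish (minimise (λ _ → true ∷ false ∷ []) Heavy? Heavy-resp
      (λ B → count (not ∘ B)) (λ B≗C → count-cong (λ v → cong not (B≗C v)))
      (λ _ → false) (λ _ → there (here refl)) ((λ _ ()) , ≤-trans (≤-reflexive empty) z≤n))
    where
    Heavy : (Fin n → Bool) → Set
    Heavy B = (∀ v → B v ≡ true → X v ≡ true) × 3 * k * count B ≤ weight X B
    Heavy? : Decidable Heavy
    Heavy? B = Fin.all? (λ v → (B v Data.Bool.≟ true) →-dec (X v Data.Bool.≟ true)) ×-dec (3 * k * count B ≤? weight X B)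
    Heavy-resp : ∀ {B C} → B ≗ C → Heavy B → Heavy C
    Heavy-resp B≗C (B⊆X , B-heavy) =
      (λ v Cv → B⊆X v (trans (B≗C v) Cv)) ,
      subst₂ (λ c w → 3 * k * c ≤ w) (count-cong B≗C) (weight-cong X B≗C) B-heavy
    empty : 3 * k * count {n} (λ _ → false) ≡ 0
    empty = trans (cong (3 * k *_) (∑-zero (allFin n))) (*-zeroʳ (3 * k))
    either : ∀ b → b ∈ true ∷ false ∷ []
    either true = here refl
    either false = there (here refl)

    finish : (∃ λ B → (∀ v → B v ∈ true ∷ false ∷ []) × Heavy B ×
               (∀ C → (∀ v → C v ∈ true ∷ false ∷ []) → Heavy C → count (not ∘ B) ≤ count (not ∘ C))) → Core k X
    finish (B , _ , (B⊆X , B-heavy) , B-largest) = record { B = B ; B⊆X = B⊆X ; B<X = B<X ; reduced = reduced }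
      where
      B<X : count B < count X
      B<X with Fin.any? (λ v → (X v Data.Bool.≟ true) ×-dec (B v Data.Bool.≟ false))
      ... | yes (v , Xv , ¬Bv) = count-strict v B⊆X Xv ¬Bv
      -- If `B` were all of `X`, its weight would be twice the degree sum inside `X`, which
      -- sparseness makes too small.
      ... | no none = contradiction (begin-strict
              3 * k * count X                         ≡⟨ cong (3 * k *_) (count-cong B≗X) ⟨
              3 * k * count B                         ≤⟨ B-heavy ⟩
              weight X B                              ≡⟨ weight-cong X B≗X ⟩
              weight X X                              ≡⟨ ∑-cong (allFin n) (λ v → double (b2n (X v)) (degᵢₙ X v)) ⟩
              ∑V (λ v → 2 * (b2n (X v) * degᵢₙ X v))  ≡⟨ ∑-* (allFin n) 2 _ ⟩
              2 * ∑V (λ v → b2n (X v) * degᵢₙ X v)    <⟨ sparse ⟩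
              3 * k * count X                         ∎) (<-irrefl refl)
        where
        open ≤-Reasoning
        double : ∀ x d → x * (d + d) ≡ 2 * (x * d)
        double = solve-∀
        B≗X : B ≗ X
        B≗X v with B v in Bv | X v in Xv
        ... | true | true = refl
        ... | false | false = refl
        ... | true | false = trans (≡-sym (B⊆X v Bv)) Xv
        ... | false | true = contradiction (v , Xv , Bv) none
      reduced : ∀ S → (∀ v → S v ≡ true → X v ≡ true × B v ≡ false) → 0 < count S →
                ∑V (λ v → b2n (S v) * (degᵢₙ X v + degᵢₙ S v + 2 * degᵢₙ B v)) < 3 * k * count S
      -- A set `S` gaining enough weight would make the union of `B` and `S` heavy, with fewer
      -- vertices outside it.
      reduced S S⊆ S>0 = ≰⇒> λ S-heavy → contradiction (B-largest U (λ v → either (U v)) (U⊆X , (begin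
          3 * k * count U                   ≡⟨ cong (3 * k *_) |U| ⟩
          3 * k * (count B + count S)       ≡⟨ *-distribˡ-+ (3 * k) (count B) (count S) ⟩
          3 * k * count B + 3 * k * count S ≤⟨ +-mono-≤ B-heavy S-heavy ⟩
          weight X B + ∑V (λ v → b2n (S v) * (degᵢₙ X v + degᵢₙ S v + 2 * degᵢₙ B v)) ≡⟨ weight-∪ X {B} {S} {U} U≡ ⟨
          weight X U                        ∎)))
          (<⇒≱ (begin-strict
            count (not ∘ U)             <⟨ m<m+n _ S>0 ⟩
            count (not ∘ U) + count S   ≡⟨ ∑-+ (allFin n) _ _ ⟨
            ∑V (λ v → b2n (not (U v)) + b2n (S v)) ≡⟨ ∑-cong (allFin n) complement ⟩
            count (not ∘ B)             ∎))
        where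
        open ≤-Reasoning
        U : Fin n → Bool
        U v = B v ∨ S v
        U≡ : ∀ v → b2n (U v) ≡ b2n (B v) + b2n (S v)
        U≡ v with B v in Bv | S v in Sv
        ... | true | true = case trans (≡-sym Bv) (proj₂ (S⊆ v Sv)) of λ ()
        ... | true | false = refl
        ... | false | _ = refl
        |U| : count U ≡ count B + count S
        |U| = trans (∑-cong (allFin n) U≡) (∑-+ (allFin n) _ _)
        U⊆X : ∀ v → U v ≡ true → X v ≡ true
        U⊆X v Uv with B v in Bv | S v in Sv
        ... | true | _ = B⊆X v Bv
        ... | false | true = proj₁ (S⊆ v Sv)
        complement : ∀ v → b2n (not (U v)) + b2n (S v) ≡ b2n (not (B v))
        complement v with B v in Bv | S v in Sv
        ... | true | true = case trans (≡-sym Bv) (proj₂ (S⊆ v Sv)) of λ ()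
        ... | true | false = refl
        ... | false | true = refl
        ... | false | false = refl

length-filter-¬ : ∀ {A : Set} {P : A → Set} (P? : Decidable P) xs →
                  length (filter (¬? ∘ P?) xs) + length (filter P? xs) ≡ length xs
length-filter-¬ P? [] = refl
length-filter-¬ P? (x ∷ xs) with does (P? x)
... | true = trans (+-suc _ _) (cong suc (length-filter-¬ P? xs))
... | false = cong suc (length-filter-¬ P? xs)

module ListColouring {n : ℕ} (G : Graph n) (L : Fin n → List ℕ) (κ : ℕ)
  (L! : ∀ v → Unique (L v)) (L-long : ∀ v → suc κ ≤ length (L v))
  (sparse : ∀ X → 0 < count X →
            2 * ∑V (λ v → b2n (X v) * Degrees.degᵢₙ G X v) < 3 * suc κ * count X) where
  open Degrees G
  open Counting G using (adj-sym)

  k : ℕ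
  k = suc κ

  record Colourable (X : Fin n → Bool) : Set where
    field
      colour : Fin n → ℕ
      proper : ∀ v → X v ≡ true → colour v ∈ L v
      small  : ∀ u → X u ≡ true → ∃ λ W → u ∈ W × length W ≤ clusterBound κ ×
               (∀ {a b} → a ∈ W → X a ≡ true → X b ≡ true → adj G a b ≡ true → colour a ≡ colour b → b ∈ W)

  module Extend (X : Fin n → Bool) (C : Core k X) (col : Colourable (Core.B C)) where
    open Core C
    open Colourable col renaming (colour to colB; proper to colB-proper; small to colB-small)

    A : Fin n → Bool
    A v = X v ∧ not (B v)

    A⁻ : ∀ {v} → A v ≡ true → X v ≡ true × B v ≡ false
    A⁻ {v} Av with X v | B v
    ... | true | false = refl , refl

    -- The graph induced on `A`, kept on the full vertex set: vertices outside `A` become isolated.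
    H : Graph n
    H = record
      { adj = λ u w → adj G u w ∧ (A u ∧ A w)
      ; sym = λ u w → cong₂ _∧_ (Graph.sym G u w) (Data.Bool.Properties.∧-comm (A u) (A w))
      ; irrefl = λ v → cong (_∧ (A v ∧ A v)) (irrefl G v) }

    inner-neighbours : Fin n → Fin n → Bool
    inner-neighbours v w = adj G v w ∧ B w

    used? : ∀ v c → Dec (Any (λ w → c ≡ colB w) (select (inner-neighbours v)))
    used? v c = any? (λ w → c ≟ colB w) (select (inner-neighbours v))

    -- The given lists may be long, and they are first cut to `k` colours: the upper bound on list
    -- sizes is what later bounds degrees by 3κ + 2.
    free : Fin n → List ℕ
    free v = filter (¬? ∘ used? v) (take k (L v))

    -- Outside `A` the colour 0 is a placeholder: sparseness demands a nonempty list even at an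
    -- isolated vertex.
    L′ : Fin n → List ℕ
    L′ v = if A v then free v else [ 0 ]

    take-unique : ∀ v → Unique (take k (L v))
    take-unique v = Unique.take⁺ k (L! v)

    L′-unique : ∀ v → Unique (L′ v)
    L′-unique v with A v
    ... | true = Unique.filter⁺ (¬? ∘ used? v) (take-unique v)
    ... | false = [] ∷ []

    |take| : ∀ v → length (take k (L v)) ≡ k
    |take| v = trans (length-take k (L v)) (m≤n⇒m⊓n≡m (L-long v))

    L′-short : ∀ v → length (L′ v) ≤ k
    L′-short v with A v
    ... | true = ≤-trans (Data.List.Properties.length-filter (¬? ∘ used? v) (take k (L v))) (≤-reflexive (|take| v))
    ... | false = s≤s z≤n

    free-large : ∀ v → k ≤ length (free v) + degᵢₙ B v
    free-large v = begin
      k                                                          ≡⟨ |take| v ⟨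
      length (take k (L v))                                      ≡⟨ length-filter-¬ (used? v) (take k (L v)) ⟨
      length (free v) + length (filter (used? v) (take k (L v))) ≤⟨ +-monoʳ-≤ (length (free v)) used-few ⟩
      length (free v) + degᵢₙ B v                                ∎
      where
      open ≤-Reasoning
      used-few : length (filter (used? v) (take k (L v))) ≤ degᵢₙ B v
      used-few = ≤-trans
        (unique-⊆⇒length≤ {ys = map colB (select (inner-neighbours v))} (Unique.filter⁺ (used? v) (take-unique v)) λ c∈ →
          let w , w∈ , eq = find (proj₂ (∈-filter⁻ (used? v) {xs = take k (L v)} c∈))
          in subst (_∈ _) (≡-sym eq) (∈-map⁺ colB w∈))
        (≤-reflexive (trans (length-map colB (select (inner-neighbours v))) (length-select (inner-neighbours v))))

    -- Only the part `S′` of `S` inside `A` has edges in `H`. If it is nonempty, the maximality of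
    -- `B` applies to it; if it is empty, the left side is 0 and the placeholder lists make the
    -- right side positive.
    sparse′ : ∀ {S} → Unique S → 0 < length S →
              ∑ S (λ v → count (adj H v) + ∑ S (λ w → b2n (adj H v w))) < ∑ S (λ v → 3 * length (L′ v))
    sparse′ {S} S! S>0 = begin-strict
      ∑ S (λ v → count (adj H v) + ∑ S (λ w → b2n (adj H v w)))
        ≡⟨ to-mask (λ v → count (adj H v) + ∑ S (λ w → b2n (adj H v w))) ⟨
      ∑V (λ v → b2n (I v) * (count (adj H v) + ∑ S (λ w → b2n (adj H v w))))
        ≡⟨ ∑-cong (allFin n) pointwise ⟩
      ∑V (λ v → b2n (S′ v) * (degᵢₙ A v + degᵢₙ S′ v))
        <⟨ go (Fin.any? (λ v → S′ v Data.Bool.≟ true)) ⟩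
      ∑ S (λ v → 3 * length (L′ v)) ∎
      where
      open ≤-Reasoning
      I S′ : Fin n → Bool
      I v = does (any? (v Fin.≟_) S)
      S′ v = I v ∧ A v
      to-mask : ∀ f → ∑V (λ v → b2n (I v) * f v) ≡ ∑ S f
      to-mask f = ∑-indicator Fin._≟_ (Unique.allFin⁺ n) ∈-allFin S! f
      pointwise : ∀ v → b2n (I v) * (count (adj H v) + ∑ S (λ w → b2n (adj H v w)))
                        ≡ b2n (S′ v) * (degᵢₙ A v + degᵢₙ S′ v)
      pointwise v = trans
        (cong (λ s → b2n (I v) * (count (adj H v) + s)) (≡-sym (to-mask (λ w → b2n (adj H v w)))))
        (trans (cong (b2n (I v) *_) (trans (cong₂ _+_ (∑-cong (allFin n) first-part) (∑-cong (allFin n) second-part))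
                  (trans (cong₂ _+_ (∑-* (allFin n) (b2n (A v)) _) (∑-* (allFin n) (b2n (A v)) _))
                    (≡-sym (*-distribˡ-+ (b2n (A v)) _ _)))))
          (trans (≡-sym (*-assoc (b2n (I v)) (b2n (A v)) _)) (cong (_* (degᵢₙ A v + degᵢₙ S′ v)) (≡-sym (b2n-∧ (I v) (A v))))))
        where
        first-part : ∀ w → b2n (adj H v w) ≡ b2n (A v) * b2n (adj G v w ∧ A w)
        first-part w with adj G v w | A v
        ... | false | true = refl
        ... | false | false = refl
        ... | true | true = ≡-sym (+-identityʳ _)
        ... | true | false = refl
        second-part : ∀ w → b2n (I w) * b2n (adj H v w) ≡ b2n (A v) * b2n (adj G v w ∧ S′ w)
        second-part w with adj G v w | A v | I w
        ... | false | true | true = refl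
        ... | false | true | false = refl
        ... | false | false | true = refl
        ... | false | false | false = refl
        ... | true | true | true = refl
        ... | true | true | false = refl
        ... | true | false | true = refl
        ... | true | false | false = refl
      go : Dec (∃ λ v → S′ v ≡ true) → ∑V (λ v → b2n (S′ v) * (degᵢₙ A v + degᵢₙ S′ v)) < ∑ S (λ v → 3 * length (L′ v))
      -- Three times the degree into `B` is added to both sides. On the left one copy turns the
      -- degree in `A` into that in `X` and the other two are those of `reduced`; on the right they
      -- make up for the deleted colours.
      go (yes (v , S′v)) = ≤-trans (+-cancelʳ-< (∑V (λ v → b2n (S′ v) * (3 * degᵢₙ B v))) _ _ (begin-strict
          ∑V (λ v → b2n (S′ v) * (degᵢₙ A v + degᵢₙ S′ v)) + ∑V (λ v → b2n (S′ v) * (3 * degᵢₙ B v))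
            ≡⟨ ∑-+ (allFin n) _ _ ⟨
          ∑V (λ v → b2n (S′ v) * (degᵢₙ A v + degᵢₙ S′ v) + b2n (S′ v) * (3 * degᵢₙ B v))
            ≡⟨ ∑-cong (allFin n) (λ v → trans (regroup (b2n (S′ v)) (degᵢₙ A v) (degᵢₙ S′ v) (degᵢₙ B v))
                 (cong (λ d → b2n (S′ v) * (d + degᵢₙ S′ v + 2 * degᵢₙ B v)) (≡-sym (degᵢₙ-split X≡ v)))) ⟩
          ∑V (λ v → b2n (S′ v) * (degᵢₙ X v + degᵢₙ S′ v + 2 * degᵢₙ B v))
            <⟨ reduced S′ (λ v S′v → A⁻ (proj₂ (∧-true⁻ {I v} S′v))) (count-pos v S′v) ⟩
          3 * k * count S′
            ≡⟨ ∑-* (allFin n) (3 * k) _ ⟨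
          ∑V (λ v → 3 * k * b2n (S′ v))
            ≤⟨ ∑-mono (allFin n) list-size ⟩
          ∑V (λ v → b2n (I v) * (3 * length (L′ v)) + b2n (S′ v) * (3 * degᵢₙ B v))
            ≡⟨ ∑-+ (allFin n) _ _ ⟩
          ∑V (λ v → b2n (I v) * (3 * length (L′ v))) + ∑V (λ v → b2n (S′ v) * (3 * degᵢₙ B v)) ∎))
        (≤-reflexive (to-mask (λ v → 3 * length (L′ v))))
        where
        regroup : ∀ s a t b → s * (a + t) + s * (3 * b) ≡ s * (a + b + t + 2 * b)
        regroup = solve-∀
        X≡ : ∀ v → b2n (X v) ≡ b2n (A v) + b2n (B v)
        X≡ v with B v in Bv | X v in Xv
        ... | true | true = refl
        ... | false | true = refl
        ... | false | false = refl
        ... | true | false = case trans (≡-sym Xv) (B⊆X v Bv) of λ ()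
        list-size : ∀ v → 3 * k * b2n (S′ v) ≤ b2n (I v) * (3 * length (L′ v)) + b2n (S′ v) * (3 * degᵢₙ B v)
        list-size v with I v | A v
        ... | false | _ = ≤-reflexive (*-zeroʳ (3 * k))
        ... | true | false = ≤-trans (≤-reflexive (*-zeroʳ (3 * k))) z≤n
        ... | true | true = begin
          3 * k * 1                                        ≡⟨ *-identityʳ (3 * k) ⟩
          3 * k                                            ≤⟨ *-monoʳ-≤ 3 (free-large v) ⟩
          3 * (length (free v) + degᵢₙ B v)                ≡⟨ spread (length (free v)) (degᵢₙ B v) ⟩
          1 * (3 * length (free v)) + 1 * (3 * degᵢₙ B v)  ∎
          where
          spread : ∀ a b → 3 * (a + b) ≡ 1 * (3 * a) + 1 * (3 * b)
          spread = solve-∀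
      go (no none) = ≤-trans (s≤s (≤-reflexive zero-sum)) (positive S refl S>0)
        where
        zero-sum : ∑V (λ v → b2n (S′ v) * (degᵢₙ A v + degᵢₙ S′ v)) ≡ 0
        zero-sum = trans (∑-cong (allFin n) vanish) (∑-zero (allFin n))
          where
          vanish : ∀ v → b2n (S′ v) * (degᵢₙ A v + degᵢₙ S′ v) ≡ 0
          vanish v = cong (λ b → b2n b * (degᵢₙ A v + degᵢₙ S′ v)) (Data.Bool.Properties.¬-not (λ S′v → none (v , S′v)))
        positive : ∀ T → T ≡ S → 0 < length T → 0 < ∑ T (λ v → 3 * length (L′ v))
        positive (x ∷ T) refl _ with A x in Ax
        ... | false = s≤s z≤n
        ... | true = contradiction (x , ∧-true⁺ (dec-true (any? (x Fin.≟_) S) (here refl)) Ax) none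

    extend′ : (∃ λ ψ → (∀ v → ψ v ∈ L′ v) × Clustered H ψ (clusterBound κ)) → Colourable X
    extend′ (ψ , ψ∈ , ψ-small) = record { colour = χ ; proper = χ-proper ; small = χ-small }
      where
      χ : Fin n → ℕ
      χ v = if B v then colB v else ψ v
      χ-B : ∀ {v} → B v ≡ true → χ v ≡ colB v
      χ-B Bv rewrite Bv = refl
      χ-A : ∀ {v} → B v ≡ false → χ v ≡ ψ v
      χ-A Bv rewrite Bv = refl
      A⁺ : ∀ {v} → X v ≡ true → B v ≡ false → A v ≡ true
      A⁺ Xv Bv rewrite Xv | Bv = refl
      ψ-free : ∀ {v} → A v ≡ true → ψ v ∈ free v
      ψ-free {v} Av with ψ v | ψ∈ v
      ... | c | c∈ rewrite Av = c∈
      χ-proper : ∀ v → X v ≡ true → χ v ∈ L v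
      χ-proper v Xv with B v in Bv
      ... | true = colB-proper v Bv
      ... | false = subst (ψ v ∈_) (take++drop≡id k (L v)) (∈-++⁺ˡ
              (proj₁ (∈-filter⁻ (¬? ∘ used? v) {xs = take k (L v)} (ψ-free (A⁺ Xv Bv)))))
      -- The colours of neighbours in `B` were deleted from the list of `a`. Hence no monochromatic
      -- component inside `X` meets both `A` and `B`.
      clash : ∀ {a b} → X a ≡ true → B a ≡ false → B b ≡ true → adj G a b ≡ true → χ a ≢ χ b
      clash {a} {b} Xa Ba Bb ab χ≡ = proj₂ (∈-filter⁻ (¬? ∘ used? a) {xs = take k (L a)} (ψ-free (A⁺ Xa Ba)))
        (lose (select⁺ {p = inner-neighbours a} (∧-true⁺ ab Bb)) (trans (≡-sym (χ-A Ba)) (trans χ≡ (χ-B Bb))))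
      restrict : (Fin n → Bool) → List (Fin n) → List (Fin n)
      restrict p = filter (λ v → p v Data.Bool.≟ true)
      restrict-length : ∀ p W {m} → length W ≤ m → length (restrict p W) ≤ m
      restrict-length p W = ≤-trans (Data.List.Properties.length-filter (λ v → p v Data.Bool.≟ true) W)
      χ-small : ∀ u → X u ≡ true → ∃ λ W → u ∈ W × length W ≤ clusterBound κ ×
                (∀ {a b} → a ∈ W → X a ≡ true → X b ≡ true → adj G a b ≡ true → χ a ≡ χ b → b ∈ W)
      χ-small u Xu = go (true-or-false (B u))
        where
        true-or-false : ∀ b → b ≡ true ⊎ b ≡ false
        true-or-false true = inj₁ refl
        true-or-false false = inj₂ refl
        go : B u ≡ true ⊎ B u ≡ false → ∃ λ W → u ∈ W × length W ≤ clusterBound κ ×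
             (∀ {a b} → a ∈ W → X a ≡ true → X b ≡ true → adj G a b ≡ true → χ a ≡ χ b → b ∈ W)
        -- `W` is known to be closed only under steps between vertices of `B`, so it is cut down to
        -- `B`.
        go (inj₁ Bu) with W , u∈ , |W| , closed ← colB-small u Bu =
          restrict B W , ∈-filter⁺ (λ v → B v Data.Bool.≟ true) u∈ Bu , restrict-length B W |W| , closed′
          where
          closed′ : ∀ {a b} → a ∈ restrict B W → X a ≡ true → X b ≡ true → adj G a b ≡ true → χ a ≡ χ b → b ∈ restrict B W
          closed′ {a} {b} a∈ Xa Xb ab χ≡ with ∈-filter⁻ (λ v → B v Data.Bool.≟ true) {xs = W} a∈ | true-or-false (B b)
          ... | a∈W , Ba | inj₁ Bb = ∈-filter⁺ (λ v → B v Data.Bool.≟ true)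
                  (closed a∈W Ba Bb ab (trans (≡-sym (χ-B Ba)) (trans χ≡ (χ-B Bb)))) Bb
          ... | a∈W , Ba | inj₂ Bb = contradiction (≡-sym χ≡) (clash Xb Bb Ba (adj-sym ab))
        go (inj₂ Bu) with W , u∈ , |W| , closed ← ψ-small u =
          restrict A W , ∈-filter⁺ (λ v → A v Data.Bool.≟ true) u∈ (A⁺ Xu Bu) , restrict-length A W |W| , closed′
          where
          closed′ : ∀ {a b} → a ∈ restrict A W → X a ≡ true → X b ≡ true → adj G a b ≡ true → χ a ≡ χ b → b ∈ restrict A W
          closed′ {a} {b} a∈ Xa Xb ab χ≡ with ∈-filter⁻ (λ v → A v Data.Bool.≟ true) {xs = W} a∈ | true-or-false (B b)
          ... | a∈W , Aa | inj₁ Bb = contradiction χ≡ (clash Xa (proj₂ (A⁻ Aa)) Bb ab)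
          ... | a∈W , Aa | inj₂ Bb = ∈-filter⁺ (λ v → A v Data.Bool.≟ true)
                  (closed a∈W (∧-true⁺ ab (∧-true⁺ Aa (A⁺ Xb Bb)))
                    (trans (≡-sym (χ-A (proj₂ (A⁻ Aa)))) (trans χ≡ (χ-A Bb)))) (A⁺ Xb Bb)

    extension : Colourable X
    extension = extend′ (sparse⇒clustered H L′ L′-unique κ L′-short sparse′)

  colour-within : ∀ m X → count X ≤ m → Colourable X
  colour-within m X X≤m with 0 <? count X
  ... | no X≯0 = record
    { colour = λ _ → 0
    ; proper = λ v Xv → contradiction (count-pos v Xv) X≯0
    ; small = λ v Xv → contradiction (count-pos v Xv) X≯0 }
  colour-within zero X X≤m | yes X>0 = contradiction (≤-trans X>0 X≤m) λ ()
  colour-within (suc m) X X≤m | yes X>0 =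
    Extend.extension X C (colour-within m (Core.B C) (≤-pred (≤-trans (Core.B<X C) X≤m)))
    where
    C : Core k X
    C = core k X (sparse X X>0)

  colourable : ∃ λ χ → (∀ v → χ v ∈ L v) × Clustered G χ (clusterBound κ)
  colourable = colour , (λ v → proper v refl) ,
    λ u → let W , u∈ , |W| , closed = small u refl in W , u∈ , |W| , λ a∈ ab χ≡ → closed a∈ refl refl ab χ≡
    where open Colourable (colour-within (count {n} (λ _ → true)) (λ _ → true) ≤-refl)

-- Closed sets and monochromatic components.

mono⊆closed : ∀ {n} {G : Graph n} {χ : Fin n → ℕ} {u w W} → (∀ {a b} → a ∈ W → adj G a b ≡ true → χ a ≡ χ b → b ∈ W) →
              u ∈ W → MonoConn G χ u w → w ∈ W
mono⊆closed closed u∈ here = u∈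
mono⊆closed closed u∈ (step uv vw eq) = closed (mono⊆closed closed u∈ uv) vw eq

clustered⇒HasClustering : ∀ {n} {G : Graph n} {χ m} → Clustered G χ m → HasClustering G χ m
clustered⇒HasClustering small u xs xs! conn with W , u∈ , |W| , closed ← small u =
  ≤-trans (unique-⊆⇒length≤ xs! (λ x∈ → mono⊆closed closed u∈ (All.lookup conn x∈))) |W|

-- Average degrees and floors as fractions of natural numbers.

avgDeg′-≃ : ∀ s c → toℚᵘ (avgDeg' s (suc c)) ≃ mkℚᵘ (ℤ.+ s) c
avgDeg′-≃ s c = toℚᵘ-fromℚᵘ (mkℚᵘ (ℤ.+ s) c)

avgDeg-fraction : ∀ s c → ∃₂ λ s′ c′ → toℚᵘ (avgDeg' s c) ≃ mkℚᵘ (ℤ.+ s′) c′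
avgDeg-fraction s zero = 0 , 0 , ℚᵘ.≃-refl
avgDeg-fraction s (suc c) = s , c , avgDeg′-≃ s c

-- The fraction `p` is in lowest terms and `a` over `suc d` need not be; each is expanded by the
-- denominator of the other, after which the numerators agree.
floor-≃ : ∀ p a d → toℚᵘ p ≃ mkℚᵘ (ℤ.+ a) d → ⌊ p ⌋ℕ ≡ a / suc d
floor-≃ (mkℚ (ℤ.+ b) e _) a d (*≡* eq) = begin
  ∣ ℤ.+ b ℤ./ ℤ.+ suc e ∣            ≡⟨ cong ∣_∣ (ℤ.div-pos-is-/ℕ (ℤ.+ b) (suc e)) ⟩
  b / suc e                      ≡⟨ m*n/o*n≡m/o b (suc d) (suc e) ⟨
  b * suc d / (suc e * suc d)    ≡⟨ cong (_/ (suc e * suc d)) (ℤ.+-injective (trans (ℤ.pos-* b (suc d)) (trans eq (≡-sym (ℤ.pos-* a (suc e)))))) ⟩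
  a * suc e / (suc e * suc d)    ≡⟨ /-congʳ {m = a * suc e} (*-comm (suc e) (suc d)) ⟩
  a * suc e / (suc d * suc e)    ≡⟨ m*n/o*n≡m/o a (suc e) (suc d) ⟩
  a / suc d                      ∎
  where open ≡-Reasoning
floor-≃ (mkℚ (-[1+ b ]) e _) a d (*≡* eq) = contradiction (trans (ℤ.pos-* a (suc e)) (≡-sym eq)) λ ()

≤-fraction : ∀ {p q} t x s c → toℚᵘ p ≃ mkℚᵘ (ℤ.+ t) x → toℚᵘ q ≃ mkℚᵘ (ℤ.+ s) c → p ≤ℚ q → t * suc c ≤ s * suc x
≤-fraction t x s c p≃ q≃ p≤q with ℚᵘ.≤-respʳ-≃ q≃ (ℚᵘ.≤-respˡ-≃ p≃ (toℚᵘ-mono-≤ p≤q))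
... | *≤* le = ℤ.drop‿+≤+ (subst₂ ℤ._≤_ (≡-sym (ℤ.pos-* t (suc c))) (≡-sym (ℤ.pos-* s (suc x))) le)

suc-fraction : ∀ {p} a d → toℚᵘ p ≃ mkℚᵘ (ℤ.+ a) d → toℚᵘ (p +ℚ 1ℚ) ≃ mkℚᵘ (ℤ.+ (a + suc d)) d
suc-fraction {p} a d p≃ = ℚᵘ.≃-trans (toℚᵘ-homo-+ p 1ℚ) (ℚᵘ.≃-trans (ℚᵘ.+-congˡ (toℚᵘ 1ℚ) p≃) (*≡*
  (cong₂ ℤ._*_ (cong₂ ℤ._+_ (ℤ.*-identityʳ (ℤ.+ a)) (ℤ.*-identityˡ (ℤ.+ suc d)))
               (cong ℤ.+_ (≡-sym (*-identityʳ (suc d)))))))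

-- `mkℚᵘ` stores the denominator less one, whence the `pred`.
twoThirds-fraction : ∀ {m} s c → toℚᵘ m ≃ mkℚᵘ (ℤ.+ s) c → toℚᵘ (twoThirds *ℚ m) ≃ mkℚᵘ (ℤ.+ (2 * s)) (pred (3 * suc c))
twoThirds-fraction {m} s c m≃ = ℚᵘ.≃-trans (toℚᵘ-homo-* twoThirds m)
  (ℚᵘ.≃-trans (ℚᵘ.*-congˡ {toℚᵘ twoThirds} m≃)
    (*≡* (cong (ℤ._* ℤ.+ (3 * suc c)) (≡-sym (ℤ.pos-* 2 s)))))

module _ {n : ℕ} (G : Graph n) where
  open Degrees G

  induced : (Fin n → Bool) → Subgraph G
  induced X = record
    { vert = X
    ; edge = λ u v → X u ∧ (adj G u v ∧ X v)
    ; edge-sym = edge-sym′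
    ; edge-adj = λ u v uv → proj₁ (∧-true⁻ (proj₂ (∧-true⁻ {X u} uv)))
    ; edge-vert = λ u v uv → ∧-true⁺ (proj₁ (∧-true⁻ {X u} uv)) (proj₂ (∧-true⁻ {adj G u v} (proj₂ (∧-true⁻ {X u} uv)))) }
    where
    edge-sym′ : ∀ u v → X u ∧ (adj G u v ∧ X v) ≡ X v ∧ (adj G v u ∧ X u)
    edge-sym′ u v rewrite Graph.sym G u v with X u | X v | adj G v u
    ... | true | true | true = refl
    ... | true | true | false = refl
    ... | true | false | true = refl
    ... | true | false | false = refl
    ... | false | true | true = refl
    ... | false | true | false = refl
    ... | false | false | true = refl
    ... | false | false | false = refl

  degSum-induced : ∀ X → degSum (induced X) ≡ ∑V (λ v → b2n (X v) * degᵢₙ X v)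
  degSum-induced X = ∑-cong (allFin n) λ u →
    trans (∑-cong (allFin n) (λ v → b2n-∧ (X u) (adj G u v ∧ X v))) (∑-* (allFin n) (b2n (X u)) _)

  -- The subgraph induced on `X` has average degree at most `m`, and the floor plus one exceeds
  -- 2m/3. Both inequalities are multiplied out to natural numbers.
  induced-sparse : ∀ m s c → toℚᵘ m ≃ mkℚᵘ (ℤ.+ s) c → (∀ H → avgDeg H ≤ℚ m) →
                   ∀ X → 0 < count X →
                   2 * ∑V (λ v → b2n (X v) * degᵢₙ X v) < 3 * suc (2 * s / (3 * suc c)) * count X
  induced-sparse m s c m≃ max X X>0 = go (count X) refl X>0
    where
    open ≤-Reasoning
    t = ∑V (λ v → b2n (X v) * degᵢₙ X v)
    D = 3 * suc c
    k = suc (2 * s / D)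
    below : 2 * s < k * D
    below = begin-strict
      2 * s                              ≡⟨ m≡m%n+[m/n]*n (2 * s) D ⟩
      2 * s % D + 2 * s / D * D          <⟨ +-monoˡ-< (2 * s / D * D) (m%n<n (2 * s) D) ⟩
      k * D                              ∎
    go : ∀ x → x ≡ count X → 0 < x → 2 * t < 3 * k * count X
    go (suc x) |X| _ = *-cancelʳ-< (suc c) (2 * t) (3 * k * count X) (begin-strict
      2 * t * suc c            ≡⟨ *-assoc 2 t (suc c) ⟩
      2 * (t * suc c)          ≤⟨ *-monoʳ-≤ 2 (≤-fraction t x s c avg m≃ (max (induced X))) ⟩
      2 * (s * suc x)          ≡⟨ *-assoc 2 s (suc x) ⟨
      2 * s * suc x            <⟨ *-monoˡ-< (suc x) below ⟩
      k * D * suc x            ≡⟨ rearrange k (suc c) (suc x) ⟩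
      3 * k * suc x * suc c    ≡⟨ cong (λ x → 3 * k * x * suc c) |X| ⟩
      3 * k * count X * suc c  ∎)
      where
      rearrange : ∀ k c x → k * (3 * c) * x ≡ 3 * k * x * c
      rearrange = solve-∀
      avg : toℚᵘ (avgDeg (induced X)) ≃ mkℚᵘ (ℤ.+ t) x
      avg = subst₂ (λ d c → toℚᵘ (avgDeg' d c) ≃ mkℚᵘ (ℤ.+ t) x) (≡-sym (degSum-induced X)) |X| (avgDeg′-≃ t x)

theorem6 : ∀ {n : ℕ} (G : Graph n) (m : ℚ) → IsMad G m →
    ChoosableWithClustering G ⌊ twoThirds *ℚ m +ℚ 1ℚ ⌋ℕ (57 * ⌊ twoThirds *ℚ m ⌋ℕ + 6)
-- That the maximum is attained exhibits `m` as an average degree, hence as a quotient of natural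
-- numbers, so the floors become natural quotients.
theorem6 {n} G m ((H , refl) , max) = go (avgDeg-fraction (degSum H) (nVert H))
  where
  go : (∃₂ λ s c → toℚᵘ m ≃ mkℚᵘ (ℤ.+ s) c) →
       ChoosableWithClustering G ⌊ twoThirds *ℚ m +ℚ 1ℚ ⌋ℕ (57 * ⌊ twoThirds *ℚ m ⌋ℕ + 6)
  go (s , c , m≃) L L-ok = χ , χ-proper , subst (λ κ → HasClustering G χ (57 * κ + 6)) (≡-sym κ≡) (clustered⇒HasClustering χ-small)
    where
    D = 3 * suc c
    κ = 2 * s / D
    q≃ : toℚᵘ (twoThirds *ℚ m) ≃ mkℚᵘ (ℤ.+ (2 * s)) (pred D)
    q≃ = twoThirds-fraction s c m≃
    κ≡ : ⌊ twoThirds *ℚ m ⌋ℕ ≡ κ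
    κ≡ = floor-≃ (twoThirds *ℚ m) (2 * s) (pred D) q≃
    k≡ : ⌊ twoThirds *ℚ m +ℚ 1ℚ ⌋ℕ ≡ suc κ
    -- Adding 1 adds one full denominator `D` to the numerator, so the quotient grows by exactly
    -- one.
    k≡ = trans (floor-≃ (twoThirds *ℚ m +ℚ 1ℚ) (2 * s + D) (pred D) (suc-fraction {twoThirds *ℚ m} (2 * s) (pred D) q≃))
      (trans (+-distrib-/-∣ʳ (2 * s) (Data.Nat.Divisibility.∣-refl {D}))
        (trans (cong (κ +_) (n/n≡1 D)) (+-comm κ 1)))
    result = ListColouring.colourable G L κ (λ v → proj₁ (L-ok v))
      (λ v → subst (_≤ length (L v)) k≡ (proj₂ (L-ok v))) (induced-sparse G m s c m≃ max)
    χ = proj₁ result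
    χ-proper = proj₁ (proj₂ result)
    χ-small = proj₂ (proj₂ result)
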